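{- Let $G$ be a DQS odd unicyclic graph on $n\geq 7$ vertices. Then for every positive integer $r$, the graph $G\sqcup rK_2$ is DQS.
   Context: All graphs are finite, simple and undirected. For a graph $G$ with adjacency matrix $A_G$ and diagonal degree matrix $D_G$, the signless Laplacian matrix is $Q_G=D_G+A_G$; its multiset of eigenvalues is the $Q$-spectrum. A graph $G$ is DQS if every graph with the same $Q$-spectrum as $G$ is isomorphic to $G$. A connected graph with $n$ vertices and $n$ edges is unicyclic; it is odd unicyclic if its unique cycle has odd length. $G\sqcup H$ denotes disjoint union, $rK_2$ the disjoint union of $r$ copies of the complete graph $K_2$. -}

module Defs where

open import Data.Nat using (ℕ; zero; suc; _+_; _*_; _≤_)
open import Data.Nat.Properties using ()
open import Data.Integer as ℤ using (ℤ; +_; -[1+_])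
open import Data.Fin using (Fin; zero; suc; splitAt; punchIn; inject₁; fromℕ; toℕ; _≟_)
open import Data.Fin.Properties using ()
open import Data.Bool using (Bool; true; false; if_then_else_; _∧_)
open import Data.Sum using (_⊎_; inj₁; inj₂)
open import Data.Product using (Σ; _×_; _,_; ∃)
open import Data.List using (List; []; _∷_; foldr; map; allFin)
open import Data.Nat.ListAction using (sum)
open import Data.Vec.Functional using ()
open import Relation.Nullary using (¬_; yes; no)
open import Relation.Nullary.Decidable using (⌊_⌋)
open import Relation.Binary.PropositionalEquality using (_≡_; refl; sym)
open import Function.Bundles using (_⤖_; Bijection)
open import Function.Definitions using (Injective)
import Data.Nat as ℕ

record Graph (n : ℕ) : Set where
  field
    adj    : Fin n → Fin n → Bool
    adj-sym    : ∀ u v → adj u v ≡ adj v u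
    adj-irrefl : ∀ u → adj u u ≡ false
open Graph public

_≅_ : ∀ {n m} → Graph n → Graph m → Set
_≅_ {n} {m} G H = Σ (Fin n ⤖ Fin m) λ f →
  ∀ u v → adj H (Bijection.to f u) (Bijection.to f v) ≡ adj G u v

count : ∀ {n} → (Fin n → Bool) → ℕ
count {n} p = sum (map (λ i → if p i then 1 else 0) (allFin n))

degree : ∀ {n} → Graph n → Fin n → ℕ
degree G u = count (adj G u)

edgeCount : ∀ {n} → Graph n → ℕ
edgeCount {n} G = sum (map (λ u → count (λ v → adj G u v ∧ ⌊ toℕ u ℕ.<? toℕ v ⌋)) (allFin n))

data Walk {n} (G : Graph n) : Fin n → Fin n → Set where
  [] : ∀ {u} → Walk G u u
  _∷_ : ∀ {u w v} → adj G u w ≡ true → Walk G w v → Walk G u v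

Connected : ∀ {n} → Graph n → Set
Connected G = ∀ u v → Walk G u v

record Cycle {n} (G : Graph n) (j : ℕ) : Set where
  field
    vert   : Fin (3 + j) → Fin n
    inj    : Injective _≡_ _≡_ vert
    step   : ∀ (i : Fin (2 + j)) → adj G (vert (inject₁ i)) (vert (suc i)) ≡ true
    close  : adj G (vert (fromℕ (2 + j))) (vert zero) ≡ true

Unicyclic : ∀ {n} → Graph n → Set
Unicyclic {n} G = Connected G × edgeCount G ≡ n

OddUnicyclic : ∀ {n} → Graph n → Set
OddUnicyclic G = Unicyclic G × Σ ℕ λ j → Σ ℕ λ k → (3 + j ≡ 1 + 2 * k) × Cycle G j

private
  combine : ∀ {n m} → Graph n → Graph m → Fin n ⊎ Fin m → Fin n ⊎ Fin m → Bool
  combine G H (inj₁ a) (inj₁ b) = adj G a b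
  combine G H (inj₂ a) (inj₂ b) = adj H a b
  combine G H (inj₁ _) (inj₂ _) = false
  combine G H (inj₂ _) (inj₁ _) = false

  combine-sym : ∀ {n m} (G : Graph n) (H : Graph m) x y → combine G H x y ≡ combine G H y x
  combine-sym G H (inj₁ a) (inj₁ b) = adj-sym G a b
  combine-sym G H (inj₂ a) (inj₂ b) = adj-sym H a b
  combine-sym G H (inj₁ _) (inj₂ _) = refl
  combine-sym G H (inj₂ _) (inj₁ _) = refl

  combine-irr : ∀ {n m} (G : Graph n) (H : Graph m) x → combine G H x x ≡ false
  combine-irr G H (inj₁ a) = adj-irrefl G a
  combine-irr G H (inj₂ a) = adj-irrefl H a

_⊔_ : ∀ {n m} → Graph n → Graph m → Graph (n + m)
_⊔_ {n} G H = record
  { adj = λ u v → combine G H (splitAt n u) (splitAt n v)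
  ; adj-sym = λ u v → combine-sym G H (splitAt n u) (splitAt n v)
  ; adj-irrefl = λ u → combine-irr G H (splitAt n u) }

K₂ : Graph 2
K₂ = record { adj = a ; adj-sym = s ; adj-irrefl = i }
  where
  a : Fin 2 → Fin 2 → Bool
  a zero (suc zero) = true
  a (suc zero) zero = true
  a _ _ = false
  s : ∀ u v → a u v ≡ a v u
  s zero zero = refl
  s zero (suc zero) = refl
  s (suc zero) zero = refl
  s (suc zero) (suc zero) = refl
  i : ∀ u → a u u ≡ false
  i zero = refl
  i (suc zero) = refl

empty : Graph 0
empty = record { adj = λ () ; adj-sym = λ () ; adj-irrefl = λ () }

rK₂ : (r : ℕ) → Graph (r * 2)
rK₂ zero = empty
rK₂ (suc r) = K₂ ⊔ rK₂ r

-- Integer polynomials (coefficient lists, lowest degree first)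

Poly : Set
Poly = List ℤ

_⊕_ : Poly → Poly → Poly
[] ⊕ q = q
p ⊕ [] = p
(a ∷ p) ⊕ (b ∷ q) = (a ℤ.+ b) ∷ (p ⊕ q)

scale : ℤ → Poly → Poly
scale c = map (c ℤ.*_)

_⊗_ : Poly → Poly → Poly
[] ⊗ q = []
(a ∷ p) ⊗ q = scale a q ⊕ (+ 0 ∷ (p ⊗ q))

coeff : Poly → ℕ → ℤ
coeff [] _ = + 0
coeff (a ∷ p) zero = a
coeff (a ∷ p) (suc k) = coeff p k

det : ∀ {n} → (Fin n → Fin n → Poly) → Poly
det {zero} M = + 1 ∷ []
det {suc n} M =
  foldr _⊕_ []
    (map (λ j → scale (sign (toℕ j)) (M zero j ⊗ det (λ i k → M (suc i) (punchIn j k))))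
         (allFin (suc n)))
  where
  sign : ℕ → ℤ
  sign zero = + 1
  sign (suc zero) = -[1+ 0 ]
  sign (suc (suc k)) = sign k

-- Signless Laplacian Q = D + A, and its characteristic polynomial det(xI − Q)

Q : ∀ {n} → Graph n → Fin n → Fin n → ℤ
Q G u v with u ≟ v
... | yes _ = + degree G u
... | no  _ = if adj G u v then + 1 else + 0

charPolyQ : ∀ {n} → Graph n → Poly
charPolyQ G = det λ u v → (ℤ.- Q G u v) ∷ (if ⌊ u ≟ v ⌋ then + 1 ∷ [] else [])

-- same Q-spectrum (multiset of eigenvalues of Q, with multiplicity):
-- equal characteristic polynomials of Q
QCospectral : ∀ {n m} → Graph n → Graph m → Set
QCospectral G H = ∀ k → coeff (charPolyQ G) k ≡ coeff (charPolyQ H) k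

DQS : ∀ {n} → Graph n → Set
DQS G = ∀ {m} (H : Graph m) → QCospectral G H → G ≅ H

{-# OPTIONS --safe #-}
-- Let H be cospectral with G ⊔ r K₂. The trace and the multiplicity r of the Q-eigenvalue 0 force the components of H
-- to be r trees together with s odd unicyclic graphs, and comparing the products of the nonzero eigenvalues (n for a
-- tree on n vertices, 4 for an odd unicyclic graph) shows that the orders of the trees multiply to 2 ^ (r + 2 - 2 s).
-- The eigenvalue 2 has multiplicity at least r in H. It is a simple eigenvalue of every component that has it: for a
-- double one all principal minors of 2 - Q of order n - 1 would vanish, but they are odd since the incidence matrix of
-- a tree or odd unicyclic graph is unimodular up to a factor 2. Moreover trees with eigenvalue 2 have even order. By
-- counting, either s = 1 and all trees are K₂, so that H = U ⊔ r K₂ with U cospectral to G, or s = 0 and G has at most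
-- 6 vertices, or H is one of U ⊔ T ⊔ K₁ ⊔ (r - 2) K₂ with |T| = 4 and U₁ ⊔ U₂ ⊔ 2 K₁ ⊔ (r - 2) K₂. The last two are
-- excluded by the linear coefficient of the characteristic polynomial modulo 4, which for an odd unicyclic graph of
-- girth g is ± n g.
module Submission where

open import Defs
open import Data.Nat as ℕ using (ℕ; zero; suc; _≤_; z≤n; s≤s)
import Data.Nat.Properties as ℕ
open import Data.Integer as ℤ using (ℤ; +_; -[1+_]; 0ℤ; 1ℤ; -1ℤ; -_; _+_; _*_; _-_; ∣_∣)
import Data.Integer.Properties as ℤ
open import Data.Integer.Tactic.RingSolver using (solve-∀)
open import Data.Nat.Tactic.RingSolver using () renaming (solve-∀ to ℕ-solve-∀)
open import Data.Fin as Fin using (Fin; zero; suc; toℕ; inject₁; punchIn; punchOut; splitAt; _↑ˡ_; _↑ʳ_; _≟_)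
import Data.Fin.Properties as Fin
open import Data.Fin.Induction using (<-weakInduction)
open import Data.Bool using (Bool; true; false; if_then_else_; _∧_)
open import Data.Sum using (_⊎_; inj₁; inj₂; [_,_]′)
open import Data.Sum.Function.Propositional using (_⊎-↔_)
open import Data.Product using (Σ; ∃; ∃₂; _×_; _,_; proj₁; proj₂)
open import Data.List using (List; []; _∷_; _++_; map; foldr; allFin; tabulate; concatMap; filterᵇ; length; lookup)
open import Data.Nat.ListAction using (sum)
import Data.List.Properties as List
open import Data.Bool.Properties as Bool using ()
open import Data.Fin.Subset using (Subset; _∈_; _∪_; ⁅_⁆; _⊃_)
open import Data.Fin.Subset.Properties using (_∈?_; p⊆p∪q; q⊆p∪q; x∈p∪q⁻; x∈⁅x⁆; x∈⁅y⁆⇒x≡y)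
open import Data.Fin.Subset.Induction using (⊃-wellFounded)
open import Induction.WellFounded using (Acc; acc)
open import Data.Nat.Induction using (<-wellFounded)
open import Data.Vec.Functional using (updateAt; insertAt)
open import Data.Vec.Functional.Properties using (updateAt-updates; updateAt-minimal; insertAt-lookup; insertAt-punchIn)
open import Function using (_∘_; _$_; id; _↔_; Inverse)
open import Function.Bundles using (mk↔ₛ′)
open import Function.Properties.Inverse using (↔⇒⤖; ↔-sym; ↔-trans; ↔-refl)
open import Function.Properties.Bijection using (⤖⇒↔)
open import Data.Fin.Permutation using (↔⇒≡)
open import Relation.Binary.Definitions as Tri using ()
open import Relation.Nullary using (¬_; Dec; yes; no; contradiction)
open import Relation.Nullary.Decidable using (⌊_⌋; _×-dec_; ¬?; decidable-stable)
open import Relation.Binary.PropositionalEquality using (_≡_; _≢_; refl; sym; trans; cong; cong₂; subst; subst₂; module ≡-Reasoning)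
open import Algebra.Properties.Semiring.Sum ℤ.+-*-semiring using (*-distribˡ-sum; *-distribʳ-sum; ∑-distrib-+; ∑-comm; sum-replicate-zero; sum-permute) renaming (sum to ∑; sum-cong-≗ to ∑-cong)
open import Algebra.Properties.AbelianGroup ℤ.+-0-abelianGroup using () renaming (∙-cancelˡ to +-cancelˡ)

-- No eigenvalue is ever computed: spectra are read off integer values of `ρ`. A multiplicity is an
-- exponent of `t` or `t + 2`, a product of nonzero eigenvalues is the constant term of the
-- remaining factor, and a derivative is a congruence modulo `s * s`. The counting is one equation.
-- Let `α` and `β` count the trees of H without and with eigenvalue 2, `γ` and `ε` the odd unicyclic
-- components without and with it, and let `κ` be the multiplicity of 2 in G. By simplicity
-- `α + β = r` and `β + ε = r + κ`, so `ε = α + κ`. With `A` the product of the orders of the trees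
-- without eigenvalue 2 and `B` the product of the halved orders of the other trees, the constant
-- terms give `A * B * 2 ^ (2 * (κ + γ) + α) = 4`, which leaves few shapes. The two shapes excluded
-- last satisfy all these constraints, so a further invariant is needed. A linear coefficient is not
-- multiplicative over components. The value at - 4 is, and modulo 16 it still shows the linear
-- coefficient modulo 4 of an odd unicyclic graph, because there `ρ` is 4 at 0.

Mat : ℕ → Set
Mat n = Fin n → Fin n → ℤ

-- Finite sums and unit vectors

∑-zero : ∀ {n} (f : Fin n → ℤ) → (∀ i → f i ≡ 0ℤ) → ∑ f ≡ 0ℤ
∑-zero {n} f h = trans (∑-cong h) (sum-replicate-zero n)

∑-linear : ∀ {n} c (f g : Fin n → ℤ) → ∑ (λ i → f i + c * g i) ≡ ∑ f + c * ∑ g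
∑-linear c f g = trans (∑-distrib-+ f (λ i → c * g i)) (cong (_+_ (∑ f)) (sym (*-distribˡ-sum c g)))

∑-neg : ∀ {n} (f : Fin n → ℤ) → ∑ (λ i → - f i) ≡ - ∑ f
∑-neg f = begin
  ∑ (λ i → - f i)     ≡⟨ ∑-cong (λ i → sym (ℤ.-1*i≡-i (f i))) ⟩
  ∑ (λ i → -1ℤ * f i) ≡⟨ sym (*-distribˡ-sum -1ℤ f) ⟩
  -1ℤ * ∑ f           ≡⟨ ℤ.-1*i≡-i (∑ f) ⟩
  - ∑ f               ∎
  where open ≡-Reasoning

δ : ∀ {n} → Mat n
δ i j = if ⌊ i ≟ j ⌋ then 1ℤ else 0ℤ

δ-diag : ∀ {n} (i : Fin n) → δ i i ≡ 1ℤ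
δ-diag i with i ≟ i
... | yes _ = refl
... | no i≢i = contradiction refl i≢i

δ-off : ∀ {n} {i j : Fin n} → i ≢ j → δ i j ≡ 0ℤ
δ-off {i = i} {j} i≢j with i ≟ j
... | yes i≡j = contradiction i≡j i≢j
... | no _ = refl

δ-sym : ∀ {n} (i j : Fin n) → δ i j ≡ δ j i
δ-sym i j with i ≟ j
... | yes refl = sym (δ-diag i)
... | no i≢j = sym (δ-off (i≢j ∘ sym))

δ-injective : ∀ {m n} (f : Fin m → Fin n) → (∀ {i j} → f i ≡ f j → i ≡ j) → ∀ i j → δ (f i) (f j) ≡ δ i j
δ-injective f inj i j with i ≟ j
... | yes refl = δ-diag (f i)
... | no i≢j = δ-off (i≢j ∘ inj)

∑-δˡ : ∀ {n} (i : Fin n) (f : Fin n → ℤ) → ∑ (λ j → δ i j * f j) ≡ f i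
∑-δˡ {suc n} zero f = trans
  (cong₂ _+_ (ℤ.*-identityˡ (f zero)) (∑-zero (λ j → δ zero (suc j) * f (suc j)) (λ j → ℤ.*-zeroˡ (f (suc j)))))
  (ℤ.+-identityʳ (f zero))
∑-δˡ {suc n} (suc i) f = trans
  (cong₂ _+_ (ℤ.*-zeroˡ (f zero)) (∑-cong (λ j → cong (_* f (suc j)) (δ-injective suc Fin.suc-injective i j))))
  (trans (ℤ.+-identityˡ _) (∑-δˡ i (f ∘ suc)))

∑-δʳ : ∀ {n} (f : Fin n → ℤ) (j : Fin n) → ∑ (λ i → f i * δ i j) ≡ f j
∑-δʳ f j = trans (∑-cong (λ i → trans (ℤ.*-comm (f i) (δ i j)) (cong (_* f i) (δ-sym i j)))) (∑-δˡ j f)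

-- Every integer vector is reached from zero by adding multiples of unit vectors. This lets a change
-- of many rows or diagonal entries of a matrix be made one at a time. The second argument stands in
-- for function extensionality.
vectorInduction : ∀ {n} (P : (Fin n → ℤ) → Set) → (∀ {c c′} → (∀ i → c i ≡ c′ i) → P c → P c′) → P (λ _ → 0ℤ) →
  (∀ c i x → P c → P (λ k → c k + x * δ i k)) → ∀ c → P c
vectorInduction {zero} P resp base step c = resp (λ ()) base
vectorInduction {suc n} P resp base step c = resp final (step (extend (c ∘ suc)) zero (c zero) tailCase)
  where
  extend : (Fin n → ℤ) → Fin (suc n) → ℤ
  extend d zero = 0ℤ
  extend d (suc i) = d i
  tailCase : P (extend (c ∘ suc))
  tailCase = vectorInduction (P ∘ extend) (λ h → resp λ { zero → refl ; (suc i) → h i })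
    (resp (λ { zero → refl ; (suc i) → refl }) base)
    (λ d i x p → resp (λ { zero → trans (ℤ.+-identityˡ _) (ℤ.*-zeroʳ x)
                         ; (suc k) → cong (λ y → d k + x * y) (δ-injective suc Fin.suc-injective i k) })
      (step (extend d) (suc i) x p))
    (c ∘ suc)
  final : ∀ k → extend (c ∘ suc) k + c zero * δ zero k ≡ c k
  final zero = trans (ℤ.+-identityˡ _) (ℤ.*-identityʳ (c zero))
  final (suc k) = trans (cong (_+_ (c (suc k))) (ℤ.*-zeroʳ (c zero))) (ℤ.+-identityʳ (c (suc k)))

-- Determinants by Laplace expansion

sgn : ℕ → ℤ
sgn zero = 1ℤ
sgn (suc k) = - sgn k

minor : ∀ {n} → Mat (suc n) → Fin (suc n) → Mat n
minor M j i k = M (suc i) (punchIn j k)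

-- Sealed so that determinants of concrete matrices do not unfold; `detℤ-zero` and `detℤ-suc` give
-- back the recursion. It follows the same expansion along row zero as `det`, so that evaluation of
-- polynomials commutes with both.
opaque
  detℤ : ∀ {n} → Mat n → ℤ
  detℤ {zero} M = 1ℤ
  detℤ {suc n} M = ∑ λ j → sgn (toℕ j) * (M zero j * detℤ (minor M j))

  detℤ-cong : ∀ {n} {M M′ : Mat n} → (∀ i j → M i j ≡ M′ i j) → detℤ M ≡ detℤ M′
  detℤ-cong {zero} h = refl
  detℤ-cong {suc n} {M} {M′} h = ∑-cong λ j → cong (sgn (toℕ j) *_)
    (cong₂ _*_ (h zero j) (detℤ-cong {M = minor M j} {minor M′ j} (λ i k → h (suc i) (punchIn j k))))

  detℤ-zero : ∀ (M : Mat 0) → detℤ M ≡ 1ℤ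
  detℤ-zero M = refl

  detℤ-suc : ∀ {n} (M : Mat (suc n)) → detℤ M ≡ ∑ λ j → sgn (toℕ j) * (M zero j * detℤ (minor M j))
  detℤ-suc M = refl

-- Multilinear and alternating functions of the rows

_ᵀ : ∀ {m n} → (Fin m → Fin n → ℤ) → Fin n → Fin m → ℤ
(M ᵀ) i j = M j i

infixl 9 _ᵀ

-- The law `linear` relates three matrices that agree outside row `i`, so additivity and homogeneity
-- are one equation and no normal form for row replacement is imposed on its users.
record Multilinear {n} (D : Mat n → ℤ) : Set where
  field
    respects : ∀ {M M′} → (∀ i j → M i j ≡ M′ i j) → D M ≡ D M′
    linear : ∀ i c {M M′ M″} →
      (∀ k → k ≢ i → ∀ j → M k j ≡ M′ k j) → (∀ k → k ≢ i → ∀ j → M k j ≡ M″ k j) →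
      (∀ j → M i j ≡ M′ i j + c * M″ i j) → D M ≡ D M′ + c * D M″

record Alternating {n} (D : Mat n → ℤ) : Set where
  field
    multilinear : Multilinear D
    alternating : ∀ {i k} M → i ≢ k → (∀ j → M i j ≡ M k j) → D M ≡ 0ℤ
  open Multilinear multilinear public

_[_]≔_ : ∀ {n} {A : Set} → (Fin n → A) → Fin n → A → Fin n → A
M [ i ]≔ v = updateAt M i (λ _ → v)

module _ {n : ℕ} {A : Set} (M : Fin n → Fin n → A) where
  ≔-at : ∀ i v j → (M [ i ]≔ v) i j ≡ v j
  ≔-at i v j = cong (_$ j) (updateAt-updates i {f = λ _ → v} M)

  ≔-off : ∀ i v k → k ≢ i → ∀ j → (M [ i ]≔ v) k j ≡ M k j
  ≔-off i v k k≢i j = cong (_$ j) (updateAt-minimal k i {f = λ _ → v} M k≢i)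

module MultilinearProperties {n : ℕ} {D : Mat n → ℤ} (multilinear : Multilinear D) where
  open Multilinear multilinear
  open ≡-Reasoning

  x≡x+x⇒0 : ∀ x → x ≡ x + 1ℤ * x → x ≡ 0ℤ
  x≡x+x⇒0 x h = begin
    x                   ≡⟨ lemma x ⟩
    (x + 1ℤ * x) + - x  ≡⟨ cong (_+ - x) (sym h) ⟩
    x + - x             ≡⟨ ℤ.+-inverseʳ x ⟩
    0ℤ                  ∎
    where
    lemma : ∀ x → x ≡ (x + 1ℤ * x) + - x
    lemma = solve-∀

  -- A zero row is the sum of itself with itself, so linearity gives `D M ≡ D M + D M`.
  zeroRow : ∀ i M → (∀ j → M i j ≡ 0ℤ) → D M ≡ 0ℤ
  zeroRow i M h = x≡x+x⇒0 (D M) (linear i 1ℤ (λ _ _ _ → refl) (λ _ _ _ → refl)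
    (λ j → trans (h j) (sym (cong₂ (λ a b → a + 1ℤ * b) (h j) (h j)))))

  expandRow : ∀ {m} i M (v : Fin m → ℤ) (w : Fin m → Fin n → ℤ) →
    (∀ j → M i j ≡ ∑ λ a → v a * w a j) → D M ≡ ∑ λ a → v a * D (M [ i ]≔ w a)
  expandRow {zero} i M v w h = zeroRow i M h
  expandRow {suc m} i M v w h = begin
    D M
      ≡⟨ linear i (v zero) {M′ = M [ i ]≔ rest} {M [ i ]≔ w zero}
           (λ k k≢i j → sym (≔-off M i rest k k≢i j)) (λ k k≢i j → sym (≔-off M i (w zero) k k≢i j))
           (λ j → trans (h j) (trans (ℤ.+-comm (v zero * w zero j) (rest j))
             (sym (cong₂ (λ a b → a + v zero * b) (≔-at M i rest j) (≔-at M i (w zero) j))))) ⟩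
    D (M [ i ]≔ rest) + v zero * D (M [ i ]≔ w zero)
      ≡⟨ cong (_+ v zero * D (M [ i ]≔ w zero)) (trans (expandRow i (M [ i ]≔ rest) (v ∘ suc) (w ∘ suc) (≔-at M i rest))
           (∑-cong (λ a → cong (v (suc a) *_) (respects (overwrite (w (suc a))))))) ⟩
    ∑ (λ a → v (suc a) * D (M [ i ]≔ w (suc a))) + v zero * D (M [ i ]≔ w zero)
      ≡⟨ ℤ.+-comm _ (v zero * D (M [ i ]≔ w zero)) ⟩
    ∑ (λ a → v a * D (M [ i ]≔ w a)) ∎
    where
    rest : Fin n → ℤ
    rest j = ∑ λ a → v (suc a) * w (suc a) j
    overwrite : ∀ u k j → ((M [ i ]≔ rest) [ i ]≔ u) k j ≡ (M [ i ]≔ u) k j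
    overwrite u k j with k ≟ i
    ... | yes refl = trans (≔-at (M [ i ]≔ rest) i u j) (sym (≔-at M i u j))
    ... | no k≢i = trans (≔-off (M [ i ]≔ rest) i u k k≢i j)
                     (trans (≔-off M i rest k k≢i j) (sym (≔-off M i u k k≢i j)))

  -- Polarization: the sum of both rows is put into both places and expanded. Vanishing on equal
  -- rows is assumed for the pair `i`, `k` only, because the lemma is also applied to columns at a
  -- stage where just adjacent equal columns are known to give zero.
  swapRows : ∀ {i k} M M′ → i ≢ k → (∀ N → (∀ j → N i j ≡ N k j) → D N ≡ 0ℤ) → (∀ j → M′ i j ≡ M k j) → (∀ j → M′ k j ≡ M i j) →
    (∀ l → l ≢ i → l ≢ k → ∀ j → M′ l j ≡ M l j) → D M′ ≡ - D M
  swapRows {i} {k} M M′ i≢k alternatingᵢₖ atᵢ atₖ off = begin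
    D M′                                        ≡⟨ lemma (D M) (D M′) ⟩
    ((0ℤ + 1ℤ * D M) + 1ℤ * (D M′ + 1ℤ * 0ℤ)) - D M ≡⟨ cong (_- D M) (sym sum≡0) ⟩
    0ℤ - D M                                    ≡⟨ ℤ.+-identityˡ (- D M) ⟩
    - D M                                       ∎
    where
    lemma : ∀ x y → y ≡ ((0ℤ + 1ℤ * x) + 1ℤ * (y + 1ℤ * 0ℤ)) - x
    lemma = solve-∀
    R : (Fin n → ℤ) → (Fin n → ℤ) → Mat n
    R u v = (M [ i ]≔ u) [ k ]≔ v
    u v w : Fin n → ℤ
    u = M i
    v = M k
    w j = M i j + 1ℤ * M k j
    R-k : ∀ a b j → R a b k j ≡ b j
    R-k a b j = ≔-at (M [ i ]≔ a) k b j
    R-i : ∀ a b j → R a b i j ≡ a j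
    R-i a b j = trans (≔-off (M [ i ]≔ a) k b i i≢k j) (≔-at M i a j)
    R-off : ∀ a b l → l ≢ i → l ≢ k → ∀ j → R a b l j ≡ M l j
    R-off a b l l≢i l≢k j = trans (≔-off (M [ i ]≔ a) k b l l≢k j) (≔-off M i a l l≢i j)
    R≗ : ∀ a b N → (∀ j → N i j ≡ a j) → (∀ j → N k j ≡ b j) → (∀ l → l ≢ i → l ≢ k → ∀ j → N l j ≡ M l j) →
      ∀ l j → R a b l j ≡ N l j
    R≗ a b N Ni Nk Noff l j with l ≟ i
    ... | yes refl = trans (R-i a b j) (sym (Ni j))
    ... | no l≢i with l ≟ k
    ...   | yes refl = trans (R-k a b j) (sym (Nk j))
    ...   | no l≢k = trans (R-off a b l l≢i l≢k j) (sym (Noff l l≢i l≢k j))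
    diag : ∀ a → D (R a a) ≡ 0ℤ
    diag a = alternatingᵢₖ (R a a) (λ j → trans (R-i a a j) (sym (R-k a a j)))
    linₖ : ∀ a → D (R a w) ≡ D (R a u) + 1ℤ * D (R a v)
    linₖ a = linear k 1ℤ (agree w u) (agree w v) (λ j → trans (R-k a w j) (sym (cong₂ (λ x y → x + 1ℤ * y) (R-k a u j) (R-k a v j))))
      where
      agree : ∀ b b′ l → l ≢ k → ∀ j → R a b l j ≡ R a b′ l j
      agree b b′ l l≢k j = trans (≔-off (M [ i ]≔ a) k b l l≢k j) (sym (≔-off (M [ i ]≔ a) k b′ l l≢k j))
    linᵢ : D (R w w) ≡ D (R u w) + 1ℤ * D (R v w)
    linᵢ = linear i 1ℤ (agree u) (agree v) (λ j → trans (R-i w w j) (sym (cong₂ (λ x y → x + 1ℤ * y) (R-i u w j) (R-i v w j))))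
      where
      agree : ∀ a l → l ≢ i → ∀ j → R w w l j ≡ R a w l j
      agree a l l≢i j with l ≟ k
      ... | yes refl = trans (R-k w w j) (sym (R-k a w j))
      ... | no l≢k = trans (R-off w w l l≢i l≢k j) (sym (R-off a w l l≢i l≢k j))
    sum≡0 : 0ℤ ≡ (0ℤ + 1ℤ * D M) + 1ℤ * (D M′ + 1ℤ * 0ℤ)
    sum≡0 = begin
      0ℤ                           ≡⟨ sym (diag w) ⟩
      D (R w w)                    ≡⟨ linᵢ ⟩
      D (R u w) + 1ℤ * D (R v w)   ≡⟨ cong₂ (λ x y → x + 1ℤ * y) (linₖ u) (linₖ v) ⟩
      (D (R u u) + 1ℤ * D (R u v)) + 1ℤ * (D (R v u) + 1ℤ * D (R v v))
        ≡⟨ cong₂ (λ x y → x + 1ℤ * y)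
             (cong₂ (λ x y → x + 1ℤ * y) (diag u) (respects (R≗ u v M (λ _ → refl) (λ _ → refl) (λ _ _ _ _ → refl))))
             (cong₂ (λ x y → x + 1ℤ * y) (respects (R≗ v u M′ atᵢ atₖ off)) (diag v)) ⟩
      (0ℤ + 1ℤ * D M) + 1ℤ * (D M′ + 1ℤ * 0ℤ) ∎

module AlternatingProperties {n : ℕ} {D : Mat n → ℤ} (alt : Alternating D) where
  open Alternating alt
  open MultilinearProperties multilinear public using (zeroRow; expandRow)
  open ≡-Reasoning

  addRow : ∀ i k c M M′ → i ≢ k → (∀ l → l ≢ i → ∀ j → M′ l j ≡ M l j) →
    (∀ j → M′ i j ≡ M i j + c * M k j) → D M′ ≡ D M
  addRow i k c M M′ i≢k off at = begin
    D M′
      ≡⟨ linear i c {M′ = M} {M [ i ]≔ M k} off (λ l l≢i j → trans (off l l≢i j) (sym (≔-off M i (M k) l l≢i j)))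
           (λ j → trans (at j) (cong (λ x → M i j + c * x) (sym (≔-at M i (M k) j)))) ⟩
    D M + c * D (M [ i ]≔ M k)
      ≡⟨ cong (λ x → D M + c * x) (alternating (M [ i ]≔ M k) i≢k
           (λ j → trans (≔-at M i (M k) j) (sym (≔-off M i (M k) k (i≢k ∘ sym) j)))) ⟩
    D M + c * 0ℤ
      ≡⟨ trans (cong (_+_ (D M)) (ℤ.*-zeroʳ c)) (ℤ.+-identityʳ (D M)) ⟩
    D M ∎

  addToRows : ∀ p (c : Fin n → ℤ) M M′ → c p ≡ 0ℤ → (∀ i j → M′ i j ≡ M i j + c i * M p j) → D M′ ≡ D M
  addToRows p c M M′ cp≡0 h = trans (respects (λ i j → trans (h i j) (cong (λ x → M i j + x * M p j) (sym (away-p i)))))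
    (vectorInduction (λ c → D (H c) ≡ D M) (λ e eq → trans (respects λ i j → cong (λ x → M i j + x * (1ℤ - δ i p) * M p j) (sym (e i))) eq)
      (respects λ i j → ℤ.+-identityʳ (M i j)) step c)
    where
    -- The factor `1ℤ - δ i p` keeps row `p` fixed for every intermediate vector, although only the
    -- final one is known to vanish at `p`.
    H : (Fin n → ℤ) → Mat n
    H c i j = M i j + c i * (1ℤ - δ i p) * M p j
    unchanged : ∀ c i j → c * (1ℤ - 1ℤ) ≡ 0ℤ × M i j + c * (1ℤ - 1ℤ) * M p j ≡ M i j
    unchanged c i j = ℤ.*-zeroʳ c , trans (cong (λ x → M i j + x * M p j) (ℤ.*-zeroʳ c)) (ℤ.+-identityʳ (M i j))
    H-p : ∀ c j → H c p j ≡ M p j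
    H-p c j = trans (cong (λ d → M p j + c p * (1ℤ - d) * M p j) (δ-diag p)) (proj₂ (unchanged (c p) p j))
    away-p : ∀ i → c i * (1ℤ - δ i p) ≡ c i
    away-p i with i ≟ p
    ... | yes refl = trans (ℤ.*-zeroʳ (c i)) (sym cp≡0)
    ... | no _ = ℤ.*-identityʳ (c i)
    step : ∀ c i x → D (H c) ≡ D M → D (H (λ k → c k + x * δ i k)) ≡ D M
    step c i x eq with i ≟ p
    ... | yes refl = trans (respects λ k j → same k j) eq
      where
      same : ∀ k j → H (λ k → c k + x * δ i k) k j ≡ H c k j
      same k j with k ≟ i
      ... | yes refl = trans (proj₂ (unchanged (c k + x * δ k k) k j)) (sym (proj₂ (unchanged (c k) k j)))
      ... | no k≢i = cong (λ d → M k j + d * (1ℤ - 0ℤ) * M i j) (trans (cong (λ d → c k + x * d) (δ-off (k≢i ∘ sym))) (lemma (c k) x))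
        where
        lemma : ∀ c x → c + x * 0ℤ ≡ c
        lemma = solve-∀
    ... | no i≢p = trans (addRow i p x (H c) (H (λ k → c k + x * δ i k)) i≢p
      (λ l l≢i j → cong (λ d → M l j + d * (1ℤ - δ l p) * M p j) (trans (cong (λ d → c l + x * d) (δ-off (l≢i ∘ sym))) (lemma₀ (c l) x)))
      (λ j → trans (cong₂ (λ d e → M i j + (c i + x * d) * (1ℤ - e) * M p j) (δ-diag i) (δ-off i≢p))
        (trans (lemma (M i j) (c i) x (M p j)) (sym (cong₂ (λ e y → M i j + c i * (1ℤ - e) * M p j + x * y) (δ-off i≢p) (H-p c j)))))) eq
      where
      lemma₀ : ∀ c x → c + x * 0ℤ ≡ c
      lemma₀ = solve-∀
      lemma : ∀ m c x y → m + (c + x * 1ℤ) * (1ℤ - 0ℤ) * y ≡ m + c * (1ℤ - 0ℤ) * y + x * y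
      lemma = solve-∀

-- Columns in the Laplace expansion

∑-cancelAdjacent : ∀ {n} (f : Fin (suc n) → ℤ) (i : Fin n) → f (inject₁ i) + f (suc i) ≡ 0ℤ →
  (∀ j → j ≢ inject₁ i → j ≢ suc i → f j ≡ 0ℤ) → ∑ f ≡ 0ℤ
∑-cancelAdjacent {suc n} f zero h off = trans (sym (ℤ.+-assoc (f zero) (f (suc zero)) (∑ (λ j → f (suc (suc j))))))
  (cong₂ _+_ h (∑-zero _ (λ j → off (suc (suc j)) (λ ()) (λ ()))))
∑-cancelAdjacent {suc n} f (suc i) h off = cong₂ _+_ (off zero (λ ()) (λ ()))
  (∑-cancelAdjacent (f ∘ suc) i h (λ j p q → off (suc j) (p ∘ Fin.suc-injective) (q ∘ Fin.suc-injective)))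

punchIn-adjacent : ∀ {n} (i k : Fin n) →
  (k ≡ i × punchIn (inject₁ i) k ≡ suc i × punchIn (suc i) k ≡ inject₁ i)
  ⊎ (k ≢ i × punchIn (inject₁ i) k ≡ punchIn (suc i) k)
punchIn-adjacent zero zero = inj₁ (refl , refl , refl)
punchIn-adjacent zero (suc k) = inj₂ ((λ ()) , refl)
punchIn-adjacent (suc i) zero = inj₂ ((λ ()) , refl)
punchIn-adjacent (suc i) (suc k) with punchIn-adjacent i k
... | inj₁ (p , q , r) = inj₁ (cong suc p , cong suc q , cong suc r)
... | inj₂ (p , q) = inj₂ (p ∘ Fin.suc-injective , cong suc q)

adjacentPreimage : ∀ {n} (i : Fin (suc n)) (j : Fin (suc (suc n))) → j ≢ inject₁ i → j ≢ suc i →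
  ∃ λ (i′ : Fin n) → punchIn j (inject₁ i′) ≡ inject₁ i × punchIn j (suc i′) ≡ suc i
adjacentPreimage zero zero p q = contradiction refl p
adjacentPreimage zero (suc zero) p q = contradiction refl q
adjacentPreimage {suc n} zero (suc (suc j)) p q = zero , refl , refl
adjacentPreimage (suc i) zero p q = i , refl , refl
adjacentPreimage {suc n} (suc i) (suc j) p q with adjacentPreimage i j (p ∘ cong suc) (q ∘ cong suc)
... | i′ , r , s = suc i′ , cong suc r , cong suc s

sgn-inject₁ : ∀ {n} (i : Fin n) → sgn (toℕ (suc i)) ≡ - sgn (toℕ (inject₁ i))
sgn-inject₁ i = cong (λ k → - sgn k) (sym (Fin.toℕ-inject₁ i))

-- The terms of the two equal columns have equal minors and opposite signs. Every other minor still
-- contains both columns, again adjacent, so it vanishes by induction.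
detℤ-adjacentColumns : ∀ {n} (M : Mat (suc n)) (i : Fin n) → (∀ k → M k (inject₁ i) ≡ M k (suc i)) → detℤ M ≡ 0ℤ
detℤ-adjacentColumns {suc n} M i h = trans (detℤ-suc M) (∑-cancelAdjacent (λ j → sgn (toℕ j) * term j) i pair others)
  where
  open ≡-Reasoning
  sameMinor : ∀ a k → minor M (suc i) a k ≡ minor M (inject₁ i) a k
  sameMinor a k with punchIn-adjacent i k
  ... | inj₁ (_ , q , r) = trans (cong (M (suc a)) r) (trans (h (suc a)) (cong (M (suc a)) (sym q)))
  ... | inj₂ (_ , q) = cong (M (suc a)) (sym q)
  lemma : ∀ s x → s * x + - s * x ≡ 0ℤ
  lemma = solve-∀
  term : Fin (suc (suc n)) → ℤ
  term j = M zero j * detℤ (minor M j)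
  pair : sgn (toℕ (inject₁ i)) * term (inject₁ i) + sgn (toℕ (suc i)) * term (suc i) ≡ 0ℤ
  pair = trans
    (cong (_+_ (sgn (toℕ (inject₁ i)) * term (inject₁ i)))
      (cong₂ _*_ (sgn-inject₁ i) (cong₂ _*_ (sym (h zero)) (detℤ-cong {M = minor M (suc i)} {minor M (inject₁ i)} sameMinor))))
    (lemma (sgn (toℕ (inject₁ i))) (term (inject₁ i)))
  others : ∀ j → j ≢ inject₁ i → j ≢ suc i → sgn (toℕ j) * term j ≡ 0ℤ
  others j p q with adjacentPreimage i j p q
  ... | i′ , r , s = begin
    sgn (toℕ j) * (M zero j * detℤ (minor M j))
      ≡⟨ cong (λ x → sgn (toℕ j) * (M zero j * x)) (detℤ-adjacentColumns (minor M j) i′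
           (λ k → trans (cong (M (suc k)) r) (trans (h (suc k)) (cong (M (suc k)) (sym s))))) ⟩
    sgn (toℕ j) * (M zero j * 0ℤ)
      ≡⟨ trans (cong (sgn (toℕ j) *_) (ℤ.*-zeroʳ (M zero j))) (ℤ.*-zeroʳ (sgn (toℕ j))) ⟩
    0ℤ ∎

-- In the expansion along row zero, the term of column `i` is linear through its entry and the other
-- terms are linear through their minors.
detℤ-linearColumn : ∀ {n} (i : Fin n) c {M M′ M″ : Mat n} →
  (∀ k → k ≢ i → ∀ j → M j k ≡ M′ j k) → (∀ k → k ≢ i → ∀ j → M j k ≡ M″ j k) →
  (∀ j → M j i ≡ M′ j i + c * M″ j i) → detℤ M ≡ detℤ M′ + c * detℤ M″
detℤ-linearColumn {suc n} i c {M} {M′} {M″} off off′ at = begin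
  detℤ M                       ≡⟨ detℤ-suc M ⟩
  ∑ (summand M)                ≡⟨ ∑-cong term ⟩
  ∑ (λ j → summand M′ j + c * summand M″ j) ≡⟨ ∑-linear c (summand M′) (summand M″) ⟩
  ∑ (summand M′) + c * ∑ (summand M″) ≡⟨ sym (cong₂ (λ x y → x + c * y) (detℤ-suc M′) (detℤ-suc M″)) ⟩
  detℤ M′ + c * detℤ M″        ∎
  where
  open ≡-Reasoning
  lemma₁ : ∀ s a b x c → s * ((a + c * b) * x) ≡ s * (a * x) + c * (s * (b * x))
  lemma₁ = solve-∀
  lemma₂ : ∀ s m x y c → s * (m * (x + c * y)) ≡ s * (m * x) + c * (s * (m * y))
  lemma₂ = solve-∀
  summand : Mat (suc n) → Fin (suc n) → ℤ
  summand A j = sgn (toℕ j) * (A zero j * detℤ (minor A j))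
  term : ∀ j → summand M j ≡ summand M′ j + c * summand M″ j
  term j with j ≟ i
  ... | yes refl = begin
    sgn (toℕ j) * (M zero j * detℤ (minor M j))
      ≡⟨ cong (λ x → sgn (toℕ j) * (x * detℤ (minor M j))) (at zero) ⟩
    sgn (toℕ j) * ((M′ zero j + c * M″ zero j) * detℤ (minor M j))
      ≡⟨ lemma₁ (sgn (toℕ j)) (M′ zero j) (M″ zero j) (detℤ (minor M j)) c ⟩
    sgn (toℕ j) * (M′ zero j * detℤ (minor M j)) + c * (sgn (toℕ j) * (M″ zero j * detℤ (minor M j)))
      ≡⟨ cong₂ (λ x y → sgn (toℕ j) * (M′ zero j * x) + c * (sgn (toℕ j) * (M″ zero j * y)))
           (detℤ-cong {M = minor M j} {minor M′ j} (λ a k → off (punchIn j k) (Fin.punchInᵢ≢i j k) (suc a)))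
           (detℤ-cong {M = minor M j} {minor M″ j} (λ a k → off′ (punchIn j k) (Fin.punchInᵢ≢i j k) (suc a))) ⟩
    _ ∎
  ... | no j≢i = begin
    sgn (toℕ j) * (M zero j * detℤ (minor M j))
      ≡⟨ cong (λ x → sgn (toℕ j) * (M zero j * x)) (detℤ-linearColumn i′ c {minor M j} {minor M′ j} {minor M″ j}
           (λ k k≢i′ a → off (punchIn j k) (away k k≢i′) (suc a))
           (λ k k≢i′ a → off′ (punchIn j k) (away k k≢i′) (suc a))
           (λ a → subst (λ l → M (suc a) l ≡ M′ (suc a) l + c * M″ (suc a) l) (sym i′-eq) (at (suc a)))) ⟩
    sgn (toℕ j) * (M zero j * (detℤ (minor M′ j) + c * detℤ (minor M″ j)))
      ≡⟨ lemma₂ (sgn (toℕ j)) (M zero j) (detℤ (minor M′ j)) (detℤ (minor M″ j)) c ⟩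
    sgn (toℕ j) * (M zero j * detℤ (minor M′ j)) + c * (sgn (toℕ j) * (M zero j * detℤ (minor M″ j)))
      ≡⟨ cong₂ (λ x y → sgn (toℕ j) * (x * detℤ (minor M′ j)) + c * (sgn (toℕ j) * (y * detℤ (minor M″ j))))
           (off j j≢i zero) (off′ j j≢i zero) ⟩
    _ ∎
    where
    i′ : Fin n
    i′ = punchOut j≢i
    i′-eq : punchIn j i′ ≡ i
    i′-eq = Fin.punchIn-punchOut j≢i
    away : ∀ k → k ≢ i′ → punchIn j k ≢ i
    away k k≢i′ e = k≢i′ (Fin.punchIn-injective j k i′ (trans e (sym i′-eq)))

detℤ-ᵀ-multilinear : ∀ {n} → Multilinear {n} (λ A → detℤ (A ᵀ))
detℤ-ᵀ-multilinear = record
  { respects = λ {A} {B} h → detℤ-cong {M = A ᵀ} {B ᵀ} (λ i j → h j i)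
  ; linear = λ i c {A} {B} {C} → detℤ-linearColumn i c {A ᵀ} {B ᵀ} {C ᵀ}
  }

-- Equal columns at distance d + 1 become adjacent after d adjacent swaps.
module _ where
  private
    columnsAtDistance : ∀ {n} d (M : Mat (suc n)) (a : Fin (suc n)) (b : Fin n) → toℕ a ℕ.+ d ≡ toℕ b →
      (∀ k → M k a ≡ M k (suc b)) → detℤ M ≡ 0ℤ
    columnsAtDistance zero M a b e h = detℤ-adjacentColumns M b
      (λ k → trans (cong (M k) (Fin.toℕ-injective
        (trans (Fin.toℕ-inject₁ b) (trans (sym e) (ℕ.+-identityʳ (toℕ a)))))) (h k))
    columnsAtDistance (suc d) M a zero e h = contradiction (trans (sym (ℕ.+-suc (toℕ a) d)) e) λ ()
    columnsAtDistance {suc n} (suc d) M a (suc b) e h =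
      trans (MultilinearProperties.swapRows detℤ-ᵀ-multilinear {i} {s} (M′ ᵀ) (M ᵀ) i≢s
        (λ N → detℤ-adjacentColumns (N ᵀ) (suc b)) (λ k → sym (M′-s k)) (λ k → sym (M′-i k)) (λ j p q k → sym (M′-off j p q k)))
      (cong -_ (columnsAtDistance d M′ a (inject₁ b)
        (trans (ℕ.suc-injective (trans (sym (ℕ.+-suc (toℕ a) d)) e)) (sym (Fin.toℕ-inject₁ b)))
        (λ k → trans (M′-off a a≢i a≢s k) (trans (h k) (sym (M′-i k))))))
      where
      i s : Fin (suc (suc n))
      i = inject₁ (suc b)
      s = suc (suc b)
      toℕ-i : toℕ i ≡ toℕ a ℕ.+ suc d
      toℕ-i = trans (Fin.toℕ-inject₁ (suc b)) (sym e)
      a<i : toℕ a ℕ.< toℕ i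
      a<i = subst (toℕ a ℕ.<_) (sym toℕ-i) (ℕ.m<m+n (toℕ a) (s≤s z≤n))
      a≢i : a ≢ i
      a≢i refl = ℕ.<-irrefl refl a<i
      a≢s : a ≢ s
      a≢s refl = ℕ.<-asym a<i (subst (ℕ._< toℕ s) (sym (Fin.toℕ-inject₁ (suc b))) ℕ.≤-refl)
      i≢s : i ≢ s
      i≢s e′ = ℕ.<-irrefl (trans (sym (Fin.toℕ-inject₁ (suc b))) (cong toℕ e′)) ℕ.≤-refl
      M′ : Mat (suc (suc n))
      M′ k j = (((M ᵀ) [ i ]≔ (λ r → M r s)) [ s ]≔ (λ r → M r i)) j k
      M′-s : ∀ k → M′ k s ≡ M k i
      M′-s k = ≔-at ((M ᵀ) [ i ]≔ (λ r → M r s)) s (λ r → M r i) k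
      M′-i : ∀ k → M′ k i ≡ M k s
      M′-i k = trans (≔-off ((M ᵀ) [ i ]≔ (λ r → M r s)) s (λ r → M r i) i i≢s k) (≔-at (M ᵀ) i (λ r → M r s) k)
      M′-off : ∀ j → j ≢ i → j ≢ s → ∀ k → M′ k j ≡ M k j
      M′-off j j≢i j≢s k = trans (≔-off ((M ᵀ) [ i ]≔ (λ r → M r s)) s (λ r → M r i) j j≢s k)
        (≔-off (M ᵀ) i (λ r → M r s) j j≢i k)

    columns< : ∀ {n} (M : Mat n) {a b} → toℕ a ℕ.< toℕ b → (∀ k → M k a ≡ M k b) → detℤ M ≡ 0ℤ
    columns< {suc n} M {a} {suc b} a<b h =
      columnsAtDistance (toℕ b ℕ.∸ toℕ a) M a b (ℕ.m+[n∸m]≡n (ℕ.s≤s⁻¹ a<b)) h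

  detℤ-equalColumns : ∀ {n} (M : Mat n) {a b} → a ≢ b → (∀ k → M k a ≡ M k b) → detℤ M ≡ 0ℤ
  detℤ-equalColumns M {a} {b} a≢b h with Fin.<-cmp a b
  ... | Tri.tri< a<b _ _ = columns< M a<b h
  ... | Tri.tri≈ _ a≡b _ = contradiction a≡b a≢b
  ... | Tri.tri> _ _ b<a = columns< M b<a (sym ∘ h)

-- Uniqueness of alternating functions

punchIn-view : ∀ {n} (j l : Fin (suc n)) → l ≡ j ⊎ ∃ λ k → l ≡ punchIn j k
punchIn-view j l with j ≟ l
... | yes j≡l = inj₁ (sym j≡l)
... | no j≢l = inj₂ (punchOut j≢l , sym (Fin.punchIn-punchOut j≢l))

module _ {n : ℕ} where
  -- Border of `N` by the unit row `δ j` on top and zeros in the rest of column `j`. Composition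
  -- with it turns an alternating function of order `suc n` into one of order `n`.
  insertZeroColumn : Fin (suc n) → Mat n → Mat (suc n)
  insertZeroColumn j N zero = δ j
  insertZeroColumn j N (suc i) = insertAt (N i) j 0ℤ

  insertAt-pointwise : ∀ {a b c : Fin n → ℤ} (_⊕_ : ℤ → ℤ → ℤ) → 0ℤ ≡ 0ℤ ⊕ 0ℤ → (∀ k → a k ≡ b k ⊕ c k) →
    ∀ j l → insertAt a j 0ℤ l ≡ insertAt b j 0ℤ l ⊕ insertAt c j 0ℤ l
  insertAt-pointwise {a} {b} {c} _⊕_ h₀ h j l with punchIn-view j l
  ... | inj₁ refl = trans (insertAt-lookup a l 0ℤ)
    (trans h₀ (sym (cong₂ _⊕_ (insertAt-lookup b l 0ℤ) (insertAt-lookup c l 0ℤ))))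
  ... | inj₂ (k , refl) = trans (insertAt-punchIn a j 0ℤ k)
    (trans (h k) (sym (cong₂ _⊕_ (insertAt-punchIn b j 0ℤ k) (insertAt-punchIn c j 0ℤ k))))

  insertAt-cong : ∀ {a b : Fin n → ℤ} → (∀ k → a k ≡ b k) → ∀ j l → insertAt a j 0ℤ l ≡ insertAt b j 0ℤ l
  insertAt-cong {a} {b} h = insertAt-pointwise {a} {b} {b} (λ x _ → x) refl h

  insertZeroColumn-alternating : ∀ {D : Mat (suc n) → ℤ} → Alternating D → ∀ j → Alternating (D ∘ insertZeroColumn j)
  insertZeroColumn-alternating alt j = record
    { multilinear = record
        { respects = λ h → respects λ { zero l → refl ; (suc i) l → insertAt-cong (h i) j l }
        ; linear = λ i c {M} {M′} {M″} off off′ at → linear (suc i) c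
            (λ { zero _ l → refl ; (suc k) k≢i l → insertAt-cong (off k (k≢i ∘ cong suc)) j l })
            (λ { zero _ l → refl ; (suc k) k≢i l → insertAt-cong (off′ k (k≢i ∘ cong suc)) j l })
            (insertAt-pointwise {M i} {M′ i} {M″ i} (λ x y → x + c * y) (sym (cong (_+_ 0ℤ) (ℤ.*-zeroʳ c))) at j)
        }
    ; alternating = λ M i≢k h → alternating (insertZeroColumn j M) (i≢k ∘ Fin.suc-injective) (insertAt-cong h j)
    }
    where open Alternating alt

-- An alternating function is determined by its value at the identity: after expanding row zero, the column
-- of its unit vector is cleared in the other rows, which leaves an alternating function of the minor.
alternating-unique : ∀ {n} {D : Mat n → ℤ} → Alternating D → ∀ M → D M ≡ D δ * detℤ M
alternating-unique {zero} {D} alt M = begin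
  D M             ≡⟨ Alternating.respects alt (λ ()) ⟩
  D δ             ≡⟨ sym (ℤ.*-identityʳ (D δ)) ⟩
  D δ * 1ℤ        ≡⟨ cong (D δ *_) (sym (detℤ-zero M)) ⟩
  D δ * detℤ M    ∎
  where open ≡-Reasoning
alternating-unique {suc n} {D} alt M = begin
  D M
    ≡⟨ expandRow zero M (M zero) δ (λ j → sym (∑-δʳ (M zero) j)) ⟩
  ∑ (λ j → M zero j * D (M [ zero ]≔ δ j))
    ≡⟨ ∑-cong (λ j → trans (cong (M zero j *_) (clear j))
         (lemma (M zero j) (sgn (toℕ j)) (D δ) (detℤ (minor M j)))) ⟩
  ∑ (λ j → D δ * (sgn (toℕ j) * (M zero j * detℤ (minor M j))))
    ≡⟨ sym (*-distribˡ-sum (D δ) (λ j → sgn (toℕ j) * (M zero j * detℤ (minor M j)))) ⟩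
  D δ * ∑ (λ j → sgn (toℕ j) * (M zero j * detℤ (minor M j)))
    ≡⟨ cong (D δ *_) (sym (detℤ-suc M)) ⟩
  D δ * detℤ M ∎
  where
  open ≡-Reasoning
  open Alternating alt
  open AlternatingProperties alt
  open MultilinearProperties multilinear using (swapRows)
  lemma : ∀ m s d x → m * ((s * d) * x) ≡ d * (s * (m * x))
  lemma = solve-∀
  lemma₂ : ∀ x y → y + - y * x ≡ y * (1ℤ - x)
  lemma₂ = solve-∀

  -- Passing from `inject₁ i` to `suc i` exchanges row `zero` with row `suc i`; each such exchange
  -- contributes one sign.
  unitAt : ∀ j → D (insertZeroColumn j δ) ≡ sgn (toℕ j) * D δ
  unitAt = <-weakInduction (λ j → D (insertZeroColumn j δ) ≡ sgn (toℕ j) * D δ) base step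
    where
    rows : Fin (suc n) → Mat (suc n)
    rows j zero = δ j
    rows j (suc i) = δ (punchIn j i)
    rows≗ : ∀ j i l → insertZeroColumn j δ i l ≡ rows j i l
    rows≗ j zero l = refl
    rows≗ j (suc i) l with punchIn-view j l
    ... | inj₁ refl = trans (insertAt-lookup (δ i) l 0ℤ) (sym (δ-off (Fin.punchInᵢ≢i l i)))
    ... | inj₂ (k , refl) = trans (insertAt-punchIn (δ i) j 0ℤ k)
      (sym (δ-injective (punchIn j) (Fin.punchIn-injective j _ _) i k))
    base : D (insertZeroColumn zero δ) ≡ sgn 0 * D δ
    base = trans (respects (λ { zero l → refl ; (suc i) l → rows≗ zero (suc i) l })) (sym (ℤ.*-identityˡ (D δ)))
    step : ∀ i → D (insertZeroColumn (inject₁ i) δ) ≡ sgn (toℕ (inject₁ i)) * D δ →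
      D (insertZeroColumn (suc i) δ) ≡ sgn (toℕ (suc i)) * D δ
    step i ih = begin
      D (insertZeroColumn (suc i) δ)      ≡⟨ respects (rows≗ (suc i)) ⟩
      D (rows (suc i))                    ≡⟨ swapRows {zero} {suc i} (rows (inject₁ i)) (rows (suc i)) (λ ()) (λ N → alternating N (λ ())) atZero atSuc off ⟩
      - D (rows (inject₁ i))              ≡⟨ cong -_ (trans (sym (respects (rows≗ (inject₁ i)))) ih) ⟩
      - (sgn (toℕ (inject₁ i)) * D δ)     ≡⟨ ℤ.neg-distribˡ-* (sgn (toℕ (inject₁ i))) (D δ) ⟩
      - sgn (toℕ (inject₁ i)) * D δ       ≡⟨ cong (_* D δ) (sym (sgn-inject₁ i)) ⟩
      sgn (toℕ (suc i)) * D δ             ∎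
      where
      at-i : punchIn (inject₁ i) i ≡ suc i × punchIn (suc i) i ≡ inject₁ i
      at-i with punchIn-adjacent i i
      ... | inj₁ (_ , p , q) = p , q
      ... | inj₂ (i≢i , _) = contradiction refl i≢i
      atZero : ∀ j → δ (suc i) j ≡ rows (inject₁ i) (suc i) j
      atZero j = cong (λ k → δ k j) (sym (proj₁ at-i))
      atSuc : ∀ j → rows (suc i) (suc i) j ≡ δ (inject₁ i) j
      atSuc j = cong (λ k → δ k j) (proj₂ at-i)
      off : ∀ l → l ≢ zero → l ≢ suc i → ∀ j → rows (suc i) l j ≡ rows (inject₁ i) l j
      off zero l≢0 _ j = contradiction refl l≢0
      off (suc l) _ l≢i j with punchIn-adjacent i l
      ... | inj₁ (l≡i , _) = contradiction (cong suc l≡i) l≢i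
      ... | inj₂ (_ , p) = cong (λ k → δ k j) (sym p)

  clear : ∀ j → D (M [ zero ]≔ δ j) ≡ (sgn (toℕ j) * D δ) * detℤ (minor M j)
  clear j = begin
    D (M [ zero ]≔ δ j)
      ≡⟨ sym (addToRows zero c (M [ zero ]≔ δ j) (insertZeroColumn j (minor M j)) refl cleared) ⟩
    D (insertZeroColumn j (minor M j))
      ≡⟨ alternating-unique (insertZeroColumn-alternating alt j) (minor M j) ⟩
    D (insertZeroColumn j δ) * detℤ (minor M j)
      ≡⟨ cong (_* detℤ (minor M j)) (unitAt j) ⟩
    (sgn (toℕ j) * D δ) * detℤ (minor M j) ∎
    where
    c : Fin (suc n) → ℤ
    c zero = 0ℤ
    c (suc i) = - M (suc i) j
    cleared : ∀ i l → insertZeroColumn j (minor M j) i l ≡ (M [ zero ]≔ δ j) i l + c i * δ j l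
    cleared zero l = sym (ℤ.+-identityʳ (δ j l))
    cleared (suc i) l with punchIn-view j l
    ... | inj₁ refl = trans (insertAt-lookup (minor M l i) l 0ℤ)
      (sym (trans (cong (λ x → M (suc i) l + - M (suc i) l * x) (δ-diag l)) (trans (lemma₂ 1ℤ (M (suc i) l)) (ℤ.*-zeroʳ (M (suc i) l)))))
    ... | inj₂ (k , refl) = trans (insertAt-punchIn (minor M j i) j 0ℤ k)
      (sym (trans (cong (λ x → M (suc i) (punchIn j k) + - M (suc i) j * x) (δ-off (Fin.punchInᵢ≢i j k ∘ sym)))
        (trans (cong (_+_ (M (suc i) (punchIn j k))) (ℤ.*-zeroʳ (- M (suc i) j))) (ℤ.+-identityʳ _))))

-- Consequences of uniqueness: transposes, products, permutations, blocks

detℤ-firstRow : ∀ {n} (M : Mat (suc n)) x → (∀ j → M zero j ≡ x * δ zero j) → detℤ M ≡ x * detℤ (minor M zero)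
detℤ-firstRow M x h = begin
  detℤ M
    ≡⟨ detℤ-suc M ⟩
  ∑ (λ j → sgn (toℕ j) * (M zero j * detℤ (minor M j)))
    ≡⟨ ∑-cong (λ j → trans (cong (λ y → sgn (toℕ j) * (y * detℤ (minor M j))) (h j))
         (lemma (sgn (toℕ j)) x (δ zero j) (detℤ (minor M j)))) ⟩
  ∑ (λ j → δ zero j * (x * (sgn (toℕ j) * detℤ (minor M j))))
    ≡⟨ ∑-δˡ zero (λ j → x * (sgn (toℕ j) * detℤ (minor M j))) ⟩
  x * (1ℤ * detℤ (minor M zero))
    ≡⟨ cong (x *_) (ℤ.*-identityˡ (detℤ (minor M zero))) ⟩
  x * detℤ (minor M zero) ∎
  where
  open ≡-Reasoning
  lemma : ∀ s x d m → s * ((x * d) * m) ≡ d * (x * (s * m))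
  lemma = solve-∀

detℤ-δ : ∀ n → detℤ (δ {n}) ≡ 1ℤ
detℤ-δ zero = detℤ-zero δ
detℤ-δ (suc n) = trans (detℤ-firstRow δ 1ℤ (λ j → sym (ℤ.*-identityˡ (δ zero j))))
  (trans (ℤ.*-identityˡ _) (trans (detℤ-cong {M = minor δ zero} {δ} (δ-injective suc Fin.suc-injective)) (detℤ-δ n)))

-- What has been shown about columns says that the determinant of the transpose is an alternating
-- function of the rows; it is 1 at the identity, so uniqueness applies. Only then is the Laplace
-- expansion known to alternate in its own rows.
detℤ-ᵀ : ∀ {n} (M : Mat n) → detℤ (M ᵀ) ≡ detℤ M
detℤ-ᵀ {n} M = begin
  detℤ (M ᵀ)                ≡⟨ alternating-unique {D = λ A → detℤ (A ᵀ)} columnwise M ⟩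
  detℤ (δ {n} ᵀ) * detℤ M   ≡⟨ cong (_* detℤ M) (trans (detℤ-cong {M = δ ᵀ} {δ} (λ i j → δ-sym j i)) (detℤ-δ n)) ⟩
  1ℤ * detℤ M               ≡⟨ ℤ.*-identityˡ (detℤ M) ⟩
  detℤ M                    ∎
  where
  open ≡-Reasoning
  columnwise : Alternating (λ A → detℤ (A ᵀ))
  columnwise = record { multilinear = detℤ-ᵀ-multilinear ; alternating = λ A → detℤ-equalColumns (A ᵀ) }

detℤ-alternating : ∀ {n} → Alternating (detℤ {n})
detℤ-alternating = record
  { multilinear = record
      { respects = detℤ-cong
      ; linear = λ i c {A} {B} {C} off off′ at → subst₂ _≡_ (detℤ-ᵀ A) (cong₂ (λ x y → x + c * y) (detℤ-ᵀ B) (detℤ-ᵀ C))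
          (detℤ-linearColumn i c {A ᵀ} {B ᵀ} {C ᵀ} off off′ at)
      }
  ; alternating = λ A i≢k h → trans (sym (detℤ-ᵀ A)) (detℤ-equalColumns (A ᵀ) i≢k h)
  }

infixl 7 _⊡_

_⊡_ : ∀ {l m n} → (Fin l → Fin m → ℤ) → (Fin m → Fin n → ℤ) → Fin l → Fin n → ℤ
(A ⊡ B) i k = ∑ λ j → A i j * B j k

-- For fixed `B` the left side is alternating in `A` and equals `detℤ B` at the identity. The same
-- argument, with another alternating function, gives the rules for simultaneous permutation and for
-- block matrices.
detℤ-⊡ : ∀ {n} (A B : Mat n) → detℤ (A ⊡ B) ≡ detℤ A * detℤ B
detℤ-⊡ A B = begin
  detℤ (A ⊡ B)             ≡⟨ alternating-unique {D = λ M → detℤ (M ⊡ B)} alt A ⟩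
  detℤ (δ ⊡ B) * detℤ A    ≡⟨ cong (_* detℤ A) (detℤ-cong {M = δ ⊡ B} {B} (λ i k → ∑-δˡ i (λ j → B j k))) ⟩
  detℤ B * detℤ A          ≡⟨ ℤ.*-comm (detℤ B) (detℤ A) ⟩
  detℤ A * detℤ B          ∎
  where
  open ≡-Reasoning
  open Alternating detℤ-alternating
  lemma : ∀ a b c x → (a + c * b) * x ≡ a * x + c * (b * x)
  lemma = solve-∀
  row-cong : ∀ (M M′ : Mat _) i → (∀ j → M i j ≡ M′ i j) → ∀ k → (M ⊡ B) i k ≡ (M′ ⊡ B) i k
  row-cong M M′ i h k = ∑-cong (λ j → cong (_* B j k) (h j))
  alt : Alternating (λ M → detℤ (M ⊡ B))
  alt = record
    { multilinear = record
        { respects = λ {M} {M′} h → respects {M ⊡ B} {M′ ⊡ B} (λ i → row-cong M M′ i (h i))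
        ; linear = λ i c {M} {M′} {M″} off off′ at → linear i c {M ⊡ B} {M′ ⊡ B} {M″ ⊡ B}
            (λ k k≢i → row-cong M M′ k (off k k≢i)) (λ k k≢i → row-cong M M″ k (off′ k k≢i))
            (λ k → trans (∑-cong (λ j → trans (cong (_* B j k) (at j)) (lemma (M′ i j) (M″ i j) c (B j k))))
              (∑-linear c (λ j → M′ i j * B j k) (λ j → M″ i j * B j k)))
        }
    ; alternating = λ M i≢k h → alternating (M ⊡ B) i≢k (λ l → ∑-cong (λ j → cong (_* B j l) (h j)))
    }

detℤ-permute : ∀ {n} (f g : Fin n → Fin n) → (∀ i → f (g i) ≡ i) → (∀ i → g (f i) ≡ i) →
  ∀ M → detℤ (λ i j → M (f i) (f j)) ≡ detℤ M
detℤ-permute {n} f g fg gf M = begin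
  detℤ (λ i j → M (f i) (f j))           ≡⟨ alternating-unique {D = λ A → detℤ (λ i j → A (f i) (f j))} alt M ⟩
  detℤ (λ i j → δ (f i) (f j)) * detℤ M  ≡⟨ cong (_* detℤ M) (trans (detℤ-cong (δ-injective f f-injective)) (detℤ-δ n)) ⟩
  1ℤ * detℤ M                            ≡⟨ ℤ.*-identityˡ (detℤ M) ⟩
  detℤ M                                 ∎
  where
  open ≡-Reasoning
  open Alternating detℤ-alternating
  f-injective : ∀ {i j} → f i ≡ f j → i ≡ j
  f-injective {i} {j} e = trans (sym (gf i)) (trans (cong g e) (gf j))
  away : ∀ {i k} → k ≢ g i → f k ≢ i
  away k≢gi fk≡i = k≢gi (trans (sym (gf _)) (cong g fk≡i))
  alt : Alternating (λ A → detℤ (λ i j → A (f i) (f j)))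
  alt = record
    { multilinear = record
        { respects = λ h → respects (λ i j → h (f i) (f j))
        ; linear = λ i c {A} {B} {C} off off′ at → linear (g i) c
            (λ k k≢ j → off (f k) (away k≢) (f j)) (λ k k≢ j → off′ (f k) (away k≢) (f j))
            (λ j → subst (λ l → A l (f j) ≡ B l (f j) + c * C l (f j)) (sym (fg i)) (at (f j)))
        }
    ; alternating = λ {i} {k} A i≢k h → alternating {g i} {g k} _
        (λ e → i≢k (trans (sym (fg i)) (trans (cong f e) (fg k))))
        (λ j → subst₂ (λ a b → A a (f j) ≡ A b (f j)) (sym (fg i)) (sym (fg k)) (h (f j)))
    }

blockEntry : ∀ {k m} → Mat k → Mat m → Fin k ⊎ Fin m → Fin k ⊎ Fin m → ℤ
blockEntry A B (inj₁ i) (inj₁ j) = A i j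
blockEntry A B (inj₂ i) (inj₂ j) = B i j
blockEntry A B _ _ = 0ℤ

blockDiag : ∀ {k m} → Mat k → Mat m → Mat (k ℕ.+ m)
blockDiag {k} A B u v = blockEntry A B (splitAt k u) (splitAt k v)

detℤ-blockDiag : ∀ {k m} (A : Mat k) (B : Mat m) → detℤ (blockDiag A B) ≡ detℤ A * detℤ B
detℤ-blockDiag {k} {m} A B = begin
  detℤ (blockDiag A B)             ≡⟨ alternating-unique {D = λ M → detℤ (blockDiag M B)} alt A ⟩
  detℤ (blockDiag δ B) * detℤ A    ≡⟨ cong (_* detℤ A) (identity k) ⟩
  detℤ B * detℤ A                  ≡⟨ ℤ.*-comm (detℤ B) (detℤ A) ⟩
  detℤ A * detℤ B                  ∎
  where
  open ≡-Reasoning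
  open Alternating detℤ-alternating
  entry-row : ∀ (M M′ : Mat k) x → (∀ i → x ≡ inj₁ i → ∀ j → M i j ≡ M′ i j) → ∀ y → blockEntry M B x y ≡ blockEntry M′ B x y
  entry-row M M′ (inj₁ i) h (inj₁ j) = h i refl j
  entry-row M M′ (inj₁ i) h (inj₂ j) = refl
  entry-row M M′ (inj₂ i) h (inj₁ j) = refl
  entry-row M M′ (inj₂ i) h (inj₂ j) = refl
  splitAt-inj₁ : ∀ u i → splitAt k u ≡ inj₁ i → u ≡ i ↑ˡ m
  splitAt-inj₁ u i e = sym (Fin.splitAt⁻¹-↑ˡ e)
  off-row : ∀ (M M′ : Mat k) i → (∀ l → l ≢ i → ∀ j → M l j ≡ M′ l j) →
    ∀ u → u ≢ i ↑ˡ m → ∀ v → blockDiag M B u v ≡ blockDiag M′ B u v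
  off-row M M′ i h u u≢ v = entry-row M M′ (splitAt k u)
    (λ l e → h l (λ l≡i → u≢ (trans (splitAt-inj₁ u l e) (cong (_↑ˡ m) l≡i)))) (splitAt k v)
  entry-linear : ∀ c (M M′ M″ : Mat k) i → (∀ j → M i j ≡ M′ i j + c * M″ i j) →
    ∀ y → blockEntry M B (inj₁ i) y ≡ blockEntry M′ B (inj₁ i) y + c * blockEntry M″ B (inj₁ i) y
  entry-linear c M M′ M″ i h (inj₁ j) = h j
  entry-linear c M M′ M″ i h (inj₂ j) = sym (cong (_+_ 0ℤ) (ℤ.*-zeroʳ c))
  entry-equal : ∀ (M : Mat k) i l → (∀ j → M i j ≡ M l j) → ∀ y → blockEntry M B (inj₁ i) y ≡ blockEntry M B (inj₁ l) y
  entry-equal M i l h (inj₁ j) = h j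
  entry-equal M i l h (inj₂ j) = refl
  alt : Alternating (λ M → detℤ (blockDiag M B))
  alt = record
    { multilinear = record
        { respects = λ {M} {M′} h → respects {blockDiag M B} {blockDiag M′ B}
            (λ u v → entry-row M M′ (splitAt k u) (λ i _ → h i) (splitAt k v))
        ; linear = λ i c {M} {M′} {M″} off off′ at → linear (i ↑ˡ m) c {blockDiag M B} {blockDiag M′ B} {blockDiag M″ B}
            (off-row M M′ i off) (off-row M M″ i off′)
            (λ v → subst (λ x → blockEntry M B x (splitAt k v) ≡ blockEntry M′ B x (splitAt k v) + c * blockEntry M″ B x (splitAt k v))
              (sym (Fin.splitAt-↑ˡ k i m)) (entry-linear c M M′ M″ i at (splitAt k v)))
        }
    ; alternating = λ {i} {l} M i≢l h → alternating {i ↑ˡ m} {l ↑ˡ m} (blockDiag M B) (i≢l ∘ Fin.↑ˡ-injective m i l)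
        (λ v → subst₂ (λ x y → blockEntry M B x (splitAt k v) ≡ blockEntry M B y (splitAt k v))
          (sym (Fin.splitAt-↑ˡ k i m)) (sym (Fin.splitAt-↑ˡ k l m)) (entry-equal M i l h (splitAt k v)))
    }
  identity : ∀ k′ → detℤ (blockDiag (δ {k′}) B) ≡ detℤ B
  identity zero = refl
  identity (suc k′) = begin
    detℤ (blockDiag (δ {suc k′}) B)
      ≡⟨ detℤ-firstRow (blockDiag (δ {suc k′}) B) 1ℤ topRow ⟩
    1ℤ * detℤ (minor (blockDiag (δ {suc k′}) B) zero)
      ≡⟨ trans (ℤ.*-identityˡ _) (detℤ-cong {M = minor (blockDiag (δ {suc k′}) B) zero} {blockDiag (δ {k′}) B} rest) ⟩
    detℤ (blockDiag (δ {k′}) B)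
      ≡⟨ identity k′ ⟩
    detℤ B ∎
    where
    topRow : ∀ v → blockDiag (δ {suc k′}) B zero v ≡ 1ℤ * δ zero v
    topRow zero = refl
    topRow (suc v) with splitAt k′ v
    ... | inj₁ j = refl
    ... | inj₂ j = refl
    rest : ∀ u v → blockDiag (δ {suc k′}) B (suc u) (suc v) ≡ blockDiag (δ {k′}) B u v
    rest u v with splitAt k′ u | splitAt k′ v
    ... | inj₁ i | inj₁ j = δ-injective suc Fin.suc-injective i j
    ... | inj₁ i | inj₂ j = refl
    ... | inj₂ i | inj₁ j = refl
    ... | inj₂ i | inj₂ j = refl

-- Adjugates

-- Replacing row `j` by a unit vector gives the cofactor without deleting a row and a column, so the
-- order of the matrix does not change. The diagonal entries are the principal minors of order one
-- less.
adjugate : ∀ {n} → Mat n → Mat n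
adjugate M k j = detℤ (M [ j ]≔ δ k)

-- The left side is the expansion of the determinant of `M` with row `j` overwritten by row `i`: two
-- equal rows unless `i` is `j`.
⊡-adjugate : ∀ {n} (M : Mat n) i j → (M ⊡ adjugate M) i j ≡ δ i j * detℤ M
⊡-adjugate M i j = begin
  ∑ (λ k → M i k * detℤ (M [ j ]≔ δ k))
    ≡⟨ ∑-cong (λ k → cong (M i k *_) (sym (respects (overwrite k)))) ⟩
  ∑ (λ k → M i k * detℤ ((M [ j ]≔ M i) [ j ]≔ δ k))
    ≡⟨ sym (expandRow j (M [ j ]≔ M i) (M i) δ (λ l → trans (≔-at M j (M i) l) (sym (∑-δʳ (M i) l)))) ⟩
  detℤ (M [ j ]≔ M i)
    ≡⟨ value ⟩
  δ i j * detℤ M ∎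
  where
  open ≡-Reasoning
  open Alternating detℤ-alternating
  open AlternatingProperties detℤ-alternating
  overwrite : ∀ k l m → ((M [ j ]≔ M i) [ j ]≔ δ k) l m ≡ (M [ j ]≔ δ k) l m
  overwrite k l m with l ≟ j
  ... | yes refl = trans (≔-at (M [ l ]≔ M i) l (δ k) m) (sym (≔-at M l (δ k) m))
  ... | no l≢j = trans (≔-off (M [ j ]≔ M i) j (δ k) l l≢j m)
    (trans (≔-off M j (M i) l l≢j m) (sym (≔-off M j (δ k) l l≢j m)))
  restore : ∀ l m → (M [ i ]≔ M i) l m ≡ M l m
  restore l m with l ≟ i
  ... | yes refl = ≔-at M l (M l) m
  ... | no l≢i = ≔-off M i (M i) l l≢i m
  value : detℤ (M [ j ]≔ M i) ≡ δ i j * detℤ M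
  value with i ≟ j
  ... | yes refl = trans (respects restore) (sym (ℤ.*-identityˡ (detℤ M)))
  ... | no i≢j = alternating (M [ j ]≔ M i) i≢j (λ m → trans (≔-off M j (M i) i i≢j m) (sym (≔-at M j (M i) m)))

-- Injectivity without division: column `j` of the adjugate of `M ᵀ`, used as a row vector `L`,
-- satisfies `L M = det * δ j`, so `M x = 0` gives `det * x j = 0`.
⊡-kernel : ∀ {n} (M : Mat n) (x : Fin n → ℤ) → detℤ M ≢ 0ℤ → (∀ i → ∑ (λ k → M i k * x k) ≡ 0ℤ) → ∀ j → x j ≡ 0ℤ
⊡-kernel M x det≢0 Mx≡0 j with ℤ.i*j≡0⇒i≡0∨j≡0 (detℤ (M ᵀ)) product
  where
  open ≡-Reasoning
  L : _ → ℤ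
  L i = adjugate (M ᵀ) i j
  lemma : ∀ a b c → a * (b * c) ≡ (b * a) * c
  lemma = solve-∀
  product : detℤ (M ᵀ) * x j ≡ 0ℤ
  product = begin
    detℤ (M ᵀ) * x j
      ≡⟨ ℤ.*-comm (detℤ (M ᵀ)) (x j) ⟩
    x j * detℤ (M ᵀ)
      ≡⟨ sym (∑-δˡ j (λ k → x k * detℤ (M ᵀ))) ⟩
    ∑ (λ k → δ j k * (x k * detℤ (M ᵀ)))
      ≡⟨ ∑-cong (λ k → trans (trans (cong (_* (x k * detℤ (M ᵀ))) (δ-sym j k)) (swap (δ k j) (x k) (detℤ (M ᵀ))))
           (cong (_* x k) (sym (⊡-adjugate (M ᵀ) k j)))) ⟩
    ∑ (λ k → ∑ (λ i → M i k * L i) * x k)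
      ≡⟨ ∑-cong (λ k → *-distribʳ-sum (x k) (λ i → M i k * L i)) ⟩
    ∑ (λ k → ∑ (λ i → (M i k * L i) * x k))
      ≡⟨ ∑-comm (λ k i → (M i k * L i) * x k) ⟩
    ∑ (λ i → ∑ (λ k → (M i k * L i) * x k))
      ≡⟨ ∑-cong (λ i → trans (∑-cong (λ k → sym (lemma (L i) (M i k) (x k)))) (sym (*-distribˡ-sum (L i) (λ k → M i k * x k)))) ⟩
    ∑ (λ i → L i * ∑ (λ k → M i k * x k))
      ≡⟨ ∑-zero _ (λ i → trans (cong (L i *_) (Mx≡0 i)) (ℤ.*-zeroʳ (L i))) ⟩
    0ℤ ∎
    where
    swap : ∀ d x y → d * (x * y) ≡ (d * y) * x
    swap = solve-∀
... | inj₁ det≡0 = contradiction (trans (sym (detℤ-ᵀ M)) det≡0) det≢0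
... | inj₂ xj≡0 = xj≡0

detℤ-rankOne : ∀ {n} (M : Mat n) v t → detℤ (λ i k → M i k + t * (δ v i * δ v k)) ≡ detℤ M + t * adjugate M v v
detℤ-rankOne M v t = linear v t {_} {M} {M [ v ]≔ δ v}
  off
  (λ i i≢v k → trans (off i i≢v k) (sym (≔-off M v (δ v) i i≢v k)))
  (λ k → cong (λ x → M v k + t * x) (trans (cong (_* δ v k) (δ-diag v)) (trans (ℤ.*-identityˡ (δ v k)) (sym (≔-at M v (δ v) k)))))
  where
  open Alternating detℤ-alternating
  off : ∀ i → i ≢ v → ∀ k → M i k + t * (δ v i * δ v k) ≡ M i k
  off i i≢v k = trans (cong (λ x → M i k + t * (x * δ v k)) (δ-off (i≢v ∘ sym)))
    (trans (cong (_+_ (M i k)) (ℤ.*-zeroʳ t)) (ℤ.+-identityʳ (M i k)))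

adjugate-symmetric : ∀ {n} (M : Mat n) → (∀ i j → M i j ≡ M j i) → ∀ k j → adjugate M k j ≡ adjugate M j k
adjugate-symmetric {n} M M-sym k j = begin
  adjugate M k j        ≡⟨ sym (cleared k j) ⟩
  detℤ (Z k j)     ≡⟨ sym (detℤ-ᵀ (Z k j)) ⟩
  detℤ (Z k j ᵀ)   ≡⟨ respects transposed ⟩
  detℤ (Z j k)     ≡⟨ cleared j k ⟩
  adjugate M j k        ∎
  where
  open ≡-Reasoning
  open Alternating detℤ-alternating
  open AlternatingProperties detℤ-alternating
  -- `M` with row `j` and column `k` cleared and 1 at their crossing. Clearing the column subtracts
  -- multiples of the unit row, so the determinant is unchanged, and the cleared form is exchanged
  -- with its mirror image by transposition.
  Z : Fin n → Fin n → Mat n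
  Z k j i l = (1ℤ - δ i j) * (1ℤ - δ k l) * M i l + δ i j * δ k l
  transposed : ∀ i l → (Z k j ᵀ) i l ≡ Z j k i l
  transposed i l = begin
    (1ℤ - δ l j) * (1ℤ - δ k i) * M l i + δ l j * δ k i
      ≡⟨ cong₂ _+_ (cong₂ _*_ (cong₂ (λ a b → (1ℤ - a) * (1ℤ - b)) (δ-sym l j) (δ-sym k i)) (M-sym l i))
           (cong₂ _*_ (δ-sym l j) (δ-sym k i)) ⟩
    (1ℤ - δ j l) * (1ℤ - δ i k) * M i l + δ j l * δ i k
      ≡⟨ lemma (δ j l) (δ i k) (M i l) ⟩
    (1ℤ - δ i k) * (1ℤ - δ j l) * M i l + δ i k * δ j l ∎
    where
    lemma : ∀ a b m → (1ℤ - a) * (1ℤ - b) * m + a * b ≡ (1ℤ - b) * (1ℤ - a) * m + b * a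
    lemma = solve-∀
  δ-subst : ∀ (a : Fin n → ℤ) k l → a l * δ k l ≡ a k * δ k l
  δ-subst a k l with k ≟ l
  ... | yes refl = refl
  ... | no _ = trans (ℤ.*-zeroʳ (a l)) (sym (ℤ.*-zeroʳ (a k)))
  cleared : ∀ k j → detℤ (Z k j) ≡ adjugate M k j
  cleared k j = addToRows j (λ i → (δ i j - 1ℤ) * M i k) (M [ j ]≔ δ k) (Z k j)
    (trans (cong (λ x → (x - 1ℤ) * M j k) (δ-diag j)) (ℤ.*-zeroˡ (M j k))) entry
    where
    lemma₀ : ∀ d m m′ → (1ℤ - 0ℤ) * (1ℤ - d) * m + 0ℤ * d ≡ m - m * d
    lemma₀ = solve-∀
    lemma₁ : ∀ d m m′ → (1ℤ - 1ℤ) * (1ℤ - d) * m + 1ℤ * d ≡ d + ((1ℤ - 1ℤ) * m′) * d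
    lemma₁ = solve-∀
    lemma₂ : ∀ d m m′ → m - m′ * d ≡ m + ((0ℤ - 1ℤ) * m′) * d
    lemma₂ = solve-∀
    entry : ∀ i l → Z k j i l ≡ (M [ j ]≔ δ k) i l + ((δ i j - 1ℤ) * M i k) * (M [ j ]≔ δ k) j l
    entry i l with i ≟ j
    ... | yes refl = trans (lemma₁ (δ k l) (M i l) (M i k))
      (sym (cong (λ x → x + ((1ℤ - 1ℤ) * M i k) * x) (≔-at M i (δ k) l)))
    ... | no i≢j = begin
      (1ℤ - 0ℤ) * (1ℤ - δ k l) * M i l + 0ℤ * δ k l
        ≡⟨ lemma₀ (δ k l) (M i l) (M i k) ⟩
      M i l - M i l * δ k l
        ≡⟨ cong (λ x → M i l - x) (δ-subst (M i) k l) ⟩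
      M i l - M i k * δ k l
        ≡⟨ lemma₂ (δ k l) (M i l) (M i k) ⟩
      M i l + ((0ℤ - 1ℤ) * M i k) * δ k l
        ≡⟨ sym (cong₂ (λ x y → x + ((0ℤ - 1ℤ) * M i k) * y) (≔-off M j (δ k) i i≢j l) (≔-at M j (δ k) l)) ⟩
      (M [ j ]≔ δ k) i l + ((0ℤ - 1ℤ) * M i k) * (M [ j ]≔ δ k) j l ∎

-- Congruences

infix 4 _≈_[mod_]

-- The modulus is an arbitrary integer, possibly negative or zero, since differences of evaluation
-- points such as `t - c` are used as moduli.
record _≈_[mod_] (a b c : ℤ) : Set where
  constructor _by_
  field
    quotient : ℤ
    difference : a ≡ b + c * quotient

module _ {c : ℤ} where
  ≡⇒≈ : ∀ {a b} → a ≡ b → a ≈ b [mod c ]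
  ≡⇒≈ {a} {b} refl = 0ℤ by sym (trans (cong (_+_ a) (ℤ.*-zeroʳ c)) (ℤ.+-identityʳ a))

  ≈-sym : ∀ {a b} → a ≈ b [mod c ] → b ≈ a [mod c ]
  ≈-sym {a} {b} (k by refl) = (- k) by lemma b c k
    where
    lemma : ∀ b c k → b ≡ (b + c * k) + c * - k
    lemma = solve-∀

  ≈-trans : ∀ {a b d} → a ≈ b [mod c ] → b ≈ d [mod c ] → a ≈ d [mod c ]
  ≈-trans {d = d} (k by refl) (l by refl) = (l + k) by lemma d c k l
    where
    lemma : ∀ d c k l → (d + c * l) + c * k ≡ d + c * (l + k)
    lemma = solve-∀

  ≈-+ : ∀ {a b a′ b′} → a ≈ b [mod c ] → a′ ≈ b′ [mod c ] → a + a′ ≈ b + b′ [mod c ]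
  ≈-+ {b = b} {b′ = b′} (k by refl) (l by refl) = (k + l) by lemma b b′ c k l
    where
    lemma : ∀ b b′ c k l → (b + c * k) + (b′ + c * l) ≡ (b + b′) + c * (k + l)
    lemma = solve-∀

  ≈-* : ∀ {a b a′ b′} → a ≈ b [mod c ] → a′ ≈ b′ [mod c ] → a * a′ ≈ b * b′ [mod c ]
  ≈-* {b = b} {b′ = b′} (k by refl) (l by refl) = (b * l + k * b′ + c * k * l) by lemma b b′ c k l
    where
    lemma : ∀ b b′ c k l → (b + c * k) * (b′ + c * l) ≡ b * b′ + c * (b * l + k * b′ + c * k * l)
    lemma = solve-∀

  ≈-∑ : ∀ {n} {f g : Fin n → ℤ} → (∀ i → f i ≈ g i [mod c ]) → ∑ f ≈ ∑ g [mod c ]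
  ≈-∑ {zero} h = ≡⇒≈ refl
  ≈-∑ {suc n} h = ≈-+ (h zero) (≈-∑ (h ∘ suc))

  detℤ-≈ : ∀ {n} {M M′ : Mat n} → (∀ i j → M i j ≈ M′ i j [mod c ]) → detℤ M ≈ detℤ M′ [mod c ]
  detℤ-≈ {zero} {M} {M′} h = ≡⇒≈ (detℤ-cong {M = M} {M′} (λ ()))
  detℤ-≈ {suc n} {M} {M′} h = ≈-trans (≡⇒≈ (detℤ-suc M)) (≈-trans
    (≈-∑ (λ j → ≈-* (≡⇒≈ {sgn (toℕ j)} refl) (≈-* (h zero j) (detℤ-≈ {M = minor M j} {minor M′ j} (λ i k → h (suc i) (punchIn j k))))))
    (≡⇒≈ (sym (detℤ-suc M′))))

  adjugate-≈ : ∀ {n} {M M′ : Mat n} → (∀ i j → M i j ≈ M′ i j [mod c ]) → ∀ k j → adjugate M k j ≈ adjugate M′ k j [mod c ]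
  adjugate-≈ {M = M} {M′} h k j = detℤ-≈ {M = M [ j ]≔ δ k} {M′ [ j ]≔ δ k} entry
    where
    entry : ∀ i l → (M [ j ]≔ δ k) i l ≈ (M′ [ j ]≔ δ k) i l [mod c ]
    entry i l with i ≟ j
    ... | yes refl = ≡⇒≈ (trans (≔-at M i (δ k) l) (sym (≔-at M′ i (δ k) l)))
    ... | no i≢j = ≈-trans (≡⇒≈ (≔-off M j (δ k) i i≢j l)) (≈-trans (h i l) (≡⇒≈ (sym (≔-off M′ j (δ k) i i≢j l))))

≈-scale : ∀ t {c a b} → a ≈ b [mod c ] → t * a ≈ t * b [mod t * c ]
≈-scale t {c} {b = b} (k by refl) = k by lemma t b c k
  where
  lemma : ∀ t b c k → t * (b + c * k) ≡ t * b + t * c * k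
  lemma = solve-∀

trace : ∀ {n} → Mat n → ℤ
trace M = ∑ λ v → M v v

-- First-order Taylor expansion: the derivative at 0 is the sum of the principal minors. The
-- diagonal entries are shifted one by one; each step adds `t` times a principal minor of a partly
-- shifted matrix, and modulo `t` that minor is the original one.
detℤ-shift : ∀ {n} (M : Mat n) t →
  detℤ (λ i k → M i k + t * δ i k) ≈ detℤ M + t * trace (adjugate M) [mod t * t ]
detℤ-shift {n} M t = ≈-trans
  (≈-trans (≡⇒≈ (respects (λ i k → cong (λ x → M i k + t * x) (sym (ℤ.*-identityˡ (δ i k))))))
    (vectorInduction P P-resp base step (λ _ → 1ℤ)))
  (≡⇒≈ (cong (λ x → detℤ M + t * x) (∑-cong (λ v → ℤ.*-identityˡ (adjugate M v v)))))
  where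
  open ≡-Reasoning
  open Alternating detℤ-alternating
  shifted : (Fin n → ℤ) → Mat n
  shifted c i k = M i k + t * (c i * δ i k)
  P : (Fin n → ℤ) → Set
  P c = detℤ (shifted c) ≈ detℤ M + t * ∑ (λ v → c v * adjugate M v v) [mod t * t ]
  P-resp : ∀ {c c′} → (∀ i → c i ≡ c′ i) → P c → P c′
  P-resp h p = ≈-trans (≡⇒≈ (respects (λ i k → cong (λ x → M i k + t * (x * δ i k)) (sym (h i)))))
    (≈-trans p (≡⇒≈ (cong (λ x → detℤ M + t * x) (∑-cong (λ v → cong (_* adjugate M v v) (h v))))))
  base : P (λ _ → 0ℤ)
  base = ≡⇒≈ (trans
    (respects (λ i k → trans (cong (_+_ (M i k)) (ℤ.*-zeroʳ t)) (ℤ.+-identityʳ (M i k))))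
    (sym (trans (cong (λ x → detℤ M + t * x) (∑-zero _ (λ v → ℤ.*-zeroˡ (adjugate M v v))))
      (trans (cong (_+_ (detℤ M)) (ℤ.*-zeroʳ t)) (ℤ.+-identityʳ (detℤ M))))))
  lemma : ∀ m t c x d e → m + t * ((c + x * d) * e) ≡ (m + t * (c * e)) + t * x * (d * e)
  lemma = solve-∀
  δδ : ∀ (i a b : Fin n) → δ i a * δ a b ≡ δ i a * δ i b
  δδ i a b with i ≟ a
  ... | yes refl = refl
  ... | no _ = refl
  step : ∀ c i x → P c → P (λ k → c k + x * δ i k)
  step c i x p = ≈-trans (≡⇒≈ (trans (respects entry) (detℤ-rankOne (shifted c) i (t * x))))
    (≈-trans (≈-+ p perturbed)
      (≡⇒≈ (trans (collect (detℤ M) t (∑ (λ v → c v * adjugate M v v)) x (adjugate M i i))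
        (cong (λ y → detℤ M + t * y) (sym newSum)))))
    where
    entry : ∀ a b → M a b + t * ((c a + x * δ i a) * δ a b) ≡ shifted c a b + t * x * (δ i a * δ i b)
    entry a b = trans (lemma (M a b) t (c a) x (δ i a) (δ a b)) (cong (λ y → shifted c a b + t * x * y) (δδ i a b))
    perturbed : t * x * adjugate (shifted c) i i ≈ t * (x * adjugate M i i) [mod t * t ]
    perturbed = ≈-trans (≡⇒≈ (ℤ.*-assoc t x (adjugate (shifted c) i i)))
      (≈-scale t (≈-* (≡⇒≈ {a = x} refl) (adjugate-≈ {M = shifted c} {M} (λ a b → (c a * δ a b) by refl) i i)))
    collect : ∀ d t s x a → (d + t * s) + t * (x * a) ≡ d + t * (s + x * a)
    collect = solve-∀
    newSum : ∑ (λ v → (c v + x * δ i v) * adjugate M v v) ≡ ∑ (λ v → c v * adjugate M v v) + x * adjugate M i i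
    newSum = begin
      ∑ (λ v → (c v + x * δ i v) * adjugate M v v)
        ≡⟨ ∑-cong (λ v → distribute (c v) x (δ i v) (adjugate M v v)) ⟩
      ∑ (λ v → c v * adjugate M v v + x * (δ i v * adjugate M v v))
        ≡⟨ ∑-linear x (λ v → c v * adjugate M v v) (λ v → δ i v * adjugate M v v) ⟩
      ∑ (λ v → c v * adjugate M v v) + x * ∑ (λ v → δ i v * adjugate M v v)
        ≡⟨ cong (λ y → ∑ (λ v → c v * adjugate M v v) + x * y) (∑-δˡ i (λ v → adjugate M v v)) ⟩
      ∑ (λ v → c v * adjugate M v v) + x * adjugate M i i ∎
      where
      distribute : ∀ c x d a → (c + x * d) * a ≡ c * a + x * (d * a)
      distribute = solve-∀

-- Matrix products and rank

⊡-assoc : ∀ {k l m n} (A : Fin k → Fin l → ℤ) (B : Fin l → Fin m → ℤ) (C : Fin m → Fin n → ℤ) →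
  ∀ i j → ((A ⊡ B) ⊡ C) i j ≡ (A ⊡ (B ⊡ C)) i j
⊡-assoc A B C i j = begin
  ∑ (λ b → ∑ (λ a → A i a * B a b) * C b j)
    ≡⟨ ∑-cong (λ b → *-distribʳ-sum (C b j) (λ a → A i a * B a b)) ⟩
  ∑ (λ b → ∑ (λ a → (A i a * B a b) * C b j))
    ≡⟨ ∑-comm (λ b a → (A i a * B a b) * C b j) ⟩
  ∑ (λ a → ∑ (λ b → (A i a * B a b) * C b j))
    ≡⟨ ∑-cong (λ a → trans (∑-cong (λ b → ℤ.*-assoc (A i a) (B a b) (C b j)))
         (sym (*-distribˡ-sum (A i a) (λ b → B a b * C b j)))) ⟩
  ∑ (λ a → A i a * ∑ (λ b → B a b * C b j)) ∎
  where open ≡-Reasoning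

⊡-congˡ : ∀ {l m n} {A A′ : Fin l → Fin m → ℤ} (B : Fin m → Fin n → ℤ) →
  (∀ i j → A i j ≡ A′ i j) → ∀ i k → (A ⊡ B) i k ≡ (A′ ⊡ B) i k
⊡-congˡ B h i k = ∑-cong (λ j → cong (_* B j k) (h i j))

⊡-congʳ : ∀ {l m n} (A : Fin l → Fin m → ℤ) {B B′ : Fin m → Fin n → ℤ} →
  (∀ i j → B i j ≡ B′ i j) → ∀ i k → (A ⊡ B) i k ≡ (A ⊡ B′) i k
⊡-congʳ A h i k = ∑-cong (λ j → cong (A i j *_) (h j k))

detℤ-zeroColumn : ∀ {n} (M : Mat n) k → (∀ i → M i k ≡ 0ℤ) → detℤ M ≡ 0ℤ
detℤ-zeroColumn M k h = trans (sym (detℤ-ᵀ M)) (AlternatingProperties.zeroRow detℤ-alternating k (M ᵀ) h)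

∑-split : ∀ {k d} (f : Fin (k ℕ.+ d) → ℤ) → ∑ f ≡ ∑ (λ i → f (i ↑ˡ d)) + ∑ (λ i → f (k ↑ʳ i))
∑-split {zero} f = sym (ℤ.+-identityˡ (∑ f))
∑-split {suc k} {d} f = trans (cong (_+_ (f zero)) (∑-split {k} {d} (f ∘ suc)))
  (sym (ℤ.+-assoc (f zero) (∑ (λ i → f (suc i ↑ˡ d))) (∑ (λ i → f (suc k ↑ʳ i)))))

-- Completing A and B by zeros to square matrices would give a singular A with A B = 1.
⊡-δ⇒≤ : ∀ {n k} (A : Fin n → Fin k → ℤ) (B : Fin k → Fin n → ℤ) → (∀ i j → (A ⊡ B) i j ≡ δ i j) → n ≤ k
⊡-δ⇒≤ {n} {k} A B AB≡δ with n ℕ.≤? k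
... | yes n≤k = n≤k
... | no n≰k with ℕ.m≤n⇒∃[o]m+o≡n (ℕ.≰⇒> n≰k)
...   | d , refl = contradiction (trans (sym one) (trans (detℤ-⊡ A⁺ B⁺) zero′)) λ ()
  where
  m : ℕ
  m = suc k ℕ.+ d
  A⁺ B⁺ : Mat m
  A⁺ i zero = 0ℤ
  A⁺ i (suc j) with splitAt k j
  ... | inj₁ a = A i a
  ... | inj₂ _ = 0ℤ
  B⁺ zero j = 0ℤ
  B⁺ (suc i) j with splitAt k i
  ... | inj₁ b = B b j
  ... | inj₂ _ = 0ℤ
  product : ∀ i j → (A⁺ ⊡ B⁺) i j ≡ (A ⊡ B) i j
  product i j = trans (ℤ.+-identityˡ _) (trans (∑-split {k} {d} (λ a → A⁺ i (suc a) * B⁺ (suc a) j))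
    (trans (cong₂ _+_ (∑-cong left) (∑-zero _ right)) (ℤ.+-identityʳ _)))
    where
    left : ∀ a → A⁺ i (suc (a ↑ˡ d)) * B⁺ (suc (a ↑ˡ d)) j ≡ A i a * B a j
    left a rewrite Fin.splitAt-↑ˡ k a d = refl
    right : ∀ a → A⁺ i (suc (k ↑ʳ a)) * B⁺ (suc (k ↑ʳ a)) j ≡ 0ℤ
    right a rewrite Fin.splitAt-↑ʳ k d a = refl
  one : detℤ (A⁺ ⊡ B⁺) ≡ 1ℤ
  one = trans (detℤ-cong {M = A⁺ ⊡ B⁺} {δ} (λ i j → trans (product i j) (AB≡δ i j))) (detℤ-δ m)
  zero′ : detℤ A⁺ * detℤ B⁺ ≡ 0ℤ
  zero′ = trans (cong (_* detℤ B⁺) (detℤ-zeroColumn A⁺ zero (λ _ → refl))) (ℤ.*-zeroˡ (detℤ B⁺))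

-- Units, parity and sums of squares

∣i∣≡1⇒i*i≡1 : ∀ i → ∣ i ∣ ≡ 1 → i * i ≡ 1ℤ
∣i∣≡1⇒i*i≡1 (+ .1) refl = refl
∣i∣≡1⇒i*i≡1 -[1+ .0 ] refl = refl

i*j≡1⇒i*i≡1 : ∀ i j → i * j ≡ 1ℤ → i * i ≡ 1ℤ
i*j≡1⇒i*i≡1 i j h = ∣i∣≡1⇒i*i≡1 i (ℕ.m*n≡1⇒m≡1 ∣ i ∣ ∣ j ∣ (trans (sym (ℤ.abs-* i j)) (cong ∣_∣ h)))

parity : ∀ i → ∃ λ k → (i ≡ + 2 * k) ⊎ (i ≡ 1ℤ + + 2 * k)
parity (+ n) = ℕ-parity n
  where
  lemma : ∀ k → 1ℤ + (1ℤ + + 2 * k) ≡ + 2 * (1ℤ + k)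
  lemma = solve-∀
  ℕ-parity : ∀ n → ∃ λ k → (+ n ≡ + 2 * k) ⊎ (+ n ≡ 1ℤ + + 2 * k)
  ℕ-parity zero = 0ℤ , inj₁ refl
  ℕ-parity (suc n) with ℕ-parity n
  ... | k , inj₁ e = k , inj₂ (cong (_+_ 1ℤ) e)
  ... | k , inj₂ e = 1ℤ + k , inj₁ (trans (cong (_+_ 1ℤ) e) (lemma k))
parity -[1+ n ] with parity (+ suc n)
... | k , inj₁ e = - k , inj₁ (trans (cong -_ e) (ℤ.neg-distribʳ-* (+ 2) k))
... | k , inj₂ e = - (1ℤ + k) , inj₂ (trans (cong -_ e) (lemma k))
  where
  lemma : ∀ k → - (1ℤ + + 2 * k) ≡ 1ℤ + + 2 * - (1ℤ + k)
  lemma = solve-∀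

square-≈ : ∀ i → i * i ≈ i [mod + 2 ]
square-≈ i with parity i
... | k , inj₁ refl = (+ 2 * (k * k) - k) by lemma k
  where
  lemma : ∀ k → (+ 2 * k) * (+ 2 * k) ≡ + 2 * k + + 2 * (+ 2 * (k * k) - k)
  lemma = solve-∀
... | k , inj₂ refl = (+ 2 * (k * k) + k) by lemma k
  where
  lemma : ∀ k → (1ℤ + + 2 * k) * (1ℤ + + 2 * k) ≡ (1ℤ + + 2 * k) + + 2 * (+ 2 * (k * k) + k)
  lemma = solve-∀

Odd : ℤ → Set
Odd i = i ≈ 1ℤ [mod + 2 ]

2*i≢1 : ∀ i → + 2 * i ≢ 1ℤ
2*i≢1 i h with trans (sym (ℤ.abs-* (+ 2) i)) (cong ∣_∣ h)
... | e with ∣ i ∣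
...   | zero = contradiction e λ ()
...   | suc k = contradiction (trans (sym (ℕ.+-suc (suc k) (k ℕ.+ 0))) e) λ ()

odd⇒≢0 : ∀ {i} → Odd i → i ≢ 0ℤ
odd⇒≢0 {i} (k by e) refl = 2*i≢1 (- k) (trans (lemma k) (cong (λ x → 1ℤ - x) (sym e)))
  where
  lemma : ∀ k → + 2 * - k ≡ 1ℤ - (1ℤ + + 2 * k)
  lemma = solve-∀

∑-squares : ∀ {n} (f : Fin n → ℤ) → ∃ λ k → ∑ (λ i → f i * f i) ≡ + k
∑-squares {zero} f = 0 , refl
∑-squares {suc n} f with ∑-squares (f ∘ suc)
... | k , e = ∣ f zero ∣ ℕ.* ∣ f zero ∣ ℕ.+ k , cong₂ _+_ (square (f zero)) e
  where
  square : ∀ i → i * i ≡ + (∣ i ∣ ℕ.* ∣ i ∣)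
  square (+ n) = sym (ℤ.pos-* n n)
  square -[1+ n ] = refl

-- In the adjugate C of a singular symmetric matrix C u u * C v v = C u v * C u v.
trace-adjugate≢0 : ∀ {n} (M : Mat (suc n)) → (∀ i j → M i j ≡ M j i) → detℤ M ≡ 0ℤ →
  (∀ u → Odd (adjugate M u u)) → trace (adjugate M) ≢ 0ℤ
trace-adjugate≢0 {n} M M-sym det≡0 diag-odd trace≡0 with ∑-squares (λ v → C zero (suc v))
  where
  C = adjugate M
... | k , e = contradiction (ℕ.m+n≡0⇒m≡0 (∣ C zero zero ∣ ℕ.* ∣ C zero zero ∣) (ℤ.+-injective total)) nonzero
  where
  open ≡-Reasoning
  C = adjugate M
  u : Fin (suc n)
  u = zero
  C≢0 : C u u ≢ 0ℤ
  C≢0 = odd⇒≢0 (diag-odd u)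
  MC≡0 : ∀ i j → ∑ (λ k → M i k * C k j) ≡ 0ℤ
  MC≡0 i j = trans (⊡-adjugate M i j) (trans (cong (δ i j *_) det≡0) (ℤ.*-zeroʳ (δ i j)))
  -- The vector `x`, a combination of columns `v` and `u` of `C`, is killed by `M` and vanishes at
  -- `u`. So it is killed by `M` with row `u` replaced by a unit vector, a matrix of determinant
  -- `C u u`, which is nonzero.
  rankOne : ∀ v → C u u * C v v ≡ C u v * C u v
  rankOne v = begin
    C u u * C v v   ≡⟨ ℤ.i-j≡0⇒i≡j _ _ (⊡-kernel (M [ u ]≔ δ u) x C≢0 rows v) ⟩
    C u v * C v u   ≡⟨ cong (C u v *_) (adjugate-symmetric M M-sym v u) ⟩
    C u v * C u v   ∎
    where
    x : Fin (suc n) → ℤ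
    x k = C u u * C k v - C u v * C k u
    lemma : ∀ m a b c d → m * (a * b - c * d) ≡ a * (m * b) + - c * (m * d)
    lemma = solve-∀
    commute : ∀ a b → a * b - b * a ≡ 0ℤ
    commute = solve-∀
    vanish : ∀ a c → a * 0ℤ + - c * 0ℤ ≡ 0ℤ
    vanish = solve-∀
    rows : ∀ i → ∑ (λ k → (M [ u ]≔ δ u) i k * x k) ≡ 0ℤ
    rows zero = trans (∑-δˡ u x) (commute (C u u) (C u v))
    rows (suc i) = begin
      ∑ (λ k → M (suc i) k * x k)
        ≡⟨ ∑-cong (λ k → lemma (M (suc i) k) (C u u) (C k v) (C u v) (C k u)) ⟩
      ∑ (λ k → C u u * (M (suc i) k * C k v) + - C u v * (M (suc i) k * C k u))
        ≡⟨ ∑-linear (- C u v) (λ k → C u u * (M (suc i) k * C k v)) (λ k → M (suc i) k * C k u) ⟩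
      ∑ (λ k → C u u * (M (suc i) k * C k v)) + - C u v * ∑ (λ k → M (suc i) k * C k u)
        ≡⟨ cong₂ (λ a b → a + - C u v * b)
             (trans (sym (*-distribˡ-sum (C u u) (λ k → M (suc i) k * C k v))) (cong (C u u *_) (MC≡0 (suc i) v)))
             (MC≡0 (suc i) u) ⟩
      C u u * 0ℤ + - C u v * 0ℤ
        ≡⟨ vanish (C u u) (C u v) ⟩
      0ℤ ∎
  square : ∀ i → i * i ≡ + (∣ i ∣ ℕ.* ∣ i ∣)
  square (+ n) = sym (ℤ.pos-* n n)
  square -[1+ n ] = refl
  -- Hence `C u u * trace C` is a sum of squares among which the square of `C u u` is positive; a
  -- zero trace would force it to vanish.
  total : + (∣ C u u ∣ ℕ.* ∣ C u u ∣ ℕ.+ k) ≡ + 0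
  total = begin
    + (∣ C u u ∣ ℕ.* ∣ C u u ∣) + + k         ≡⟨ sym (cong₂ _+_ (square (C u u)) e) ⟩
    ∑ (λ v → C u v * C u v)                   ≡⟨ ∑-cong (λ v → sym (rankOne v)) ⟩
    ∑ (λ v → C u u * C v v)                   ≡⟨ sym (*-distribˡ-sum (C u u) (λ v → C v v)) ⟩
    C u u * trace C                           ≡⟨ trans (cong (C u u *_) trace≡0) (ℤ.*-zeroʳ (C u u)) ⟩
    + 0 ∎
  nonzero : ∣ C u u ∣ ℕ.* ∣ C u u ∣ ≢ 0
  nonzero e with ℕ.m*n≡0⇒m≡0∨n≡0 ∣ C u u ∣ e
  ... | inj₁ p = C≢0 (ℤ.∣i∣≡0⇒i≡0 p)
  ... | inj₂ p = C≢0 (ℤ.∣i∣≡0⇒i≡0 p)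

-- Connectedness enters through vectors y w on the edges, supported on a walk from w to the base vertex u: with alternating
-- signs along the walk, the incidence matrix N satisfies N (y w) = δ w - s w * δ u.
bordered : ∀ {n e} → (Fin n → ℤ) → (Fin n → Fin e → ℤ) → Fin n → Fin (suc e) → ℤ
bordered a N i zero = a i
bordered a N i (suc k) = N i k

-- A border adds a rank-one term to the Gram matrix. For a tree the bordered matrix is square: a
-- zero border shows that the Gram matrix is singular, a unit border isolates one principal minor.
bordered-ᵀ : ∀ {n e} (a : Fin n → ℤ) (N : Fin n → Fin e → ℤ) i j →
  (bordered a N ⊡ (bordered a N ᵀ)) i j ≡ (N ⊡ (N ᵀ)) i j + 1ℤ * (a i * a j)
bordered-ᵀ a N i j = trans (ℤ.+-comm (a i * a j) ((N ⊡ (N ᵀ)) i j))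
  (cong (_+_ ((N ⊡ (N ᵀ)) i j)) (sym (ℤ.*-identityˡ (a i * a j))))

module _ {n e : ℕ} (N : Fin n → Fin e → ℤ) (u : Fin n) (y : Fin n → Fin e → ℤ) (s : Fin n → ℤ)
         (walk : ∀ w i → ∑ (λ k → N i k * y w k) ≡ δ w i - s w * δ u i) where

  walkMatrix : Fin (suc e) → Fin n → ℤ
  walkMatrix zero w = s w
  walkMatrix (suc k) w = y w k

  bordered-inverse : ∀ i w → (bordered (δ u) N ⊡ walkMatrix) i w ≡ δ i w
  bordered-inverse i w = trans (cong (_+_ (δ u i * s w)) (walk w i)) (trans (lemma (δ u i) (s w) (δ w i)) (δ-sym w i))
    where
    lemma : ∀ a b c → a * b + (c - b * a) ≡ c
    lemma = solve-∀

  -- The walks furnish a right inverse of the incidence matrix bordered by one column, so it cannot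
  -- have more rows than columns.
  vertices≤1+edges : n ≤ suc e
  vertices≤1+edges = ⊡-δ⇒≤ (bordered (δ u) N) walkMatrix bordered-inverse

module _ {n : ℕ} (N : Fin (suc n) → Fin n → ℤ) where
  tree-singular : detℤ (N ⊡ (N ᵀ)) ≡ 0ℤ
  tree-singular = begin
    detℤ (N ⊡ (N ᵀ))
      ≡⟨ detℤ-cong (λ i j → trans (sym (ℤ.+-identityʳ ((N ⊡ (N ᵀ)) i j))) (sym (bordered-ᵀ (λ _ → 0ℤ) N i j))) ⟩
    detℤ (A ⊡ (A ᵀ))
      ≡⟨ detℤ-⊡ A (A ᵀ) ⟩
    detℤ A * detℤ (A ᵀ)
      ≡⟨ cong (_* detℤ (A ᵀ)) (detℤ-zeroColumn A zero (λ _ → refl)) ⟩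
    0ℤ * detℤ (A ᵀ)
      ≡⟨ ℤ.*-zeroˡ (detℤ (A ᵀ)) ⟩
    0ℤ ∎
    where
    open ≡-Reasoning
    A : Mat (suc n)
    A = bordered (λ _ → 0ℤ) N

  -- Since the Gram matrix is singular, adding 1 at the diagonal entry `u` makes its determinant the
  -- principal minor at `u`. By the border this is also `detℤ A * detℤ A`, and `A` is invertible
  -- over the integers because of the walks.
  tree-adjugate : ∀ u (y : Fin (suc n) → Fin n → ℤ) (s : Fin (suc n) → ℤ) → (∀ w i → ∑ (λ k → N i k * y w k) ≡ δ w i - s w * δ u i) →
    adjugate (N ⊡ (N ᵀ)) u u ≡ 1ℤ
  tree-adjugate u y s walk = begin
    adjugate (N ⊡ (N ᵀ)) u u
      ≡⟨ lemma (adjugate (N ⊡ (N ᵀ)) u u) ⟩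
    0ℤ + 1ℤ * adjugate (N ⊡ (N ᵀ)) u u
      ≡⟨ cong (_+ 1ℤ * adjugate (N ⊡ (N ᵀ)) u u) (sym tree-singular) ⟩
    detℤ (N ⊡ (N ᵀ)) + 1ℤ * adjugate (N ⊡ (N ᵀ)) u u
      ≡⟨ sym (detℤ-rankOne (N ⊡ (N ᵀ)) u 1ℤ) ⟩
    detℤ (λ i j → (N ⊡ (N ᵀ)) i j + 1ℤ * (δ u i * δ u j))
      ≡⟨ detℤ-cong (λ i j → sym (bordered-ᵀ (δ u) N i j)) ⟩
    detℤ (A ⊡ (A ᵀ))
      ≡⟨ trans (detℤ-⊡ A (A ᵀ)) (cong (detℤ A *_) (detℤ-ᵀ A)) ⟩
    detℤ A * detℤ A
      ≡⟨ i*j≡1⇒i*i≡1 (detℤ A) (detℤ Y) (trans (sym (detℤ-⊡ A Y)) (trans (detℤ-cong (bordered-inverse N u y s walk)) (detℤ-δ (suc n)))) ⟩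
    1ℤ ∎
    where
    open ≡-Reasoning
    lemma : ∀ x → x ≡ 0ℤ + 1ℤ * x
    lemma = solve-∀
    A Y : Mat (suc n)
    A = bordered (δ u) N
    Y = walkMatrix N u y s walk

-- Only the residue of `girth` modulo 4 matters. In the construction below it is the sum of squares
-- of a closed odd walk from a base vertex: the length of the cycle plus 4 for each edge on the path
-- leading to it.
record OddUnicyclicMatrix {n} (M : Mat n) : Set where
  field
    det≡4 : detℤ M ≡ + 4
    girth : ℤ
    girth-odd : Odd girth
    trace≈ : trace (adjugate M) ≈ + n * girth [mod + 4 ]
    diagonal-odd : ∀ u → Odd (adjugate M u u)

-- The solutions z w of N (z w) = 2 δ w are all congruent modulo 2, and the adjugate of N Nᵀ is their Gram matrix.
module _ {n : ℕ} (N : Mat (suc n)) (y : Fin (suc n) → Fin (suc n) → ℤ) (s : Fin (suc n) → ℤ)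
         (walk : ∀ w i → ∑ (λ k → N i k * y w k) ≡ δ w i - s w * δ zero i)
         (s²≡1 : ∀ w → s w * s w ≡ 1ℤ)
         (columnSum : ∀ k → ∑ (λ i → N i k) ≡ + 2)
         (c : Fin (suc n) → ℤ) (oddWalk : ∀ i → ∑ (λ k → N i k * c k) ≡ + 2 * δ zero i) where

  private
    open ≡-Reasoning

    L : Mat (suc n)
    L = N ⊡ (N ᵀ)

    -- With the closed odd walk `c` as column zero, `N Y = T` has determinant 2, so `detℤ N` divides
    -- 2. It is even because the columns of `N` sum to 2. Hence it is 2 or - 2.
    Y T : Mat (suc n)
    Y k zero = c k
    Y k (suc w) = y (suc w) k
    T i zero = + 2 * δ zero i
    T i (suc w) = δ (suc w) i - s (suc w) * δ zero i

    NY≡T : ∀ i w → (N ⊡ Y) i w ≡ T i w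
    NY≡T i zero = oddWalk i
    NY≡T i (suc w) = walk (suc w) i

    detT≡2 : detℤ T ≡ + 2
    detT≡2 = begin
      detℤ T                          ≡⟨ sym (detℤ-ᵀ T) ⟩
      detℤ (T ᵀ)                      ≡⟨ detℤ-firstRow (T ᵀ) (+ 2) (λ j → refl) ⟩
      + 2 * detℤ (minor (T ᵀ) zero)   ≡⟨ cong (+ 2 *_) (trans (detℤ-cong {M = minor (T ᵀ) zero} {δ} rest) (detℤ-δ n)) ⟩
      + 2                             ∎
      where
      rest : ∀ w i → δ (suc w) (suc i) - s (suc w) * 0ℤ ≡ δ w i
      rest w i = trans (cong₂ (λ a b → a - b) (δ-injective suc Fin.suc-injective w i) (ℤ.*-zeroʳ (s (suc w))))
        (ℤ.+-identityʳ (δ w i))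

    half : ℤ
    half = ∑ (λ k → adjugate N k zero)

    detN≡2*half : detℤ N ≡ + 2 * half
    detN≡2*half = begin
      detℤ N
        ≡⟨ sym (trans (∑-cong {suc n} (λ i → cong (_* detℤ N) (δ-sym {suc n} i zero))) (∑-δˡ {suc n} zero (λ _ → detℤ N))) ⟩
      ∑ {suc n} (λ i → δ i zero * detℤ N)
        ≡⟨ ∑-cong (λ i → sym (⊡-adjugate N i zero)) ⟩
      ∑ (λ i → ∑ (λ k → N i k * adjugate N k zero))
        ≡⟨ ∑-comm (λ i k → N i k * adjugate N k zero) ⟩
      ∑ (λ k → ∑ (λ i → N i k * adjugate N k zero))
        ≡⟨ ∑-cong (λ k → trans (sym (*-distribʳ-sum (adjugate N k zero) (λ i → N i k)))
             (cong (_* adjugate N k zero) (columnSum k))) ⟩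
      ∑ (λ k → + 2 * adjugate N k zero)
        ≡⟨ sym (*-distribˡ-sum (+ 2) (λ k → adjugate N k zero)) ⟩
      + 2 * half ∎

    half²≡1 : half * half ≡ 1ℤ
    half²≡1 = i*j≡1⇒i*i≡1 half (detℤ Y) (ℤ.*-cancelˡ-≡ (+ 2) (half * detℤ Y) 1ℤ (begin
      + 2 * (half * detℤ Y)   ≡⟨ sym (ℤ.*-assoc (+ 2) half (detℤ Y)) ⟩
      (+ 2 * half) * detℤ Y   ≡⟨ cong (_* detℤ Y) (sym detN≡2*half) ⟩
      detℤ N * detℤ Y         ≡⟨ trans (sym (detℤ-⊡ N Y)) (trans (detℤ-cong NY≡T) detT≡2) ⟩
      + 2 * 1ℤ                ∎))

    detL≡4 : detℤ L ≡ + 4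
    detL≡4 = begin
      detℤ L                            ≡⟨ trans (detℤ-⊡ N (N ᵀ)) (cong (detℤ N *_) (detℤ-ᵀ N)) ⟩
      detℤ N * detℤ N                   ≡⟨ cong₂ _*_ detN≡2*half detN≡2*half ⟩
      (+ 2 * half) * (+ 2 * half)       ≡⟨ lemma half ⟩
      + 4 * (half * half)               ≡⟨ cong (+ 4 *_) half²≡1 ⟩
      + 4                               ∎
      where
      lemma : ∀ h → (+ 2 * h) * (+ 2 * h) ≡ + 4 * (h * h)
      lemma = solve-∀

    detN≢0 : detℤ N ≢ 0ℤ
    detN≢0 h = contradiction (trans (sym detL≡4)
      (trans (detℤ-⊡ N (N ᵀ)) (trans (cong (_* detℤ (N ᵀ)) h) (ℤ.*-zeroˡ (detℤ (N ᵀ)))))) λ ()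

    -- Twice the walk from `w` leaves an unwanted multiple of the base vector; `s w` copies of the
    -- closed odd walk cancel it.
    Z : Mat (suc n)
    Z k w = + 2 * y w k + s w * c k

    NZ≡2 : ∀ i w → (N ⊡ Z) i w ≡ + 2 * δ i w
    NZ≡2 i w = begin
      ∑ (λ k → N i k * (+ 2 * y w k + s w * c k))
        ≡⟨ ∑-cong (λ k → lemma (N i k) (y w k) (s w) (c k)) ⟩
      ∑ (λ k → + 2 * (N i k * y w k) + s w * (N i k * c k))
        ≡⟨ ∑-linear (s w) (λ k → + 2 * (N i k * y w k)) (λ k → N i k * c k) ⟩
      ∑ (λ k → + 2 * (N i k * y w k)) + s w * ∑ (λ k → N i k * c k)
        ≡⟨ cong₂ (λ a b → a + s w * b) (sym (*-distribˡ-sum (+ 2) (λ k → N i k * y w k))) (oddWalk i) ⟩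
      + 2 * ∑ (λ k → N i k * y w k) + s w * (+ 2 * δ zero i)
        ≡⟨ cong (λ a → + 2 * a + s w * (+ 2 * δ zero i)) (walk w i) ⟩
      + 2 * (δ w i - s w * δ zero i) + s w * (+ 2 * δ zero i)
        ≡⟨ lemma′ (δ w i) (s w) (δ zero i) ⟩
      + 2 * δ w i
        ≡⟨ cong (+ 2 *_) (δ-sym w i) ⟩
      + 2 * δ i w ∎
      where
      lemma : ∀ m a t b → m * (+ 2 * a + t * b) ≡ + 2 * (m * a) + t * (m * b)
      lemma = solve-∀
      lemma′ : ∀ a t b → + 2 * (a - t * b) + t * (+ 2 * b) ≡ + 2 * a
      lemma′ = solve-∀

    ∑-2δʳ : ∀ (f : Fin (suc n) → ℤ) j → ∑ (λ i → f i * (+ 2 * δ i j)) ≡ + 2 * f j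
    ∑-2δʳ f j = trans (∑-cong (λ i → lemma (f i) (δ i j)))
      (trans (sym (*-distribˡ-sum (+ 2) (λ i → f i * δ i j))) (cong (+ 2 *_) (∑-δʳ f j)))
      where
      lemma : ∀ a d → a * (+ 2 * d) ≡ + 2 * (a * d)
      lemma = solve-∀

    ∑-2δˡ : ∀ i (f : Fin (suc n) → ℤ) → ∑ (λ j → (+ 2 * δ i j) * f j) ≡ + 2 * f i
    ∑-2δˡ i f = trans (∑-cong (λ j → trans (ℤ.*-comm (+ 2 * δ i j) (f j)) (cong (λ d → f j * (+ 2 * d)) (δ-sym i j)))) (∑-2δʳ f i)

    ZN≡2 : ∀ l k → (Z ⊡ N) l k ≡ + 2 * δ l k
    ZN≡2 l k = ℤ.i-j≡0⇒i≡j _ _ (⊡-kernel N (λ l → (Z ⊡ N) l k - + 2 * δ l k) detN≢0 rows l)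
      where
      lemma : ∀ a b d → a * (b - d) ≡ a * b + -1ℤ * (a * d)
      lemma = solve-∀
      cancel : ∀ a → + 2 * a + -1ℤ * (+ 2 * a) ≡ 0ℤ
      cancel = solve-∀
      rows : ∀ i → ∑ (λ l → N i l * ((Z ⊡ N) l k - + 2 * δ l k)) ≡ 0ℤ
      rows i = begin
        ∑ (λ l → N i l * ((Z ⊡ N) l k - + 2 * δ l k))
          ≡⟨ ∑-cong (λ l → lemma (N i l) ((Z ⊡ N) l k) (+ 2 * δ l k)) ⟩
        ∑ (λ l → N i l * (Z ⊡ N) l k + -1ℤ * (N i l * (+ 2 * δ l k)))
          ≡⟨ ∑-linear -1ℤ (λ l → N i l * (Z ⊡ N) l k) (λ l → N i l * (+ 2 * δ l k)) ⟩
        (N ⊡ (Z ⊡ N)) i k + -1ℤ * ∑ (λ l → N i l * (+ 2 * δ l k))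
          ≡⟨ cong₂ (λ a b → a + -1ℤ * b)
               (trans (sym (⊡-assoc N Z N i k)) (trans (⊡-congˡ N NZ≡2 i k) (∑-2δˡ i (λ j → N j k))))
               (∑-2δʳ (N i) k) ⟩
        + 2 * N i k + -1ℤ * (+ 2 * N i k)
          ≡⟨ cancel (N i k) ⟩
        0ℤ ∎

    -- `N (Nᵀ Zᵀ) Z = 2 N Z = 4`, so `gram` and the adjugate solve the same equation `L X = 4`, and
    -- `L` is nonsingular.
    gram : Mat (suc n)
    gram = (Z ᵀ) ⊡ Z

    L-gram : ∀ i w → (L ⊡ gram) i w ≡ + 4 * δ i w
    L-gram i w = begin
      (L ⊡ gram) i w
        ≡⟨ ⊡-assoc N (N ᵀ) gram i w ⟩
      (N ⊡ ((N ᵀ) ⊡ gram)) i w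
        ≡⟨ ⊡-congʳ N (λ k j → trans (sym (⊡-assoc (N ᵀ) (Z ᵀ) Z k j))
             (trans (⊡-congˡ Z NᵀZᵀ k j) (∑-2δˡ k (λ l → Z l j)))) i w ⟩
      (N ⊡ (λ k j → + 2 * Z k j)) i w
        ≡⟨ ∑-cong (λ k → lemma (N i k) (Z k w)) ⟩
      ∑ (λ k → + 2 * (N i k * Z k w))
        ≡⟨ sym (*-distribˡ-sum (+ 2) (λ k → N i k * Z k w)) ⟩
      + 2 * (N ⊡ Z) i w
        ≡⟨ trans (cong (+ 2 *_) (NZ≡2 i w)) (sym (ℤ.*-assoc (+ 2) (+ 2) (δ i w))) ⟩
      + 4 * δ i w ∎
      where
      lemma : ∀ a b → a * (+ 2 * b) ≡ + 2 * (a * b)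
      lemma = solve-∀
      NᵀZᵀ : ∀ k l → ((N ᵀ) ⊡ (Z ᵀ)) k l ≡ + 2 * δ k l
      NᵀZᵀ k l = trans (∑-cong (λ j → ℤ.*-comm (N j k) (Z l j))) (trans (ZN≡2 l k) (cong (+ 2 *_) (δ-sym l k)))

    adjugate≡gram : ∀ i j → adjugate L i j ≡ gram i j
    adjugate≡gram i j = ℤ.i-j≡0⇒i≡j _ _ (⊡-kernel L (λ k → adjugate L k j - gram k j)
      (λ h → contradiction (trans (sym detL≡4) h) λ ()) rows i)
      where
      lemma : ∀ a b d → a * (b - d) ≡ a * b + -1ℤ * (a * d)
      lemma = solve-∀
      cancel : ∀ d → d * + 4 + -1ℤ * (+ 4 * d) ≡ 0ℤ
      cancel = solve-∀
      rows : ∀ i → ∑ (λ k → L i k * (adjugate L k j - gram k j)) ≡ 0ℤ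
      rows i = begin
        ∑ (λ k → L i k * (adjugate L k j - gram k j))
          ≡⟨ ∑-cong (λ k → lemma (L i k) (adjugate L k j) (gram k j)) ⟩
        ∑ (λ k → L i k * adjugate L k j + -1ℤ * (L i k * gram k j))
          ≡⟨ ∑-linear -1ℤ (λ k → L i k * adjugate L k j) (λ k → L i k * gram k j) ⟩
        (L ⊡ adjugate L) i j + -1ℤ * (L ⊡ gram) i j
          ≡⟨ cong₂ (λ a b → a + -1ℤ * b) (trans (⊡-adjugate L i j) (cong (δ i j *_) detL≡4)) (L-gram i j) ⟩
        δ i j * + 4 + -1ℤ * (+ 4 * δ i j)
          ≡⟨ cancel (δ i j) ⟩
        0ℤ ∎

    g : ℤ
    g = ∑ (λ k → c k * c k)

    -- Summing the equations `oddWalk` over all vertices counts each `c k` twice. As squares agree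
    -- with their roots modulo 2, this makes `g` odd.
    ∑c≡1 : ∑ c ≡ 1ℤ
    ∑c≡1 = ℤ.*-cancelˡ-≡ (+ 2) (∑ c) 1ℤ (begin
      + 2 * ∑ c                           ≡⟨ *-distribˡ-sum (+ 2) c ⟩
      ∑ (λ k → + 2 * c k)                 ≡⟨ ∑-cong (λ k → trans (cong (_* c k) (sym (columnSum k))) (*-distribʳ-sum (c k) (λ i → N i k))) ⟩
      ∑ (λ k → ∑ (λ i → N i k * c k))     ≡⟨ ∑-comm (λ k i → N i k * c k) ⟩
      ∑ (λ i → ∑ (λ k → N i k * c k))     ≡⟨ ∑-cong oddWalk ⟩
      ∑ (λ i → + 2 * δ {suc n} zero i)    ≡⟨ sym (*-distribˡ-sum (+ 2) (δ {suc n} zero)) ⟩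
      + 2 * ∑ (δ {suc n} zero)            ≡⟨ cong (+ 2 *_) (trans (∑-cong (λ i → sym (ℤ.*-identityʳ (δ {suc n} zero i)))) (∑-δˡ {suc n} zero (λ _ → 1ℤ))) ⟩
      + 2 * 1ℤ                            ∎)

    g-odd : Odd g
    g-odd = ≈-trans (≈-∑ {f = λ k → c k * c k} {g = c} (λ k → square-≈ (c k))) (≡⇒≈ ∑c≡1)

    -- An entry of `Z` has the form `2 y + s c` with `s` a sign, so its square is that of `c` modulo
    -- 4, whatever the vertex `u`.
    gram-diagonal : ∀ u → gram u u ≈ g [mod + 4 ]
    gram-diagonal u = ≈-∑ {f = λ k → Z k u * Z k u} {g = λ k → c k * c k} λ k →
      (y u k * y u k + s u * (y u k * c k)) by trans
        (lemma (y u k) (s u) (c k))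
        (cong (_+ + 4 * (y u k * y u k + s u * (y u k * c k)))
          (trans (cong (_* (c k * c k)) (s²≡1 u)) (ℤ.*-identityˡ (c k * c k))))
      where
      lemma : ∀ a t b → (+ 2 * a + t * b) * (+ 2 * a + t * b) ≡ (t * t) * (b * b) + + 4 * (a * a + t * (a * b))
      lemma = solve-∀

  oddUnicyclicMatrix : OddUnicyclicMatrix (N ⊡ (N ᵀ))
  oddUnicyclicMatrix = record
    { det≡4 = detL≡4
    ; girth = g
    ; girth-odd = g-odd
    ; trace≈ = ≈-trans (≈-∑ {f = λ u → adjugate L u u} {g = λ _ → g} (λ u → ≈-trans (≡⇒≈ (adjugate≡gram u u)) (gram-diagonal u))) (≡⇒≈ (∑-const (suc n)))
    ; diagonal-odd = λ u → ≈-trans (≡⇒≈ (adjugate≡gram u u)) (≈-trans (mod2 (gram-diagonal u)) g-odd)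
    }
    where
    ∑-const : ∀ m → ∑ {m} (λ _ → g) ≡ + m * g
    ∑-const zero = sym (ℤ.*-zeroˡ g)
    ∑-const (suc m) = trans (cong (_+_ g) (∑-const m)) (lemma (+ m) g)
      where
      lemma : ∀ m g → g + m * g ≡ (1ℤ + m) * g
      lemma = solve-∀
    mod2 : ∀ {a b} → a ≈ b [mod + 4 ] → a ≈ b [mod + 2 ]
    mod2 {b = b} (k by refl) = (+ 2 * k) by cong (_+_ b) (ℤ.*-assoc (+ 2) (+ 2) k)

-- Polynomials

-- The signs of det come from a function local to its definition, which can only be reached by unification:
-- they are determined by the first two values and the period.
module _ {n : ℕ} (M : Fin (suc n) → Fin (suc n) → Poly) where
  laplaceTerm : Fin (suc n) → Poly
  laplaceTerm j = scale (sgn (toℕ j)) (M zero j ⊗ det (λ i k → M (suc i) (punchIn j k)))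

  private
    scale-periodic : ∀ p (G : ℕ → Poly) → G 0 ≡ scale 1ℤ p → G 1 ≡ scale -1ℤ p → (∀ k → G (suc (suc k)) ≡ G k) →
      ∀ k → G k ≡ scale (sgn k) p
    scale-periodic p G h₀ h₁ h zero = h₀
    scale-periodic p G h₀ h₁ h (suc zero) = h₁
    scale-periodic p G h₀ h₁ h (suc (suc k)) = trans (h k)
      (trans (scale-periodic p G h₀ h₁ h k) (cong (λ c → scale c p) (sym (ℤ.neg-involutive (sgn k)))))

    foldr-cong : ∀ (F₀ : Poly) (F G : Fin (suc n) → Poly) → F₀ ≡ G zero → (∀ j → F j ≡ G j) →
      F₀ ⊕ foldr _⊕_ [] (map F (tabulate suc)) ≡ foldr _⊕_ [] (map G (allFin (suc n)))
    foldr-cong F₀ F G h₀ h = cong₂ (λ p ps → p ⊕ foldr _⊕_ [] ps) h₀ (List.map-cong h (tabulate suc))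

  mutual
    det-laplace : det M ≡ foldr _⊕_ [] (map laplaceTerm (allFin (suc n)))
    det-laplace = foldr-cong (laplaceTerm zero) _ laplaceTerm refl signed

    signed : (j : Fin (suc n)) → _ ≡ laplaceTerm j
    signed j with toℕ j
    ... | k = signed-at j k

    signed-at : (j : Fin (suc n)) (k : ℕ) → _ ≡ scale (sgn k) (M zero j ⊗ det (λ i k → M (suc i) (punchIn j k)))
    signed-at j = scale-periodic (M zero j ⊗ det (λ i k → M (suc i) (punchIn j k))) _ refl refl (λ _ → refl)

eval : Poly → ℤ → ℤ
eval [] t = 0ℤ
eval (a ∷ p) t = a + t * eval p t

eval-⊕ : ∀ p q t → eval (p ⊕ q) t ≡ eval p t + eval q t
eval-⊕ [] q t = sym (ℤ.+-identityˡ (eval q t))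
eval-⊕ (a ∷ p) [] t = sym (ℤ.+-identityʳ (eval (a ∷ p) t))
eval-⊕ (a ∷ p) (b ∷ q) t = trans (cong (λ x → (a + b) + t * x) (eval-⊕ p q t)) (lemma a b t (eval p t) (eval q t))
  where
  lemma : ∀ a b t x y → (a + b) + t * (x + y) ≡ (a + t * x) + (b + t * y)
  lemma = solve-∀

eval-scale : ∀ c p t → eval (scale c p) t ≡ c * eval p t
eval-scale c [] t = sym (ℤ.*-zeroʳ c)
eval-scale c (a ∷ p) t = trans (cong (λ x → c * a + t * x) (eval-scale c p t)) (lemma c a t (eval p t))
  where
  lemma : ∀ c a t x → c * a + t * (c * x) ≡ c * (a + t * x)
  lemma = solve-∀

eval-⊗ : ∀ p q t → eval (p ⊗ q) t ≡ eval p t * eval q t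
eval-⊗ [] q t = sym (ℤ.*-zeroˡ (eval q t))
eval-⊗ (a ∷ p) q t = trans (eval-⊕ (scale a q) (0ℤ ∷ (p ⊗ q)) t)
  (trans (cong₂ (λ x y → x + (0ℤ + t * y)) (eval-scale a q t) (eval-⊗ p q t)) (lemma a t (eval p t) (eval q t)))
  where
  lemma : ∀ a t x y → a * y + (0ℤ + t * (x * y)) ≡ (a + t * x) * y
  lemma = solve-∀

eval-det : ∀ {n} (M : Fin n → Fin n → Poly) t → eval (det M) t ≡ detℤ (λ i j → eval (M i j) t)
eval-det {zero} M t = trans (cong (_+_ 1ℤ) (ℤ.*-zeroʳ t)) (sym (detℤ-zero _))
eval-det {suc n} M t = begin
  eval (det M) t
    ≡⟨ cong (λ p → eval p t) (det-laplace M) ⟩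
  eval (foldr _⊕_ [] (map (laplaceTerm M) (allFin (suc n)))) t
    ≡⟨ cong (λ ps → eval (foldr _⊕_ [] ps) t) (List.map-tabulate id (laplaceTerm M)) ⟩
  eval (foldr _⊕_ [] (tabulate (laplaceTerm M))) t
    ≡⟨ eval-foldr (laplaceTerm M) ⟩
  ∑ (λ j → eval (laplaceTerm M j) t)
    ≡⟨ ∑-cong (λ j → trans (eval-scale (sgn (toℕ j)) (M zero j ⊗ det (M′ j)) t) (cong (sgn (toℕ j) *_)
         (trans (eval-⊗ (M zero j) (det (M′ j)) t) (cong (eval (M zero j) t *_) (eval-det (M′ j) t))))) ⟩
  ∑ (λ j → sgn (toℕ j) * (eval (M zero j) t * detℤ (λ i k → eval (M′ j i k) t)))
    ≡⟨ sym (detℤ-suc (λ i j → eval (M i j) t)) ⟩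
  detℤ (λ i j → eval (M i j) t) ∎
  where
  open ≡-Reasoning
  M′ : Fin (suc n) → Fin n → Fin n → Poly
  M′ j i k = M (suc i) (punchIn j k)
  eval-foldr : ∀ {m} (F : Fin m → Poly) → eval (foldr _⊕_ [] (tabulate F)) t ≡ ∑ (λ j → eval (F j) t)
  eval-foldr {zero} F = refl
  eval-foldr {suc m} F = trans (eval-⊕ (F zero) (foldr _⊕_ [] (tabulate (F ∘ suc))) t)
    (cong (_+_ (eval (F zero) t)) (eval-foldr (F ∘ suc)))

eval-cong : ∀ p q → (∀ k → coeff p k ≡ coeff q k) → ∀ t → eval p t ≡ eval q t
eval-cong [] [] h t = refl
eval-cong [] (b ∷ q) h t = trans (sym (trans (ℤ.+-identityˡ _) (ℤ.*-zeroʳ t)))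
  (cong₂ (λ x y → x + t * y) (h 0) (eval-cong [] q (h ∘ suc) t))
eval-cong (a ∷ p) [] h t = trans (cong₂ (λ x y → x + t * y) (h 0) (eval-cong p [] (h ∘ suc) t))
  (trans (ℤ.+-identityˡ _) (ℤ.*-zeroʳ t))
eval-cong (a ∷ p) (b ∷ q) h t = cong₂ (λ x y → x + t * y) (h 0) (eval-cong p q (h ∘ suc) t)

divide : ∀ p c → ∃ λ q → ∀ t → eval p t ≡ eval p c + (t - c) * eval q t
divide [] c = [] , λ t → sym (trans (ℤ.+-identityˡ _) (ℤ.*-zeroʳ (t - c)))
divide (a ∷ p) c with divide p c
... | q , h = p ⊕ scale c q , λ t → begin
  a + t * eval p t
    ≡⟨ lemma₁ a t c (eval p t) ⟩
  a + (t - c) * eval p t + c * eval p t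
    ≡⟨ cong (λ x → a + (t - c) * eval p t + c * x) (h t) ⟩
  a + (t - c) * eval p t + c * (eval p c + (t - c) * eval q t)
    ≡⟨ lemma₂ a t c (eval p t) (eval p c) (eval q t) ⟩
  (a + c * eval p c) + (t - c) * (eval p t + c * eval q t)
    ≡⟨ cong (λ x → (a + c * eval p c) + (t - c) * x) (sym (trans (eval-⊕ p (scale c q) t)
         (cong (_+_ (eval p t)) (eval-scale c q t)))) ⟩
  (a + c * eval p c) + (t - c) * eval (p ⊕ scale c q) t ∎
  where
  open ≡-Reasoning
  lemma₁ : ∀ a t c x → a + t * x ≡ a + (t - c) * x + c * x
  lemma₁ = solve-∀
  lemma₂ : ∀ a t c x y z → a + (t - c) * x + c * (y + (t - c) * z) ≡ (a + c * y) + (t - c) * (x + c * z)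
  lemma₂ = solve-∀

eval-≈ : ∀ p c t → eval p t ≈ eval p c [mod t - c ]
eval-≈ p c t = eval (proj₁ (divide p c)) t by proj₂ (divide p c) t

-- The modulus `suc ∣ a - b ∣` is too large to divide a nonzero `a - b`. This takes the place of
-- passing to a limit when a factor is cancelled at its own root.
≈-all⇒≡ : ∀ {a b} → (∀ n → a ≈ b [mod + suc n ]) → a ≡ b
≈-all⇒≡ {a} {b} h with h ∣ a - b ∣
... | k by e = ℤ.i-j≡0⇒i≡j a b (ℤ.∣i∣≡0⇒i≡0 (small ∣ k ∣ (begin
  ∣ a - b ∣                         ≡⟨ cong ∣_∣ (trans (cong (_- b) e) (lemma b (+ suc ∣ a - b ∣ * k))) ⟩
  ∣ + suc ∣ a - b ∣ * k ∣           ≡⟨ ℤ.abs-* (+ suc ∣ a - b ∣) k ⟩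
  suc ∣ a - b ∣ ℕ.* ∣ k ∣           ∎)))
  where
  open ≡-Reasoning
  lemma : ∀ b x → (b + x) - b ≡ x
  lemma = solve-∀
  small : ∀ {m} k → m ≡ suc m ℕ.* k → m ≡ 0
  small {m} zero e = trans e (ℕ.*-zeroʳ (suc m))
  small {m} (suc k) e = contradiction (ℕ.≤-trans (ℕ.m≤m*n (suc m) (suc k)) (ℕ.≤-reflexive (sym e))) (ℕ.<-irrefl refl)

*-cancelˡ : ∀ i j k → i ≢ 0ℤ → i * j ≡ i * k → j ≡ k
*-cancelˡ i j k i≢0 h with ℤ.i*j≡0⇒i≡0∨j≡0 i {j - k} (trans (lemma i j k)
  (trans (cong (_- i * k) h) (ℤ.+-inverseʳ (i * k))))
  where
  lemma : ∀ a x y → a * (x - y) ≡ a * x - a * y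
  lemma = solve-∀
... | inj₁ i≡0 = contradiction i≡0 i≢0
... | inj₂ diff≡0 = ℤ.i-j≡0⇒i≡j j k diff≡0

-- At t = c the values agree because p c ≈ p (c + s) ≡ q (c + s) ≈ q c modulo every s > 0.
eval-cancel : ∀ c p q → (∀ t → (t - c) * eval p t ≡ (t - c) * eval q t) → ∀ t → eval p t ≡ eval q t
eval-cancel c p q h t with t ℤ.≟ c
... | no t≢c = *-cancelˡ (t - c) (eval p t) (eval q t) (t≢c ∘ ℤ.i-j≡0⇒i≡j t c) (h t)
... | yes refl = ≈-all⇒≡ λ n → ≈-trans (≈-sym (near p n)) (≈-trans (≡⇒≈ (away n)) (near q n))
  where
  shift : ∀ t s → (t + s) - t ≡ s
  shift = solve-∀
  near : ∀ p n → eval p (t + + suc n) ≈ eval p t [mod + suc n ]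
  near p n = subst (eval p (t + + suc n) ≈ eval p t [mod_]) (shift t (+ suc n)) (eval-≈ p t (t + + suc n))
  away : ∀ n → eval p (t + + suc n) ≡ eval q (t + + suc n)
  away n = *-cancelˡ (+ suc n) (eval p s) (eval q s) (λ ())
    (subst (λ d → d * eval p s ≡ d * eval q s) (shift t (+ suc n)) (h s))
    where
    s : ℤ
    s = t + + suc n

-- The value at 0 gives the constant coefficient; after subtracting it, a factor `t` is cancelled
-- from both sides. The point `t = 0` of that cancellation is supplied by `eval-cancel`.
coeff-cong : ∀ p q → (∀ t → eval p t ≡ eval q t) → ∀ k → coeff p k ≡ coeff q k
coeff-cong p q h k = go k p q h
  where
  constant : ∀ a p → eval (a ∷ p) 0ℤ ≡ a
  constant a p = trans (cong (_+_ a) (ℤ.*-zeroˡ (eval p 0ℤ))) (ℤ.+-identityʳ a)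
  peel : ∀ a p b q → (∀ t → eval (a ∷ p) t ≡ eval (b ∷ q) t) → a ≡ b × (∀ t → eval p t ≡ eval q t)
  peel a p b q h = a≡b , eval-cancel 0ℤ p q (λ t → trans (cong (_* eval p t) (ℤ.+-identityʳ t))
    (trans (+-cancelˡ a (t * eval p t) (t * eval q t) (trans (h t) (cong (_+ t * eval q t) (sym a≡b))))
      (cong (_* eval q t) (sym (ℤ.+-identityʳ t)))))
    where
    a≡b : a ≡ b
    a≡b = trans (sym (constant a p)) (trans (h 0ℤ) (constant b q))
  zero∷ : ∀ t → eval [] t ≡ eval (0ℤ ∷ []) t
  zero∷ t = sym (trans (ℤ.+-identityˡ (t * 0ℤ)) (ℤ.*-zeroʳ t))
  go : ∀ k p q → (∀ t → eval p t ≡ eval q t) → coeff p k ≡ coeff q k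
  go k [] [] h = refl
  go zero [] (b ∷ q) h = proj₁ (peel 0ℤ [] b q (λ t → trans (sym (zero∷ t)) (h t)))
  go (suc k) [] (b ∷ q) h = go k [] q (proj₂ (peel 0ℤ [] b q (λ t → trans (sym (zero∷ t)) (h t))))
  go zero (a ∷ p) [] h = proj₁ (peel a p 0ℤ [] (λ t → trans (h t) (zero∷ t)))
  go (suc k) (a ∷ p) [] h = go k p [] (proj₂ (peel a p 0ℤ [] (λ t → trans (h t) (zero∷ t))))
  go zero (a ∷ p) (b ∷ q) h = proj₁ (peel a p b q h)
  go (suc k) (a ∷ p) (b ∷ q) h = go k p q (proj₂ (peel a p b q h))

-- Degrees

-- Stated through vanishing coefficients, because a coefficient list may end in zeros and its length
-- is no degree.
record Degree< (d : ℕ) (p : Poly) : Set where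
  constructor degree<
  field vanish : ∀ k → d ≤ k → coeff p k ≡ 0ℤ
open Degree<

coeff-⊕ : ∀ p q k → coeff (p ⊕ q) k ≡ coeff p k + coeff q k
coeff-⊕ [] q k = sym (ℤ.+-identityˡ (coeff q k))
coeff-⊕ (a ∷ p) [] k = sym (ℤ.+-identityʳ (coeff (a ∷ p) k))
coeff-⊕ (a ∷ p) (b ∷ q) zero = refl
coeff-⊕ (a ∷ p) (b ∷ q) (suc k) = coeff-⊕ p q k

coeff-scale : ∀ c p k → coeff (scale c p) k ≡ c * coeff p k
coeff-scale c [] k = sym (ℤ.*-zeroʳ c)
coeff-scale c (a ∷ p) zero = refl
coeff-scale c (a ∷ p) (suc k) = coeff-scale c p k

coeff-∷⊗ : ∀ a p q k → coeff ((a ∷ p) ⊗ q) k ≡ a * coeff q k + coeff (0ℤ ∷ (p ⊗ q)) k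
coeff-∷⊗ a p q k = trans (coeff-⊕ (scale a q) (0ℤ ∷ (p ⊗ q)) k) (cong (_+ coeff (0ℤ ∷ (p ⊗ q)) k) (coeff-scale a q k))

degree<-∷ : ∀ {d a p} → Degree< (suc d) (a ∷ p) → Degree< d p
degree<-∷ deg = degree< λ k d≤k → vanish deg (suc k) (s≤s d≤k)

degree<0-⊗ : ∀ p q → Degree< 0 p → Degree< 0 (p ⊗ q)
degree<0-⊗ [] q deg = degree< λ _ _ → refl
degree<0-⊗ (a ∷ p) q deg = degree< λ k _ → trans (coeff-∷⊗ a p q k)
  (cong₂ _+_ (trans (cong (_* coeff q k) (vanish deg 0 z≤n)) (ℤ.*-zeroˡ (coeff q k))) (shifted k))
  where
  shifted : ∀ k → coeff (0ℤ ∷ (p ⊗ q)) k ≡ 0ℤ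
  shifted zero = refl
  shifted (suc k) = vanish (degree<0-⊗ p q (degree< λ l _ → vanish deg (suc l) z≤n)) k z≤n

degree<-⊗ : ∀ {a b} p q → Degree< (suc a) p → Degree< b q → Degree< (a ℕ.+ b) (p ⊗ q)
degree<-⊗ [] q _ _ = degree< λ _ _ → refl
degree<-⊗ {a} {b} (x ∷ p) q dp dq = degree< λ k a+b≤k → trans (coeff-∷⊗ x p q k)
  (cong₂ _+_ (trans (cong (x *_) (vanish dq k (ℕ.≤-trans (ℕ.m≤n+m b a) a+b≤k))) (ℤ.*-zeroʳ x)) (shifted a k dp a+b≤k))
  where
  shifted : ∀ a k → Degree< (suc a) (x ∷ p) → a ℕ.+ b ≤ k → coeff (0ℤ ∷ (p ⊗ q)) k ≡ 0ℤ
  shifted a zero _ _ = refl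
  shifted zero (suc k) dp _ = vanish (degree<0-⊗ p q (degree<-∷ dp)) k z≤n
  shifted (suc a) (suc k) dp (s≤s a+b≤k) = vanish (degree<-⊗ p q (degree<-∷ dp) dq) k a+b≤k

degree<-scale : ∀ {d} c p → Degree< d p → Degree< d (scale c p)
degree<-scale c p deg = degree< λ k d≤k → trans (coeff-scale c p k) (trans (cong (c *_) (vanish deg k d≤k)) (ℤ.*-zeroʳ c))

degree<-foldr : ∀ {d m} (F : Fin m → Poly) → (∀ j → Degree< d (F j)) → Degree< d (foldr _⊕_ [] (tabulate F))
degree<-foldr {m = zero} F h = degree< λ _ _ → refl
degree<-foldr {m = suc m} F h = degree< λ k d≤k → trans (coeff-⊕ (F zero) (foldr _⊕_ [] (tabulate (F ∘ suc))) k)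
  (cong₂ _+_ (vanish (h zero) k d≤k) (vanish (degree<-foldr (F ∘ suc) (h ∘ suc)) k d≤k))

coeff-linear⊗ : ∀ p q k → Degree< 2 p → coeff (p ⊗ q) (suc k) ≡ coeff p 0 * coeff q (suc k) + coeff p 1 * coeff q k
coeff-linear⊗ [] q k _ = sym (cong₂ _+_ (ℤ.*-zeroˡ (coeff q (suc k))) (ℤ.*-zeroˡ (coeff q k)))
coeff-linear⊗ (a ∷ []) q k _ = trans (coeff-∷⊗ a [] q (suc k)) (cong (_+_ (a * coeff q (suc k))) (sym (ℤ.*-zeroˡ (coeff q k))))
coeff-linear⊗ (a ∷ b ∷ p) q k deg = trans (coeff-∷⊗ a (b ∷ p) q (suc k)) (cong (_+_ (a * coeff q (suc k)))
  (trans (coeff-∷⊗ b p q k) (trans (cong (_+_ (b * coeff q k)) (shifted k)) (ℤ.+-identityʳ (b * coeff q k)))))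
  where
  shifted : ∀ k → coeff (0ℤ ∷ (p ⊗ q)) k ≡ 0ℤ
  shifted zero = refl
  shifted (suc k) = vanish (degree<0-⊗ p q (degree<-∷ (degree<-∷ deg))) k z≤n

total : ∀ {n} → (Fin n → ℕ) → ℕ
total {zero} d = 0
total {suc n} d = d zero ℕ.+ total (d ∘ suc)

laplaceRest : ∀ {n} (M : Fin (suc n) → Fin (suc n) → Poly) → Poly
laplaceRest M = foldr _⊕_ [] (tabulate (laplaceTerm M ∘ suc))

det-laplace′ : ∀ {n} (M : Fin (suc n) → Fin (suc n) → Poly) → det M ≡ laplaceTerm M zero ⊕ laplaceRest M
det-laplace′ M = trans (det-laplace M) (cong (λ ps → foldr _⊕_ [] ps) (List.map-tabulate id (laplaceTerm M)))

degree<-det : ∀ {n} (M : Fin n → Fin n → Poly) (d : Fin n → ℕ) → (∀ i j → Degree< (suc (d i)) (M i j)) →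
  Degree< (suc (total d)) (det M)
degree<-det {zero} M d h = degree< λ { (suc k) _ → refl }
degree<-det {suc n} M d h = subst (Degree< (suc (total d))) (sym (det-laplace′ M))
  (degree<-foldr (laplaceTerm M) λ j → degree<-scale (sgn (toℕ j)) _ (subst (λ e → Degree< e (M zero j ⊗ det (λ i k → M (suc i) (punchIn j k))))
    (ℕ.+-suc (d zero) (total (d ∘ suc)))
    (degree<-⊗ (M zero j) _ (h zero j) (degree<-det (λ i k → M (suc i) (punchIn j k)) (d ∘ suc) (λ i k → h (suc i) (punchIn j k))))))

-- The shape of `x I - Q`, isolated so that the two leading coefficients of its determinant can be
-- found by induction over principal submatrices.
record MonicLinear {n} (M : Fin n → Fin n → Poly) (a : Fin n → ℤ) : Set where
  field
    constant : ∀ i → coeff (M i i) 0 ≡ a i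
    monic : ∀ i → coeff (M i i) 1 ≡ 1ℤ
    linear : ∀ i → Degree< 2 (M i i)
    off-diagonal : ∀ {i j} → i ≢ j → Degree< 1 (M i j)

module _ {n : ℕ} (M : Fin (suc n) → Fin (suc n) → Poly) (a : Fin (suc n) → ℤ) (ml : MonicLinear M a) where
  open MonicLinear ml

  MonicLinear-minor : MonicLinear (λ i k → M (suc i) (suc k)) (a ∘ suc)
  MonicLinear-minor = record
    { constant = constant ∘ suc
    ; monic = monic ∘ suc
    ; linear = linear ∘ suc
    ; off-diagonal = λ i≢j → off-diagonal (i≢j ∘ Fin.suc-injective)
    }

  -- A column other than the first costs two diagonal entries, the one in row zero and the one in
  -- that column. These terms therefore miss the two leading coefficients, which come from the first
  -- term alone.
  degree<-laplaceRest : Degree< n (laplaceRest M)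
  degree<-laplaceRest = degree<-foldr (laplaceTerm M ∘ suc) λ j → degree<-scale (sgn (toℕ (suc j))) _
    (degree<-⊗ {a = 0} (M zero (suc j)) _ (off-diagonal (λ ()))
      (subst (λ e → Degree< e (det (λ i k → M (suc i) (punchIn (suc j) k)))) (count-others j)
        (degree<-det (λ i k → M (suc i) (punchIn (suc j) k)) (rowDegree j) (rows j))))
    where
    rowDegree : ∀ {m} → Fin m → Fin m → ℕ
    rowDegree j i = if ⌊ i ≟ j ⌋ then 0 else 1
    rowDegree-suc : ∀ {m} (j i : Fin m) → rowDegree (suc j) (suc i) ≡ rowDegree j i
    rowDegree-suc j i with i ≟ j
    ... | yes refl = refl
    ... | no _ = refl
    total-cong : ∀ {m} {d d′ : Fin m → ℕ} → (∀ i → d i ≡ d′ i) → total d ≡ total d′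
    total-cong {zero} h = refl
    total-cong {suc m} h = cong₂ ℕ._+_ (h zero) (total-cong (h ∘ suc))
    total-one : ∀ m → total {m} (λ _ → 1) ≡ m
    total-one zero = refl
    total-one (suc m) = cong suc (total-one m)
    count-others : ∀ {m} (j : Fin m) → suc (total (rowDegree j)) ≡ m
    count-others {suc m} zero = cong suc (total-one m)
    count-others {suc m} (suc j) = cong suc (trans (cong suc (total-cong (rowDegree-suc j))) (count-others j))
    weaken : ∀ p → Degree< 1 p → Degree< 2 p
    weaken p deg = degree< λ k 2≤k → vanish deg k (ℕ.≤-trans (s≤s z≤n) 2≤k)
    rows : ∀ j i k → Degree< (suc (rowDegree j i)) (M (suc i) (punchIn (suc j) k))
    rows j i k with i ≟ j
    ... | yes refl = off-diagonal (Fin.punchInᵢ≢i (suc j) k ∘ sym)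
    ... | no _ with suc i ≟ punchIn (suc j) k
    ...   | yes e = subst (λ l → Degree< 2 (M (suc i) l)) e (linear (suc i))
    ...   | no ne = weaken _ (off-diagonal ne)

  coeff-det : ∀ k → n ≤ k → coeff (det M) k ≡ coeff (M zero zero ⊗ det (λ i k → M (suc i) (suc k))) k
  coeff-det k n≤k = begin
    coeff (det M) k
      ≡⟨ cong (λ p → coeff p k) (det-laplace′ M) ⟩
    coeff (laplaceTerm M zero ⊕ laplaceRest M) k
      ≡⟨ coeff-⊕ (laplaceTerm M zero) (laplaceRest M) k ⟩
    coeff (laplaceTerm M zero) k + coeff (laplaceRest M) k
      ≡⟨ cong₂ _+_ (trans (coeff-scale 1ℤ P k) (ℤ.*-identityˡ (coeff P k))) (vanish degree<-laplaceRest k n≤k) ⟩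
    coeff (M zero zero ⊗ det (λ i k → M (suc i) (suc k))) k + 0ℤ
      ≡⟨ ℤ.+-identityʳ _ ⟩
    coeff (M zero zero ⊗ det (λ i k → M (suc i) (suc k))) k ∎
    where
    open ≡-Reasoning
    P = M zero zero ⊗ det (λ i k → M (suc i) (suc k))

  coeff-det-suc : ∀ k → n ≤ suc k → coeff (det M) (suc k) ≡
    a zero * coeff (det (λ i k → M (suc i) (suc k))) (suc k) + coeff (det (λ i k → M (suc i) (suc k))) k
  coeff-det-suc k n≤k = trans (coeff-det (suc k) n≤k) (trans (coeff-linear⊗ (M zero zero) D k (linear zero))
    (cong₂ _+_ (cong (_* coeff D (suc k)) (constant zero)) (trans (cong (_* coeff D k) (monic zero)) (ℤ.*-identityˡ (coeff D k)))))
    where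
    D = det (λ i k → M (suc i) (suc k))

det-degree : ∀ {n} (M : Fin n → Fin n → Poly) a → MonicLinear M a → ∀ k → n ℕ.< k → coeff (det M) k ≡ 0ℤ
det-degree {zero} M a ml (suc k) _ = refl
det-degree {suc n} M a ml (suc k) (s≤s n<k) = trans (coeff-det-suc M a ml k (ℕ.≤-trans (ℕ.<⇒≤ n<k) (ℕ.n≤1+n k)))
  (trans (cong₂ (λ x y → a zero * x + y) (det-degree _ _ (MonicLinear-minor M a ml) (suc k) (ℕ.m<n⇒m<1+n n<k))
    (det-degree _ _ (MonicLinear-minor M a ml) k n<k)) (trans (ℤ.+-identityʳ _) (ℤ.*-zeroʳ (a zero))))

det-monic : ∀ {n} (M : Fin n → Fin n → Poly) a → MonicLinear M a → coeff (det M) n ≡ 1ℤ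
det-monic {zero} M a ml = refl
det-monic {suc n} M a ml = trans (coeff-det-suc M a ml n (ℕ.n≤1+n n))
  (trans (cong₂ (λ x y → a zero * x + y) (det-degree _ _ (MonicLinear-minor M a ml) (suc n) ℕ.≤-refl)
    (det-monic _ _ (MonicLinear-minor M a ml))) (cong (_+ 1ℤ) (ℤ.*-zeroʳ (a zero))))

det-subleading : ∀ {n} (M : Fin (suc n) → Fin (suc n) → Poly) a → MonicLinear M a → coeff (det M) n ≡ ∑ a
det-subleading {zero} M a ml = trans (coeff-det M a ml 0 z≤n) (constantTerm (M zero zero) (MonicLinear.constant ml zero))
  where
  constantTerm : ∀ p → coeff p 0 ≡ a zero → coeff (p ⊗ (1ℤ ∷ [])) 0 ≡ a zero + 0ℤ
  constantTerm [] h = trans h (sym (ℤ.+-identityʳ (a zero)))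
  constantTerm (x ∷ p) h = trans (cong (_+ 0ℤ) (ℤ.*-identityʳ x)) (cong (_+ 0ℤ) h)
det-subleading {suc n} M a ml = trans (coeff-det-suc M a ml n ℕ.≤-refl)
  (cong₂ _+_ (trans (cong (a zero *_) (det-monic _ _ (MonicLinear-minor M a ml))) (ℤ.*-identityʳ (a zero)))
    (det-subleading _ _ (MonicLinear-minor M a ml)))

-- Signless Laplacians

indicator : Bool → ℤ
indicator b = if b then 1ℤ else 0ℤ

adjacency : ∀ {n} → Graph n → Mat n
adjacency G u v = indicator (adj G u v)

adjacency-sym : ∀ {n} (G : Graph n) u v → adjacency G u v ≡ adjacency G v u
adjacency-sym G u v = cong indicator (adj-sym G u v)

adjacency-diag : ∀ {n} (G : Graph n) u → adjacency G u u ≡ 0ℤ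
adjacency-diag G u = cong indicator (adj-irrefl G u)

count-∑ : ∀ {n} (p : Fin n → Bool) → + count p ≡ ∑ (λ i → indicator (p i))
count-∑ p = trans (cong (λ xs → + sum xs) (List.map-tabulate id (λ i → if p i then 1 else 0))) (go p)
  where
  go : ∀ {m} (p : Fin m → Bool) → + sum (tabulate (λ i → if p i then 1 else 0)) ≡ ∑ (λ i → indicator (p i))
  go {zero} p = refl
  go {suc m} p with p zero
  ... | true = cong (_+_ 1ℤ) (go (p ∘ suc))
  ... | false = cong (_+_ 0ℤ) (go (p ∘ suc))

Q-entry : ∀ {n} (G : Graph n) u v → Q G u v ≡ δ u v * ∑ (adjacency G u) + adjacency G u v
Q-entry G u v with u ≟ v
... | yes refl = trans (count-∑ (adj G u)) (sym (trans (cong₂ _+_ (ℤ.*-identityˡ (∑ (adjacency G u))) (adjacency-diag G u)) (ℤ.+-identityʳ _)))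
... | no _ = trans (entry (adj G u v)) (sym (trans (cong (_+ adjacency G u v) (ℤ.*-zeroˡ (∑ (adjacency G u)))) (ℤ.+-identityˡ _)))
  where
  entry : ∀ b → (if b then + 1 else + 0) ≡ indicator b
  entry true = refl
  entry false = refl

Q-sym : ∀ {n} (G : Graph n) u v → Q G u v ≡ Q G v u
Q-sym G u v = trans (Q-entry G u v) (trans (cong₂ _+_ diag (adjacency-sym G u v)) (sym (Q-entry G v u)))
  where
  diag : δ u v * ∑ (adjacency G u) ≡ δ v u * ∑ (adjacency G v)
  diag with u ≟ v
  ... | yes refl = cong (_* ∑ (adjacency G u)) (sym (δ-diag u))
  ... | no u≢v = trans (ℤ.*-zeroˡ (∑ (adjacency G u))) (sym (trans (cong (_* ∑ (adjacency G v)) (δ-off (u≢v ∘ sym))) (ℤ.*-zeroˡ (∑ (adjacency G v)))))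

-- Up to sign, the characteristic polynomial at - t; this way trees and unicyclic graphs have positive coefficients.
ρ : ∀ {n} → Graph n → ℤ → ℤ
ρ G t = detℤ λ u v → Q G u v + t * δ u v

eval-δ : ∀ {n} (u v : Fin n) t → eval (if ⌊ u ≟ v ⌋ then + 1 ∷ [] else []) t ≡ δ u v
eval-δ u v t with u ≟ v
... | yes _ = trans (cong (_+_ 1ℤ) (ℤ.*-zeroʳ t)) (ℤ.+-identityʳ 1ℤ)
... | no _ = refl

opaque
  ρ-poly : ∀ {n} → Graph n → Poly
  ρ-poly G = det λ u v → Q G u v ∷ (if ⌊ u ≟ v ⌋ then + 1 ∷ [] else [])

  eval-ρ-poly : ∀ {n} (G : Graph n) t → eval (ρ-poly G) t ≡ ρ G t
  eval-ρ-poly G t = trans (eval-det _ t) (detℤ-cong λ u v → cong (λ x → Q G u v + t * x) (eval-δ u v t))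

-- The sign is left as the determinant of the negated identity; for cancelling it, being nonzero is
-- enough.
detℤ-neg : ∀ {n} (M : Mat n) → detℤ (λ i j → - M i j) ≡ detℤ (λ i j → - δ {n} i j) * detℤ M
detℤ-neg = alternating-unique {D = λ M → detℤ (λ i j → - M i j)} (record
  { multilinear = record
      { respects = λ h → respects (λ i j → cong -_ (h i j))
      ; linear = λ i c {M} {M′} {M″} off off′ at → linear i c
          (λ k k≢i j → cong -_ (off k k≢i j)) (λ k k≢i j → cong -_ (off′ k k≢i j))
          (λ j → trans (cong -_ (at j)) (lemma (M′ i j) c (M″ i j)))
      }
  ; alternating = λ M i≢k h → alternating _ i≢k (λ j → cong -_ (h j))
  })
  where
  open Alternating detℤ-alternating
  lemma : ∀ a c b → - (a + c * b) ≡ - a + c * - b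
  lemma = solve-∀

eval-charPolyQ : ∀ {n} (G : Graph n) t → eval (charPolyQ G) (- t) ≡ detℤ (λ i j → - δ {n} i j) * ρ G t
eval-charPolyQ G t = trans (eval-det _ (- t)) (trans
  (detℤ-cong λ u v → trans (cong (λ x → - Q G u v + - t * x) (eval-δ u v (- t))) (lemma (Q G u v) t (δ u v)))
  (detℤ-neg (λ u v → Q G u v + t * δ u v)))
  where
  lemma : ∀ q t d → - q + - t * d ≡ - (q + t * d)
  lemma = solve-∀

detℤ-negδ≢0 : ∀ n → detℤ (λ i j → - δ {n} i j) ≢ 0ℤ
detℤ-negδ≢0 n h = contradiction (begin
  1ℤ                                                              ≡⟨ sym (detℤ-δ n) ⟩
  detℤ (δ {n})                                                    ≡⟨ detℤ-cong (λ i j → sym (ℤ.neg-involutive (δ {n} i j))) ⟩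
  detℤ (λ i j → - - δ {n} i j)                                    ≡⟨ detℤ-neg (λ i j → - δ {n} i j) ⟩
  detℤ (λ i j → - δ {n} i j) * detℤ (λ i j → - δ {n} i j)         ≡⟨ cong (_* detℤ (λ i j → - δ {n} i j)) h ⟩
  0ℤ * detℤ (λ i j → - δ {n} i j)                                 ≡⟨ ℤ.*-zeroˡ (detℤ (λ i j → - δ {n} i j)) ⟩
  0ℤ                                                              ∎) λ ()
  where open ≡-Reasoning

charPolyQ-monicLinear : ∀ {n} (G : Graph n) →
  MonicLinear (λ u v → (- Q G u v) ∷ (if ⌊ u ≟ v ⌋ then + 1 ∷ [] else [])) (λ u → - Q G u u)
charPolyQ-monicLinear G = record
  { constant = λ _ → refl
  ; monic = monic
  ; linear = λ u → degree< (linear u)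
  ; off-diagonal = λ {u} {v} u≢v → degree< (off u v u≢v)
  }
  where
  monic : ∀ u → coeff (if ⌊ u ≟ u ⌋ then + 1 ∷ [] else []) 0 ≡ 1ℤ
  monic u with u ≟ u
  ... | yes _ = refl
  ... | no u≢u = contradiction refl u≢u
  linear : ∀ u k → 2 ≤ k → coeff ((- Q G u u) ∷ (if ⌊ u ≟ u ⌋ then + 1 ∷ [] else [])) k ≡ 0ℤ
  linear u (suc (suc k)) (s≤s (s≤s _)) with u ≟ u
  ... | yes _ = refl
  ... | no _ = refl
  off : ∀ u v → u ≢ v → ∀ k → 1 ≤ k → coeff ((- Q G u v) ∷ (if ⌊ u ≟ v ⌋ then + 1 ∷ [] else [])) k ≡ 0ℤ
  off u v u≢v (suc k) _ with u ≟ v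
  ... | yes u≡v = contradiction u≡v u≢v
  ... | no _ = refl

-- The order is the degree: if the orders differed, the leading coefficient 1 of one polynomial
-- would be a vanishing coefficient of the other.
cospectral⇒order≡ : ∀ {n m} (G : Graph n) (H : Graph m) → QCospectral G H → n ≡ m
cospectral⇒order≡ {n} {m} G H cs with ℕ.<-cmp n m
... | Tri.tri< n<m _ _ = contradiction (trans (sym (det-monic _ _ (charPolyQ-monicLinear H)))
  (trans (sym (cs m)) (det-degree _ _ (charPolyQ-monicLinear G) m n<m))) λ ()
... | Tri.tri≈ _ n≡m _ = n≡m
... | Tri.tri> _ _ m<n = contradiction (trans (sym (det-monic _ _ (charPolyQ-monicLinear G)))
  (trans (cs n) (det-degree _ _ (charPolyQ-monicLinear H) n m<n))) λ ()

cospectral⇒trace≡ : ∀ {n} (G H : Graph n) → QCospectral G H → trace (Q G) ≡ trace (Q H)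
cospectral⇒trace≡ {zero} G H cs = refl
cospectral⇒trace≡ {suc n} G H cs = ℤ.neg-injective (begin
  - trace (Q G)            ≡⟨ sym (∑-neg (λ u → Q G u u)) ⟩
  ∑ (λ u → - Q G u u)      ≡⟨ sym (det-subleading _ _ (charPolyQ-monicLinear G)) ⟩
  coeff (charPolyQ G) n    ≡⟨ cs n ⟩
  coeff (charPolyQ H) n    ≡⟨ det-subleading _ _ (charPolyQ-monicLinear H) ⟩
  ∑ (λ u → - Q H u u)      ≡⟨ ∑-neg (λ u → Q H u u) ⟩
  - trace (Q H)            ∎)
  where open ≡-Reasoning

cospectral⇒ρ≡ : ∀ {n} (G H : Graph n) → QCospectral G H → ∀ t → ρ G t ≡ ρ H t
cospectral⇒ρ≡ {n} G H cs t = *-cancelˡ (detℤ (λ i j → - δ {n} i j)) (ρ G t) (ρ H t) (detℤ-negδ≢0 n)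
  (trans (sym (eval-charPolyQ G t)) (trans (eval-cong (charPolyQ G) (charPolyQ H) cs (- t)) (eval-charPolyQ H t)))

ρ≡⇒cospectral : ∀ {n} (G H : Graph n) → (∀ t → ρ G t ≡ ρ H t) → QCospectral G H
ρ≡⇒cospectral {n} G H h = coeff-cong (charPolyQ G) (charPolyQ H) λ t →
  subst (λ s → eval (charPolyQ G) s ≡ eval (charPolyQ H) s) (ℤ.neg-involutive t)
    (trans (eval-charPolyQ G (- t)) (trans (cong (detℤ (λ i j → - δ {n} i j) *_) (h (- t))) (sym (eval-charPolyQ H (- t)))))

-- Isomorphisms and disjoint unions

infix 4 _≃_

record _≃_ {n m} (G : Graph n) (H : Graph m) : Set where
  constructor isomorphism
  field
    vertices : Fin n ↔ Fin m
    adj-agree : ∀ u v → adj H (Inverse.to vertices u) (Inverse.to vertices v) ≡ adj G u v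

≃⇒≅ : ∀ {n m} {G : Graph n} {H : Graph m} → G ≃ H → G ≅ H
≃⇒≅ (isomorphism f h) = ↔⇒⤖ f , h

≅⇒≃ : ∀ {n m} {G : Graph n} {H : Graph m} → G ≅ H → G ≃ H
≅⇒≃ (f , h) = isomorphism (⤖⇒↔ f) h

≃-refl : ∀ {n} {G : Graph n} → G ≃ G
≃-refl = isomorphism ↔-refl λ _ _ → refl

≃-sym : ∀ {n m} {G : Graph n} {H : Graph m} → G ≃ H → H ≃ G
≃-sym {H = H} (isomorphism f h) = isomorphism (↔-sym f) λ u v → trans (sym (h (from u) (from v)))
  (cong₂ (adj H) (strictlyInverseˡ u) (strictlyInverseˡ v))
  where open Inverse f

≃-trans : ∀ {l m n} {G : Graph l} {H : Graph m} {K : Graph n} → G ≃ H → H ≃ K → G ≃ K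
≃-trans (isomorphism f h) (isomorphism g k) = isomorphism (↔-trans f g) λ u v → trans (k (Inverse.to f u) (Inverse.to f v)) (h u v)

≃⇒order≡ : ∀ {n m} {G : Graph n} {H : Graph m} → G ≃ H → n ≡ m
≃⇒order≡ (isomorphism f _) = ↔⇒≡ f

module _ {n : ℕ} {G H : Graph n} (iso : G ≃ H) where
  private
    open _≃_ iso renaming (vertices to f)
    open Inverse f using (to; from; strictlyInverseˡ; strictlyInverseʳ)

    adjacency-to : ∀ u v → adjacency H (to u) (to v) ≡ adjacency G u v
    adjacency-to u v = cong indicator (adj-agree u v)

    to-injective : ∀ {u v} → to u ≡ to v → u ≡ v
    to-injective {u} {v} e = trans (sym (strictlyInverseʳ u)) (trans (cong from e) (strictlyInverseʳ v))

    Q-to : ∀ u v → Q H (to u) (to v) ≡ Q G u v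
    Q-to u v = trans (Q-entry H (to u) (to v)) (trans (cong₂ _+_
      (cong₂ _*_ (δ-injective to to-injective u v)
        (trans (sum-permute (adjacency H (to u)) f) (∑-cong (adjacency-to u))))
      (adjacency-to u v)) (sym (Q-entry G u v)))

  ≃⇒ρ≡ : ∀ t → ρ G t ≡ ρ H t
  ≃⇒ρ≡ t = trans (detℤ-cong λ u v → sym (cong₂ (λ x y → x + t * y) (Q-to u v) (δ-injective to to-injective u v)))
    (detℤ-permute to from strictlyInverseˡ strictlyInverseʳ (λ u v → Q H u v + t * δ u v))

  ≃⇒trace≡ : trace (Q G) ≡ trace (Q H)
  ≃⇒trace≡ = trans (∑-cong (λ u → sym (Q-to u u))) (sym (sum-permute (λ u → Q H u u) f))

sumAdj : ∀ {X Y : Set} → (X → X → Bool) → (Y → Y → Bool) → X ⊎ Y → X ⊎ Y → Bool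
sumAdj e e′ (inj₁ u) (inj₁ v) = e u v
sumAdj e e′ (inj₂ u) (inj₂ v) = e′ u v
sumAdj e e′ _ _ = false

module _ {n m : ℕ} (G : Graph n) (H : Graph m) where
  adj-⊔ : ∀ u v → adj (G ⊔ H) u v ≡ sumAdj (adj G) (adj H) (splitAt n u) (splitAt n v)
  adj-⊔ u v with splitAt n u | splitAt n v
  ... | inj₁ _ | inj₁ _ = refl
  ... | inj₁ _ | inj₂ _ = refl
  ... | inj₂ _ | inj₁ _ = refl
  ... | inj₂ _ | inj₂ _ = refl

  private
    degree-⊔ : ∀ u → ∑ (adjacency (G ⊔ H) u) ≡ [ (λ i → ∑ (adjacency G i)) , (λ i → ∑ (adjacency H i)) ]′ (splitAt n u)
    degree-⊔ u = trans (∑-split {n} {m} (adjacency (G ⊔ H) u)) (trans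
      (cong₂ _+_ (∑-cong (λ i → cong indicator (trans (adj-⊔ u (i ↑ˡ m)) (cong (sumAdj (adj G) (adj H) (splitAt n u)) (Fin.splitAt-↑ˡ n i m)))))
        (∑-cong (λ i → cong indicator (trans (adj-⊔ u (n ↑ʳ i)) (cong (sumAdj (adj G) (adj H) (splitAt n u)) (Fin.splitAt-↑ʳ n m i))))))
      (cases (splitAt n u)))
      where
      cases : ∀ x → ∑ (λ i → indicator (sumAdj (adj G) (adj H) x (inj₁ i))) + ∑ (λ i → indicator (sumAdj (adj G) (adj H) x (inj₂ i))) ≡
        [ (λ i → ∑ (adjacency G i)) , (λ i → ∑ (adjacency H i)) ]′ x
      cases (inj₁ i) = trans (cong (_+_ (∑ (adjacency G i))) (∑-zero {m} _ (λ _ → refl))) (ℤ.+-identityʳ _)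
      cases (inj₂ i) = trans (cong (_+ ∑ (adjacency H i)) (∑-zero {n} _ (λ _ → refl))) (ℤ.+-identityˡ _)

    δ-split : ∀ u v → δ u v ≡ blockEntry δ δ (splitAt n u) (splitAt n v)
    δ-split u v with splitAt n u in eu | splitAt n v in ev
    ... | inj₁ i | inj₁ j = trans (cong₂ δ (sym (Fin.splitAt⁻¹-↑ˡ eu)) (sym (Fin.splitAt⁻¹-↑ˡ ev)))
      (δ-injective (_↑ˡ m) (Fin.↑ˡ-injective m _ _) i j)
    ... | inj₂ i | inj₂ j = trans (cong₂ δ (sym (Fin.splitAt⁻¹-↑ʳ eu)) (sym (Fin.splitAt⁻¹-↑ʳ ev)))
      (δ-injective (n ↑ʳ_) (Fin.↑ʳ-injective n _ _) i j)
    ... | inj₁ i | inj₂ j = δ-off λ u≡v → contradiction (trans (sym eu) (trans (cong (splitAt n) u≡v) ev)) λ ()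
    ... | inj₂ i | inj₁ j = δ-off λ u≡v → contradiction (trans (sym eu) (trans (cong (splitAt n) u≡v) ev)) λ ()

    Q-⊔ : ∀ u v → Q (G ⊔ H) u v ≡ blockDiag (Q G) (Q H) u v
    Q-⊔ u v = trans (Q-entry (G ⊔ H) u v) (trans
      (cong₂ _+_ (cong₂ _*_ (δ-split u v) (degree-⊔ u)) (cong indicator (adj-⊔ u v)))
      (cases (splitAt n u) (splitAt n v)))
      where
      cases : ∀ x y → blockEntry δ δ x y * [ (λ i → ∑ (adjacency G i)) , (λ i → ∑ (adjacency H i)) ]′ x
        + indicator (sumAdj (adj G) (adj H) x y) ≡ blockEntry (Q G) (Q H) x y
      cases (inj₁ i) (inj₁ j) = sym (Q-entry G i j)
      cases (inj₂ i) (inj₂ j) = sym (Q-entry H i j)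
      cases (inj₁ i) (inj₂ j) = cong (_+ 0ℤ) (ℤ.*-zeroˡ (∑ (adjacency G i)))
      cases (inj₂ i) (inj₁ j) = cong (_+ 0ℤ) (ℤ.*-zeroˡ (∑ (adjacency H i)))

  ρ-⊔ : ∀ t → ρ (G ⊔ H) t ≡ ρ G t * ρ H t
  ρ-⊔ t = trans (detℤ-cong λ u v → trans (cong₂ (λ x y → x + t * y) (Q-⊔ u v) (δ-split u v)) (cases (splitAt n u) (splitAt n v)))
    (detℤ-blockDiag (λ u v → Q G u v + t * δ u v) (λ u v → Q H u v + t * δ u v))
    where
    cases : ∀ x y → blockEntry (Q G) (Q H) x y + t * blockEntry δ δ x y ≡
      blockEntry (λ u v → Q G u v + t * δ u v) (λ u v → Q H u v + t * δ u v) x y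
    cases (inj₁ i) (inj₁ j) = refl
    cases (inj₂ i) (inj₂ j) = refl
    cases (inj₁ i) (inj₂ j) = cong (_+_ 0ℤ) (ℤ.*-zeroʳ t)
    cases (inj₂ i) (inj₁ j) = cong (_+_ 0ℤ) (ℤ.*-zeroʳ t)

  trace-⊔ : trace (Q (G ⊔ H)) ≡ trace (Q G) + trace (Q H)
  trace-⊔ = trans (∑-split {n} {m} (λ u → Q (G ⊔ H) u u)) (cong₂ _+_
    (∑-cong (λ i → trans (Q-⊔ (i ↑ˡ m) (i ↑ˡ m)) (cong (λ x → blockEntry (Q G) (Q H) x x) (Fin.splitAt-↑ˡ n i m))))
    (∑-cong (λ i → trans (Q-⊔ (n ↑ʳ i) (n ↑ʳ i)) (cong (λ x → blockEntry (Q G) (Q H) x x) (Fin.splitAt-↑ʳ n m i)))))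

-- Edges and incidence matrices

∑-lookup : ∀ {A : Set} (xs : List A) (f : A → ℤ) → ∑ (λ k → f (lookup xs k)) ≡ foldr (λ x s → f x + s) 0ℤ xs
∑-lookup [] f = refl
∑-lookup (x ∷ xs) f = cong (_+_ (f x)) (∑-lookup xs f)

module _ {A : Set} (f : A → ℤ) where
  private
    sumOver : List A → ℤ
    sumOver = foldr (λ x s → f x + s) 0ℤ

  sumOver-++ : ∀ xs ys → sumOver (xs ++ ys) ≡ sumOver xs + sumOver ys
  sumOver-++ [] ys = sym (ℤ.+-identityˡ (sumOver ys))
  sumOver-++ (x ∷ xs) ys = trans (cong (_+_ (f x)) (sumOver-++ xs ys)) (sym (ℤ.+-assoc (f x) (sumOver xs) (sumOver ys)))

  sumOver-filter : ∀ p xs → sumOver (filterᵇ p xs) ≡ foldr (λ x s → indicator (p x) * f x + s) 0ℤ xs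
  sumOver-filter p [] = refl
  sumOver-filter p (x ∷ xs) with p x
  ... | true = cong₂ _+_ (sym (ℤ.*-identityˡ (f x))) (sumOver-filter p xs)
  ... | false = trans (sumOver-filter p xs) (sym (trans (cong (_+ rest) (ℤ.*-zeroˡ (f x))) (ℤ.+-identityˡ rest)))
    where
    rest = foldr (λ x s → indicator (p x) * f x + s) 0ℤ xs

sumOver-map : ∀ {A B : Set} (g : A → B) (f : B → ℤ) xs →
  foldr (λ x s → f x + s) 0ℤ (map g xs) ≡ foldr (λ x s → f (g x) + s) 0ℤ xs
sumOver-map g f [] = refl
sumOver-map g f (x ∷ xs) = cong (_+_ (f (g x))) (sumOver-map g f xs)

sumOver-allFin : ∀ {n} (f : Fin n → ℤ) → foldr (λ x s → f x + s) 0ℤ (allFin n) ≡ ∑ f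
sumOver-allFin f = go id f
  where
  go : ∀ {A : Set} {n} (g : Fin n → A) (f : A → ℤ) → foldr (λ x s → f x + s) 0ℤ (tabulate g) ≡ ∑ (f ∘ g)
  go {n = zero} g f = refl
  go {n = suc n} g f = cong (_+_ (f (g zero))) (go (g ∘ suc) f)

∑² : ∀ {n} → Mat n → ℤ
∑² F = ∑ λ p → ∑ (F p)

∑²-cong : ∀ {n} {F F′ : Mat n} → (∀ p q → F p q ≡ F′ p q) → ∑² F ≡ ∑² F′
∑²-cong h = ∑-cong λ p → ∑-cong (h p)

∑²-+ : ∀ {n} (F F′ : Mat n) → ∑² (λ p q → F p q + F′ p q) ≡ ∑² F + ∑² F′
∑²-+ F F′ = trans (∑-cong λ p → ∑-distrib-+ (F p) (F′ p)) (∑-distrib-+ (λ p → ∑ (F p)) (λ p → ∑ (F′ p)))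

∑²-δ : ∀ {n} (F : Mat n) a b → ∑² (λ p q → F p q * (δ a p * δ b q)) ≡ F a b
∑²-δ F a b = begin
  ∑² (λ p q → F p q * (δ a p * δ b q))       ≡⟨ ∑²-cong (λ p q → lemma (F p q) (δ a p) (δ b q)) ⟩
  ∑² (λ p q → δ a p * (δ b q * F p q))       ≡⟨ ∑-cong (λ p → sym (*-distribˡ-sum (δ a p) (λ q → δ b q * F p q))) ⟩
  ∑ (λ p → δ a p * ∑ (λ q → δ b q * F p q))  ≡⟨ ∑-δˡ a (λ p → ∑ (λ q → δ b q * F p q)) ⟩
  ∑ (λ q → δ b q * F a q)                    ≡⟨ ∑-δˡ b (F a) ⟩
  F a b                                      ∎
  where
  open ≡-Reasoning
  lemma : ∀ f a b → f * (a * b) ≡ a * (b * f)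
  lemma = solve-∀

module _ {n : ℕ} (G : Graph n) where
  -- Lists each edge once, at its smaller endpoint; this is the order in which `edgeCount` counts.
  increasing : Fin n → Fin n → Bool
  increasing u v = adj G u v ∧ ⌊ toℕ u ℕ.<? toℕ v ⌋

  edgesFrom : Fin n → List (Fin n × Fin n)
  edgesFrom u = map (u ,_) (filterᵇ (increasing u) (allFin n))

  edges : List (Fin n × Fin n)
  edges = concatMap edgesFrom (allFin n)

  length-edges : length edges ≡ edgeCount G
  length-edges = go (allFin n)
    where
    length-filter : ∀ (p : Fin n → Bool) xs → length (filterᵇ p xs) ≡ sum (map (λ i → if p i then 1 else 0) xs)
    length-filter p [] = refl
    length-filter p (x ∷ xs) with p x
    ... | true = cong suc (length-filter p xs)
    ... | false = length-filter p xs
    go : ∀ us → length (concatMap edgesFrom us) ≡ sum (map (λ u → count (increasing u)) us)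
    go [] = refl
    go (u ∷ us) = trans (List.length-++ (edgesFrom u)) (cong₂ ℕ._+_
      (trans (List.length-map (u ,_) (filterᵇ (increasing u) (allFin n))) (length-filter (increasing u) (allFin n))) (go us))

  source target : Fin (length edges) → Fin n
  source k = proj₁ (lookup edges k)
  target k = proj₂ (lookup edges k)

  ∑-edges : ∀ (F : Mat n) → ∑ (λ k → F (source k) (target k)) ≡ ∑² (λ u v → indicator (increasing u v) * F u v)
  ∑-edges F = trans (∑-lookup edges f) (trans (go (allFin n))
    (trans (sumOver-allFin (λ u → foldr (λ v s → indicator (increasing u v) * F u v + s) 0ℤ (allFin n)))
      (∑-cong (λ u → sumOver-allFin (λ v → indicator (increasing u v) * F u v)))))
    where
    f : Fin n × Fin n → ℤ
    f (u , v) = F u v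
    go : ∀ us → foldr (λ e s → f e + s) 0ℤ (concatMap edgesFrom us) ≡
      foldr (λ u s → foldr (λ v s → indicator (increasing u v) * F u v + s) 0ℤ (allFin n) + s) 0ℤ us
    go [] = refl
    go (u ∷ us) = trans (sumOver-++ f (edgesFrom u) (concatMap edgesFrom us)) (cong₂ _+_
      (trans (sumOver-map (u ,_) f (filterᵇ (increasing u) (allFin n))) (sumOver-filter (F u) (increasing u) (allFin n)))
      (go us))

  -- Doubling counts every edge in both directions, so for symmetric summands the orientation
  -- disappears and sums over the edge list become sums over all ordered pairs of vertices.
  2*∑-edges : ∀ (F : Mat n) → (∀ u v → F u v ≡ F v u) →
    + 2 * ∑ (λ k → F (source k) (target k)) ≡ ∑² (λ u v → adjacency G u v * F u v)
  2*∑-edges F F-sym = begin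
    + 2 * ∑ (λ k → F (source k) (target k))
      ≡⟨ cong (+ 2 *_) (∑-edges F) ⟩
    + 2 * S
      ≡⟨ double S ⟩
    S + S
      ≡⟨ cong (_+_ S) (∑-comm (λ u v → indicator (increasing u v) * F u v)) ⟩
    S + ∑² (λ u v → indicator (increasing v u) * F v u)
      ≡⟨ sym (∑²-+ (λ u v → indicator (increasing u v) * F u v) (λ u v → indicator (increasing v u) * F v u)) ⟩
    ∑² (λ u v → indicator (increasing u v) * F u v + indicator (increasing v u) * F v u)
      ≡⟨ ∑²-cong (λ u v → trans (cong (λ x → indicator (increasing u v) * F u v + indicator (increasing v u) * x) (F-sym v u))
           (trans (sym (ℤ.*-distribʳ-+ (F u v) (indicator (increasing u v)) (indicator (increasing v u)))) (cong (_* F u v) (orient u v)))) ⟩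
    ∑² (λ u v → adjacency G u v * F u v) ∎
    where
    open ≡-Reasoning
    S : ℤ
    S = ∑² (λ u v → indicator (increasing u v) * F u v)
    double : ∀ s → + 2 * s ≡ s + s
    double = solve-∀
    orient : ∀ u v → indicator (increasing u v) + indicator (increasing v u) ≡ adjacency G u v
    orient u v rewrite adj-sym G v u with adj G u v in uv
    ... | false = refl
    ... | true with toℕ u ℕ.<? toℕ v | toℕ v ℕ.<? toℕ u
    ...   | yes u<v | yes v<u = contradiction v<u (ℕ.<-asym u<v)
    ...   | yes _ | no _ = refl
    ...   | no _ | yes _ = refl
    ...   | no u≮v | no v≮u with Fin.toℕ-injective (ℕ.≤-antisym (ℕ.≮⇒≥ v≮u) (ℕ.≮⇒≥ u≮v))
    ...     | refl = contradiction (trans (sym uv) (adj-irrefl G u)) λ ()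

  incidence : Fin n → Fin (length edges) → ℤ
  incidence u k = δ u (source k) + δ u (target k)

  incidence-columnSum : ∀ k → ∑ (λ u → incidence u k) ≡ + 2
  incidence-columnSum k = trans (∑-distrib-+ (λ u → δ u (source k)) (λ u → δ u (target k))) (cong₂ _+_ (unit (source k)) (unit (target k)))
    where
    unit : ∀ v → ∑ (λ u → δ u v) ≡ 1ℤ
    unit v = trans (∑-cong (λ u → sym (ℤ.*-identityˡ (δ u v)))) (∑-δʳ (λ _ → 1ℤ) v)

  -- The product of two incidence rows has four terms: in the sum over ordered pairs two of them
  -- give the degree on the diagonal and two the adjacency, each twice what is wanted.
  Q-incidence : ∀ u v → Q G u v ≡ (incidence ⊡ (incidence ᵀ)) u v
  Q-incidence u v = sym (ℤ.*-cancelˡ-≡ (+ 2) ((incidence ⊡ (incidence ᵀ)) u v) (Q G u v) (begin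
    + 2 * ∑ (λ k → F (source k) (target k))
      ≡⟨ 2*∑-edges F F-sym ⟩
    ∑² (λ p q → A p q * F p q)
      ≡⟨ ∑²-cong (λ p q → expand (A p q) (δ u p) (δ u q) (δ v p) (δ v q)) ⟩
    ∑² (λ p q → (F₁ p q + F₂ p q) + (F₃ p q + F₄ p q))
      ≡⟨ trans (∑²-+ (λ p q → F₁ p q + F₂ p q) (λ p q → F₃ p q + F₄ p q)) (cong₂ _+_ (∑²-+ F₁ F₂) (∑²-+ F₃ F₄)) ⟩
    (∑² F₁ + ∑² F₂) + (∑² F₃ + ∑² F₄)
      ≡⟨ cong₂ _+_ (cong₂ _+_ rowDegree (∑²-δ A u v)) (cong₂ _+_ (trans (∑²-δ A v u) (adjacency-sym G v u))
           (trans (∑-comm F₄) (trans (∑²-cong (λ q p → cong (_* (δ u q * δ v q)) (adjacency-sym G p q))) rowDegree))) ⟩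
    (δ u v * ∑ (A u) + A u v) + (A u v + δ u v * ∑ (A u))
      ≡⟨ collect (δ u v * ∑ (A u)) (A u v) ⟩
    + 2 * (δ u v * ∑ (A u) + A u v)
      ≡⟨ cong (+ 2 *_) (sym (Q-entry G u v)) ⟩
    + 2 * Q G u v ∎))
    where
    open ≡-Reasoning
    A : Mat n
    A = adjacency G
    F : Mat n
    F p q = (δ u p + δ u q) * (δ v p + δ v q)
    F₁ F₂ F₃ F₄ : Mat n
    F₁ p q = A p q * (δ u p * δ v p)
    F₂ p q = A p q * (δ u p * δ v q)
    F₃ p q = A p q * (δ v p * δ u q)
    F₄ p q = A p q * (δ u q * δ v q)
    F-sym : ∀ p q → F p q ≡ F q p
    F-sym p q = cong₂ _*_ (ℤ.+-comm (δ u p) (δ u q)) (ℤ.+-comm (δ v p) (δ v q))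
    expand : ∀ a up uq vp vq → a * ((up + uq) * (vp + vq)) ≡ (a * (up * vp) + a * (up * vq)) + (a * (vp * uq) + a * (uq * vq))
    expand = solve-∀
    collect : ∀ x y → (x + y) + (y + x) ≡ + 2 * (x + y)
    collect = solve-∀
    swap : ∀ a x y → a * (x * y) ≡ x * (y * a)
    swap = solve-∀
    rowDegree : ∑² F₁ ≡ δ u v * ∑ (A u)
    rowDegree = begin
      ∑² F₁
        ≡⟨ ∑-cong (λ p → trans (sym (*-distribʳ-sum (δ u p * δ v p) (A p))) (swap (∑ (A p)) (δ u p) (δ v p))) ⟩
      ∑ (λ p → δ u p * (δ v p * ∑ (A p)))
        ≡⟨ ∑-δˡ u (λ p → δ v p * ∑ (A p)) ⟩
      δ v u * ∑ (A u)
        ≡⟨ cong (_* ∑ (A u)) (δ-sym v u) ⟩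
      δ u v * ∑ (A u) ∎

  trace-Q : trace (Q G) ≡ + 2 * + edgeCount G
  trace-Q = begin
    ∑ (λ u → Q G u u)
      ≡⟨ ∑-cong (λ u → trans (Q-entry G u u) (trans (cong₂ _+_ (cong (_* ∑ (adjacency G u)) (δ-diag u)) (adjacency-diag G u))
           (trans (ℤ.+-identityʳ _) (ℤ.*-identityˡ _)))) ⟩
    ∑² (adjacency G)
      ≡⟨ ∑²-cong (λ u v → sym (ℤ.*-identityʳ (adjacency G u v))) ⟩
    ∑² (λ u v → adjacency G u v * 1ℤ)
      ≡⟨ sym (2*∑-edges (λ _ _ → 1ℤ) (λ _ _ → refl)) ⟩
    + 2 * ∑ {length edges} (λ _ → 1ℤ)
      ≡⟨ cong (+ 2 *_) (trans (ones (length edges)) (cong +_ length-edges)) ⟩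
    + 2 * + edgeCount G ∎
    where
    open ≡-Reasoning
    ones : ∀ m → ∑ {m} (λ _ → 1ℤ) ≡ + m
    ones zero = refl
    ones (suc m) = cong (_+_ 1ℤ) (ones m)

  -- The unit vector of the edge, described by its endpoints so that its position in the edge list
  -- need not be found; both orientations enter `X` to make it symmetric.
  edgeVector : ∀ {a b} → adj G a b ≡ true →
    ∃ λ (x : Fin (length edges) → ℤ) → ∀ i → ∑ (λ k → incidence i k * x k) ≡ δ a i + δ b i
  edgeVector {a} {b} ab = (λ k → X (source k) (target k)) , λ i → ℤ.*-cancelˡ-≡ (+ 2) _ (δ a i + δ b i) (begin
    + 2 * ∑ (λ k → (δ i (source k) + δ i (target k)) * X (source k) (target k))
      ≡⟨ 2*∑-edges (λ p q → (δ i p + δ i q) * X p q) (λ p q → cong₂ _*_ (ℤ.+-comm (δ i p) (δ i q))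
           (trans (ℤ.+-comm (δ a p * δ b q) (δ b p * δ a q)) (cong₂ _+_ (ℤ.*-comm (δ b p) (δ a q)) (ℤ.*-comm (δ a p) (δ b q))))) ⟩
    ∑² (λ p q → A p q * ((δ i p + δ i q) * X p q))
      ≡⟨ ∑²-cong (λ p q → expand (A p q) (δ i p + δ i q) (δ a p * δ b q) (δ b p * δ a q)) ⟩
    ∑² (λ p q → A p q * (δ i p + δ i q) * (δ a p * δ b q) + A p q * (δ i p + δ i q) * (δ b p * δ a q))
      ≡⟨ ∑²-+ (λ p q → A p q * (δ i p + δ i q) * (δ a p * δ b q)) (λ p q → A p q * (δ i p + δ i q) * (δ b p * δ a q)) ⟩
    ∑² (λ p q → A p q * (δ i p + δ i q) * (δ a p * δ b q)) + ∑² (λ p q → A p q * (δ i p + δ i q) * (δ b p * δ a q))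
      ≡⟨ cong₂ _+_ (∑²-δ (λ p q → A p q * (δ i p + δ i q)) a b) (∑²-δ (λ p q → A p q * (δ i p + δ i q)) b a) ⟩
    A a b * (δ i a + δ i b) + A b a * (δ i b + δ i a)
      ≡⟨ cong₂ _+_ (cong₂ (λ x y → x * y) (cong indicator ab) (cong₂ _+_ (δ-sym i a) (δ-sym i b)))
           (cong₂ (λ x y → x * y) (cong indicator (trans (adj-sym G b a) ab)) (cong₂ _+_ (δ-sym i b) (δ-sym i a))) ⟩
    1ℤ * (δ a i + δ b i) + 1ℤ * (δ b i + δ a i)
      ≡⟨ collect (δ a i) (δ b i) ⟩
    + 2 * (δ a i + δ b i) ∎)
    where
    open ≡-Reasoning
    A : Mat n
    A = adjacency G
    X : Fin n → Fin n → ℤ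
    X p q = δ a p * δ b q + δ b p * δ a q
    expand : ∀ a s x y → a * (s * (x + y)) ≡ a * s * x + a * s * y
    expand = solve-∀
    collect : ∀ x y → 1ℤ * (x + y) + 1ℤ * (y + x) ≡ + 2 * (x + y)
    collect = solve-∀

  -- The edge vectors of a walk are summed with alternating signs, so inner vertices cancel.
  -- `endSign` is 1 for walks of even length and - 1 for odd ones.
  record SignedWalk (w u : Fin n) : Set where
    field
      vector : Fin (length edges) → ℤ
      endSign : ℤ
      endSign² : endSign * endSign ≡ 1ℤ
      boundary : ∀ i → ∑ (λ k → incidence i k * vector k) ≡ δ w i - endSign * δ u i

  signedWalk : ∀ {w u} → Walk G w u → SignedWalk w u
  signedWalk {w} [] = record
    { vector = λ _ → 0ℤ
    ; endSign = 1ℤ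
    ; endSign² = refl
    ; boundary = λ i → trans (∑-zero _ (λ k → ℤ.*-zeroʳ (incidence i k))) (cancel (δ w i))
    }
    where
    cancel : ∀ x → 0ℤ ≡ x - 1ℤ * x
    cancel = solve-∀
  signedWalk {w} {u} (_∷_ {w = v} wv walk) = record
    { vector = λ k → x k + -1ℤ * vector k
    ; endSign = - endSign
    ; endSign² = trans (square endSign) endSign²
    ; boundary = λ i → begin
        ∑ (λ k → incidence i k * (x k + -1ℤ * vector k))
          ≡⟨ ∑-cong (λ k → distribute (incidence i k) (x k) (vector k)) ⟩
        ∑ (λ k → incidence i k * x k + -1ℤ * (incidence i k * vector k))
          ≡⟨ ∑-linear -1ℤ (λ k → incidence i k * x k) (λ k → incidence i k * vector k) ⟩
        ∑ (λ k → incidence i k * x k) + -1ℤ * ∑ (λ k → incidence i k * vector k)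
          ≡⟨ cong₂ (λ a b → a + -1ℤ * b) (proj₂ (edgeVector wv) i) (boundary i) ⟩
        (δ w i + δ v i) + -1ℤ * (δ v i - endSign * δ u i)
          ≡⟨ cancel (δ w i) (δ v i) (endSign * δ u i) ⟩
        δ w i + endSign * δ u i
          ≡⟨ negate (δ w i) endSign (δ u i) ⟩
        δ w i - - endSign * δ u i ∎
    }
    where
    open ≡-Reasoning
    open SignedWalk (signedWalk walk)
    x = proj₁ (edgeVector wv)
    square : ∀ s → - s * - s ≡ s * s
    square = solve-∀
    distribute : ∀ m a b → m * (a + -1ℤ * b) ≡ m * a + -1ℤ * (m * b)
    distribute = solve-∀
    cancel : ∀ a b c → (a + b) + -1ℤ * (b - c) ≡ a + c
    cancel = solve-∀
    negate : ∀ a s b → a + s * b ≡ a - - s * b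
    negate = solve-∀

-- Connected graphs with few edges

adjugate-cong : ∀ {n} {M M′ : Mat n} → (∀ i j → M i j ≡ M′ i j) → ∀ k j → adjugate M k j ≡ adjugate M′ k j
adjugate-cong {M = M} {M′} h k j = detℤ-cong entry
  where
  entry : ∀ i l → (M [ j ]≔ δ k) i l ≡ (M′ [ j ]≔ δ k) i l
  entry i l with i ≟ j
  ... | yes refl = trans (≔-at M i (δ k) l) (sym (≔-at M′ i (δ k) l))
  ... | no i≢j = trans (≔-off M j (δ k) i i≢j l) (trans (h i l) (sym (≔-off M′ j (δ k) i i≢j l)))

-- With as many edges as vertices, the parity of the cycle is decided without finding the cycle:
-- either the signs of the walks to a base vertex alternate along every edge, a two-colouring kept
-- as `s`, or some edge joins equal signs.
data ConnectedKind {n} (C : Graph (suc n)) : Set where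
  tree : edgeCount C ≡ n → detℤ (Q C) ≡ 0ℤ → (∀ u → adjugate (Q C) u u ≡ 1ℤ) → ConnectedKind C
  oddUnicyclic : edgeCount C ≡ suc n → OddUnicyclicMatrix (Q C) → ConnectedKind C
  evenUnicyclic : edgeCount C ≡ suc n → detℤ (Q C) ≡ 0ℤ → (s : Fin (suc n) → ℤ) → (∀ u → s u * s u ≡ 1ℤ) →
    (∀ {u v} → adj C u v ≡ true → s u + s v ≡ 0ℤ) → ConnectedKind C
  manyEdges : suc n ℕ.< edgeCount C → ConnectedKind C

s+t≢0⇒s≡t : ∀ s t → s * s ≡ 1ℤ → t * t ≡ 1ℤ → s + t ≢ 0ℤ → s ≡ t
s+t≢0⇒s≡t s t s² t² s+t≢0 = *-cancelˡ (s + t) s t s+t≢0 (trans (lemma₁ s t) (trans (cong (_+ s * t) (trans s² (sym t²))) (lemma₂ s t)))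
  where
  lemma₁ : ∀ s t → (s + t) * s ≡ s * s + s * t
  lemma₁ = solve-∀
  lemma₂ : ∀ s t → t * t + s * t ≡ (s + t) * t
  lemma₂ = solve-∀

module _ {n e : ℕ} (source target : Fin e → Fin (suc n)) where
  private
    N : Fin (suc n) → Fin e → ℤ
    N u k = δ u (source k) + δ u (target k)

  -- An edge with equal signs at its ends closes an odd walk through the base vertex: the edge minus
  -- the two walks from its ends. The ends cancel and the base vertex remains with coefficient
  -- `2 * s a`, which the factor `s a` normalizes.
  oddWalkVector : ∀ (y : Fin (suc n) → Fin e → ℤ) (s : Fin (suc n) → ℤ) →
    (∀ w i → ∑ (λ k → N i k * y w k) ≡ δ w i - s w * δ zero i) → (∀ w → s w * s w ≡ 1ℤ) →
    ∀ k → s (source k) + s (target k) ≢ 0ℤ → ∃ λ (c : Fin e → ℤ) → ∀ i → ∑ (λ l → N i l * c l) ≡ + 2 * δ zero i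
  oddWalkVector y s walk s² k σ≢0 = c , λ i → begin
    ∑ (λ l → N i l * (s a * (δ k l + -1ℤ * (y a l + 1ℤ * y b l))))
      ≡⟨ ∑-cong (λ l → expand (N i l) (s a) (δ k l) (y a l) (y b l)) ⟩
    ∑ (λ l → s a * (δ k l * N i l + -1ℤ * (N i l * y a l + 1ℤ * (N i l * y b l))))
      ≡⟨ sym (*-distribˡ-sum (s a) (λ l → δ k l * N i l + -1ℤ * (N i l * y a l + 1ℤ * (N i l * y b l)))) ⟩
    s a * ∑ (λ l → δ k l * N i l + -1ℤ * (N i l * y a l + 1ℤ * (N i l * y b l)))
      ≡⟨ cong (s a *_) (trans (∑-linear -1ℤ (λ l → δ k l * N i l) (λ l → N i l * y a l + 1ℤ * (N i l * y b l)))
           (cong₂ (λ x z → x + -1ℤ * z) (∑-δˡ k (N i))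
             (trans (∑-linear 1ℤ (λ l → N i l * y a l) (λ l → N i l * y b l)) (cong₂ (λ x z → x + 1ℤ * z) (walk a i) (walk b i))))) ⟩
    s a * (N i k + -1ℤ * ((δ a i - s a * δ zero i) + 1ℤ * (δ b i - s b * δ zero i)))
      ≡⟨ cong₂ (λ x z → s a * (x + -1ℤ * ((δ a i - s a * δ zero i) + 1ℤ * (δ b i - z * δ zero i))))
           (cong₂ _+_ (δ-sym i a) (δ-sym i b)) (sym (s+t≢0⇒s≡t (s a) (s b) (s² a) (s² b) σ≢0)) ⟩
    s a * ((δ a i + δ b i) + -1ℤ * ((δ a i - s a * δ zero i) + 1ℤ * (δ b i - s a * δ zero i)))
      ≡⟨ collect (s a) (δ a i) (δ b i) (δ zero i) ⟩
    + 2 * ((s a * s a) * δ zero i)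
      ≡⟨ cong (+ 2 *_) (trans (cong (_* δ zero i) (s² a)) (ℤ.*-identityˡ (δ zero i))) ⟩
    + 2 * δ zero i ∎
    where
    open ≡-Reasoning
    a b : Fin (suc n)
    a = source k
    b = target k
    c : Fin e → ℤ
    c l = s a * (δ k l + -1ℤ * (y a l + 1ℤ * y b l))
    expand : ∀ m s d x z → m * (s * (d + -1ℤ * (x + 1ℤ * z))) ≡ s * (d * m + -1ℤ * (m * x + 1ℤ * (m * z)))
    expand = solve-∀
    collect : ∀ s x z d → s * ((x + z) + -1ℤ * ((x - s * d) + 1ℤ * (z - s * d))) ≡ + 2 * ((s * s) * d)
    collect = solve-∀

  signing-column : ∀ (s : Fin (suc n) → ℤ) k → ∑ (λ i → N i k * s i) ≡ s (source k) + s (target k)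
  signing-column s k = trans (∑-cong (λ i → split (δ i (source k)) (δ i (target k)) (s i)))
    (trans (∑-distrib-+ (λ i → s i * δ i (source k)) (λ i → s i * δ i (target k)))
      (cong₂ _+_ (∑-δʳ s (source k)) (∑-δʳ s (target k))))
    where
    split : ∀ a b s → (a + b) * s ≡ s * a + s * b
    split = solve-∀

module _ {n : ℕ} (source target : Fin (suc n) → Fin (suc n)) where
  private
    N : Mat (suc n)
    N u k = δ u (source k) + δ u (target k)

  -- An alternating signing is a nonzero vector in the kernel of `N ᵀ`.
  signing⇒singular : (s : Fin (suc n) → ℤ) → s zero * s zero ≡ 1ℤ → (∀ k → s (source k) + s (target k) ≡ 0ℤ) →
    detℤ (N ⊡ (N ᵀ)) ≡ 0ℤ
  signing⇒singular s s₀² σ≡0 with detℤ (N ᵀ) ℤ.≟ 0ℤ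
  ... | yes det≡0 = trans (detℤ-⊡ N (N ᵀ)) (trans (cong (detℤ N *_) det≡0) (ℤ.*-zeroʳ (detℤ N)))
  ... | no det≢0 = contradiction (trans (sym s₀²) (cong (λ x → x * x)
    (⊡-kernel (N ᵀ) s det≢0 (λ k → trans (signing-column source target s k) (σ≡0 k)) zero))) λ ()

module _ {n : ℕ} (C : Graph (suc n)) (connected : Connected C) where
  private
    module W w u = SignedWalk (signedWalk C (connected w u))
    L = incidence C ⊡ (incidence C ᵀ)

    toQ : detℤ L ≡ detℤ (Q C)
    toQ = detℤ-cong (λ u v → sym (Q-incidence C u v))

    adjugate-toQ : ∀ u v → adjugate L u v ≡ adjugate (Q C) u v
    adjugate-toQ = adjugate-cong (λ u v → sym (Q-incidence C u v))

    kind : ∀ e → length (edges C) ≡ e → ConnectedKind C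
    kind e length≡e with ℕ.<-cmp e (suc n)
    kind e length≡e | Tri.tri> _ _ n<e = manyEdges (subst (suc n ℕ.<_) (trans (sym length≡e) (length-edges C)) n<e)
    kind e length≡e | Tri.tri< e<n _ _ = tree (trans (sym (length-edges C)) length≡n) (proj₁ facts) (proj₂ facts)
      where
      length≡n : length (edges C) ≡ n
      length≡n = trans length≡e (ℕ.≤-antisym (ℕ.s≤s⁻¹ e<n) (ℕ.s≤s⁻¹ (subst (λ l → suc n ≤ suc l) length≡e
        (vertices≤1+edges (incidence C) zero (λ w → W.vector w zero) (λ w → W.endSign w zero) (λ w → W.boundary w zero)))))
      treeFacts : ∀ {l} (N : Fin (suc n) → Fin l → ℤ) → l ≡ n →
        (∀ u → ∃₂ λ (y : Fin (suc n) → Fin l → ℤ) (s : Fin (suc n) → ℤ) → ∀ w i → ∑ (λ k → N i k * y w k) ≡ δ w i - s w * δ u i) →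
        detℤ (N ⊡ (N ᵀ)) ≡ 0ℤ × ∀ u → adjugate (N ⊡ (N ᵀ)) u u ≡ 1ℤ
      treeFacts N refl walks = tree-singular N , λ u → tree-adjugate N u (proj₁ (walks u)) (proj₁ (proj₂ (walks u))) (proj₂ (proj₂ (walks u)))
      facts : detℤ (Q C) ≡ 0ℤ × ∀ u → adjugate (Q C) u u ≡ 1ℤ
      facts with treeFacts (incidence C) length≡n (λ u → (λ w → W.vector w u) , (λ w → W.endSign w u) , λ w → W.boundary w u)
      ... | det≡0 , adj≡1 = trans (sym toQ) det≡0 , λ u → trans (sym (adjugate-toQ u u)) (adj≡1 u)
    kind e length≡e | Tri.tri≈ _ e≡1+n _ with Fin.all? (λ k → W.endSign (source C k) zero + W.endSign (target C k) zero ℤ.≟ 0ℤ)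
    ... | yes σ≡0 = evenUnicyclic (trans (sym (length-edges C)) (trans length≡e e≡1+n))
      (trans (sym toQ) (singular (source C) (target C) (trans length≡e e≡1+n) σ≡0)) s (λ u → W.endSign² u zero) signs
      where
      s : Fin (suc n) → ℤ
      s w = W.endSign w zero
      singular : ∀ {l} (source target : Fin l → Fin (suc n)) → l ≡ suc n → (∀ k → s (source k) + s (target k) ≡ 0ℤ) →
        let N = λ u k → δ u (source k) + δ u (target k) in detℤ (N ⊡ (N ᵀ)) ≡ 0ℤ
      singular source target refl = signing⇒singular source target s (W.endSign² zero zero)
      signs : ∀ {u v} → adj C u v ≡ true → s u + s v ≡ 0ℤ
      signs {u} {v} uv = begin
        s u + s v
          ≡⟨ sym (cong₂ _+_ (∑-δˡ u s) (∑-δˡ v s)) ⟩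
        ∑ (λ i → δ u i * s i) + ∑ (λ i → δ v i * s i)
          ≡⟨ sym (trans (∑-cong (λ i → ℤ.*-distribʳ-+ (s i) (δ u i) (δ v i))) (∑-distrib-+ (λ i → δ u i * s i) (λ i → δ v i * s i))) ⟩
        ∑ (λ i → (δ u i + δ v i) * s i)
          ≡⟨ ∑-cong (λ i → trans (cong (_* s i) (sym (proj₂ (edgeVector C uv) i))) (*-distribʳ-sum (s i) (λ k → incidence C i k * x k))) ⟩
        ∑ (λ i → ∑ (λ k → incidence C i k * x k * s i))
          ≡⟨ ∑-comm (λ i k → incidence C i k * x k * s i) ⟩
        ∑ (λ k → ∑ (λ i → incidence C i k * x k * s i))
          ≡⟨ ∑-zero _ (λ k → trans (trans (∑-cong (λ i → lemma (incidence C i k) (x k) (s i))) (sym (*-distribˡ-sum (x k) (λ i → incidence C i k * s i))))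
               (trans (cong (x k *_) (trans (signing-column (source C) (target C) s k) (σ≡0 k))) (ℤ.*-zeroʳ (x k)))) ⟩
        0ℤ ∎
        where
        open ≡-Reasoning
        x = proj₁ (edgeVector C uv)
        lemma : ∀ a x s → a * x * s ≡ x * (a * s)
        lemma = solve-∀
    ... | no ¬σ≡0 with Fin.¬∀⟶∃¬ _ _ (λ k → W.endSign (source C k) zero + W.endSign (target C k) zero ℤ.≟ 0ℤ) ¬σ≡0
    ...   | k , σ≢0 = oddUnicyclic (trans (sym (length-edges C)) (trans length≡e e≡1+n))
      (transport (matrix (incidence C) (trans length≡e e≡1+n) (λ w → W.vector w zero) (λ w → W.boundary w zero) (incidence-columnSum C)
        (oddWalkVector (source C) (target C) (λ w → W.vector w zero) s (λ w → W.boundary w zero) (λ w → W.endSign² w zero) k σ≢0)))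
      where
      s : Fin (suc n) → ℤ
      s w = W.endSign w zero
      matrix : ∀ {l} (N : Fin (suc n) → Fin l → ℤ) → l ≡ suc n → (y : Fin (suc n) → Fin l → ℤ) →
        (∀ w i → ∑ (λ k → N i k * y w k) ≡ δ w i - s w * δ zero i) → (∀ k → ∑ (λ i → N i k) ≡ + 2) →
        (∃ λ (c : Fin l → ℤ) → ∀ i → ∑ (λ k → N i k * c k) ≡ + 2 * δ zero i) → OddUnicyclicMatrix (N ⊡ (N ᵀ))
      matrix N refl y walk columnSum (c , odd) = oddUnicyclicMatrix N y s walk (λ w → W.endSign² w zero) columnSum c odd
      transport : OddUnicyclicMatrix L → OddUnicyclicMatrix (Q C)
      transport m = record
        { det≡4 = trans (sym toQ) det≡4
        ; girth = girth
        ; girth-odd = girth-odd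
        ; trace≈ = ≈-trans (≡⇒≈ (∑-cong (λ u → sym (adjugate-toQ u u)))) trace≈
        ; diagonal-odd = λ u → ≈-trans (≡⇒≈ (sym (adjugate-toQ u u))) (diagonal-odd u)
        }
        where open OddUnicyclicMatrix m

  connectedKind : ConnectedKind C
  connectedKind = kind _ refl

-- Along an odd cycle the signs would have to alternate.
oddUnicyclic⇒matrix : ∀ {n} (G : Graph (suc n)) → OddUnicyclic G → OddUnicyclicMatrix (Q G)
oddUnicyclic⇒matrix {n} G ((connected , e≡1+n) , j , k , 3+j≡1+2k , cycle) with connectedKind G connected
... | tree e≡n _ _ = contradiction (trans (sym e≡n) e≡1+n) (ℕ.1+n≢n ∘ sym)
... | oddUnicyclic _ m = m
... | manyEdges n<e = contradiction n<e (ℕ.<-irrefl (sym e≡1+n))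
... | evenUnicyclic _ _ s s² signs = contradiction (trans (sym (s² (vert zero))) (cong (λ x → x * x) s₀≡0)) λ ()
  where
  open Cycle cycle
  s₀ : ℤ
  s₀ = s (vert zero)
  alternate : ∀ i → s (vert i) ≡ sgn (toℕ i) * s₀
  alternate = <-weakInduction (λ i → s (vert i) ≡ sgn (toℕ i) * s₀) (sym (ℤ.*-identityˡ s₀)) λ i ih →
    trans (flip (s (vert (inject₁ i))) (s (vert (suc i))) (signs (step i)))
      (trans (cong -_ ih) (trans (ℤ.neg-distribˡ-* (sgn (toℕ (inject₁ i))) s₀) (cong (_* s₀) (sym (sgn-inject₁ i)))))
    where
    lemma : ∀ a b → b ≡ (a + b) - a
    lemma = solve-∀
    flip : ∀ a b → a + b ≡ 0ℤ → b ≡ - a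
    flip a b h = trans (lemma a b) (trans (cong (_- a) h) (ℤ.+-identityˡ (- a)))
  sgn-even : ∀ k → sgn (2 ℕ.* k) ≡ 1ℤ
  sgn-even zero = refl
  sgn-even (suc k) = trans (cong (λ m → - sgn m) (ℕ.+-suc k (k ℕ.+ 0))) (trans (ℤ.neg-involutive _) (sgn-even k))
  last≡ : s (vert (Fin.fromℕ (2 ℕ.+ j))) ≡ s₀
  last≡ = trans (alternate (Fin.fromℕ (2 ℕ.+ j))) (trans (cong (λ m → sgn m * s₀)
    (trans (Fin.toℕ-fromℕ (2 ℕ.+ j)) (ℕ.suc-injective 3+j≡1+2k))) (trans (cong (_* s₀) (sgn-even k)) (ℤ.*-identityˡ s₀)))
  s₀≡0 : s₀ ≡ 0ℤ
  s₀≡0 = *-cancelˡ (+ 2) s₀ 0ℤ (λ ()) (trans (double s₀) (trans (cong (_+ s₀) (sym last≡)) (signs close)))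
    where
    double : ∀ x → + 2 * x ≡ x + x
    double = solve-∀

-- Components

-2ℤ : ℤ
-2ℤ = -[1+ 1 ]

connected⇒≃K₂ : (C : Graph 2) → Connected C → C ≃ K₂
connected⇒≃K₂ C connected = isomorphism ↔-refl same
  where
  adj₀₁ : adj C zero (suc zero) ≡ true
  adj₀₁ with connected zero (suc zero)
  ... | _∷_ {w = zero} e _ = contradiction (trans (sym (adj-irrefl C zero)) e) λ ()
  ... | _∷_ {w = suc zero} e _ = e
  same : ∀ u v → adj K₂ u v ≡ adj C u v
  same zero zero = sym (adj-irrefl C zero)
  same zero (suc zero) = sym adj₀₁
  same (suc zero) zero = sym (trans (adj-sym C (suc zero) zero) adj₀₁)
  same (suc zero) (suc zero) = sym (adj-irrefl C (suc zero))

opaque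
  unfolding ρ-poly

  ρ-K₂ : ∀ t → ρ K₂ t ≡ t * (t + + 2)
  ρ-K₂ t = trans (sym (eval-ρ-poly K₂ t)) (lemma t)
    where
    lemma : ∀ t → + 0 + t * (+ 2 + t * (+ 1 + t * + 0)) ≡ t * (t + + 2)
    lemma = solve-∀

ρ-shift : ∀ {n} (C : Graph n) c s → ρ C (c + s) ≈ ρ C c + s * trace (adjugate (λ u v → Q C u v + c * δ u v)) [mod s * s ]
ρ-shift C c s = ≈-trans (≡⇒≈ (detℤ-cong λ u v → lemma (Q C u v) c s (δ u v))) (detℤ-shift (λ u v → Q C u v + c * δ u v) s)
  where
  lemma : ∀ q c s d → q + (c + s) * d ≡ (q + c * d) + s * d
  lemma = solve-∀

ρ-zero : ∀ {n} (C : Graph n) → ρ C 0ℤ ≡ detℤ (Q C)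
ρ-zero C = detℤ-cong λ u v → trans (cong (_+_ (Q C u v)) (ℤ.*-zeroˡ (δ u v))) (ℤ.+-identityʳ (Q C u v))

≈-cancel : ∀ n {a b} → + suc n * a ≈ + suc n * b [mod + suc n * + suc n ] → a ≈ b [mod + suc n ]
≈-cancel n {a} {b} (k by e) = k by ℤ.*-cancelˡ-≡ (+ suc n) a (b + + suc n * k) (trans e (lemma (+ suc n) b k))
  where
  lemma : ∀ s b k → s * b + s * s * k ≡ s * (b + s * k)
  lemma = solve-∀

-- The derivative of `(t - c) h` at `c` is `h c`. Dividing the second hypothesis by `s` gives
-- `h (c + s) ≈ T` modulo `s`, while `h (c + s) ≈ h c` modulo `s` for any polynomial; this holds for
-- every positive `s`.
quotient≡derivative : ∀ (f : ℤ → ℤ) c h T → (∀ t → f t ≡ (t - c) * eval h t) → (∀ s → f (c + s) ≈ s * T [mod s * s ]) →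
  eval h c ≡ T
quotient≡derivative f c h T f≡ f≈ = ≈-all⇒≡ λ n → ≈-trans (≈-sym (near n)) (≈-cancel n
  (≈-trans (≡⇒≈ (trans (cong (_* eval h (c + + suc n)) (sym (shift c (+ suc n)))) (sym (f≡ (c + + suc n))))) (f≈ (+ suc n))))
  where
  shift : ∀ c s → (c + s) - c ≡ s
  shift = solve-∀
  near : ∀ n → eval h (c + + suc n) ≈ eval h c [mod + suc n ]
  near n = subst (eval h (c + + suc n) ≈ eval h c [mod_]) (shift c (+ suc n)) (eval-≈ h c (c + + suc n))

module _ {n : ℕ} (C : Graph (suc n)) (diag-odd : ∀ u → Odd (adjugate (Q C) u u)) (root : ρ C -2ℤ ≡ 0ℤ) where
  private
    M : Mat (suc n)
    M u v = Q C u v + -2ℤ * δ u v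

    M≈Q : ∀ u v → M u v ≈ Q C u v [mod + 2 ]
    M≈Q u v = (- δ u v) by lemma (Q C u v) (δ u v)
      where
      lemma : ∀ q d → q + -2ℤ * d ≡ q + + 2 * - d
      lemma = solve-∀

  -- Modulo 2 the matrix `Q - 2` is `Q`, so the oddness of the principal minors carries over from
  -- the eigenvalue 0 to the eigenvalue 2.
  -2-derivative≢0 : trace (adjugate M) ≢ 0ℤ
  -2-derivative≢0 = trace-adjugate≢0 M (λ u v → cong₂ (λ x y → x + -2ℤ * y) (Q-sym C u v) (δ-sym u v)) root
    (λ u → ≈-trans (adjugate-≈ M≈Q u u) (diag-odd u))

  -2-simple : ∀ h → (∀ t → ρ C t ≡ (t + + 2) * eval h t) → eval h -2ℤ ≢ 0ℤ
  -2-simple h ρ≡ h≡0 = -2-derivative≢0 (trans (sym (quotient≡derivative (ρ C) -2ℤ h (trace (adjugate M)) ρ≡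
    (λ s → ≈-trans (ρ-shift C -2ℤ s) (≡⇒≈ (trans (cong (_+ s * trace (adjugate M)) root) (ℤ.+-identityˡ _)))))) h≡0)

divideRoot : ∀ p c → eval p c ≡ 0ℤ → ∃ λ q → ∀ t → eval p t ≡ (t - c) * eval q t
divideRoot p c root = proj₁ (divide p c) , λ t → trans (proj₂ (divide p c) t)
  (trans (cong (_+ (t - c) * eval (proj₁ (divide p c)) t) root) (ℤ.+-identityˡ _))

module _ {n : ℕ} (C : Graph n) where
  -- The suffix tells whether 2 is an eigenvalue. The trace is twice the number of edges, so the
  -- trace equations compare edges plus factors `t` with the order: equal for trees and odd
  -- unicyclic graphs, larger by `suc k` for `excess`, that is, for even unicyclic graphs and those
  -- with more edges than vertices.
  data Component : Set where
    tree₀ : (q : Poly) → (∀ t → ρ C t ≡ t * eval q t) → eval q 0ℤ ≡ + n → eval q -2ℤ ≢ 0ℤ →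
      trace (Q C) + + 2 ≡ + 2 * + n → Component
    tree₂ : (m : ℕ) (q : Poly) → + n ≡ + 2 * + m → (∀ t → ρ C t ≡ t * ((t + + 2) * eval q t)) → eval q 0ℤ ≡ + m →
      eval q -2ℤ ≢ 0ℤ → trace (Q C) + + 2 ≡ + 2 * + n → Component
    unicyclic₀ : ρ C 0ℤ ≡ + 4 → ρ C -2ℤ ≢ 0ℤ → trace (Q C) ≡ + 2 * + n → Component
    unicyclic₂ : (j : ℤ) (q : Poly) (o : ℤ) → + n ≡ + 2 * j → (∀ t → ρ C t ≡ (t + + 2) * eval q t) → eval q 0ℤ ≡ + 2 →
      eval q -2ℤ ≢ 0ℤ → eval q -[1+ 3 ] ≡ -2ℤ * o → o ≈ 1ℤ - + 2 * j [mod + 4 ] → trace (Q C) ≡ + 2 * + n → Component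
    excess : (τ : ℕ) (q : Poly) (k : ℕ) → (∀ t → ρ C t ≡ t ℤ.^ τ * eval q t) →
      trace (Q C) + + 2 * + τ ≡ + 2 * + n + + 2 * + suc k → Component

module _ {n : ℕ} (C : Graph (suc n)) where
  private
    open ≡-Reasoning

    P : Poly
    P = ρ-poly C

    ρ≡P : ∀ t → ρ C t ≡ eval P t
    ρ≡P t = sym (eval-ρ-poly C t)

    traceOf : ∀ {e} → edgeCount C ≡ e → trace (Q C) ≡ + 2 * + e
    traceOf refl = trace-Q C

  treeComponent : edgeCount C ≡ n → detℤ (Q C) ≡ 0ℤ → (∀ u → adjugate (Q C) u u ≡ 1ℤ) → Component C
  treeComponent e≡n det≡0 adj≡1 = cases (eval q -2ℤ ℤ.≟ 0ℤ)
    where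
    P₀≡0 : eval P 0ℤ ≡ 0ℤ
    P₀≡0 = trans (sym (ρ≡P 0ℤ)) (trans (ρ-zero C) det≡0)
    q : Poly
    q = proj₁ (divideRoot P 0ℤ P₀≡0)
    P≡tq : ∀ t → ρ C t ≡ (t - 0ℤ) * eval q t
    P≡tq t = trans (ρ≡P t) (proj₂ (divideRoot P 0ℤ P₀≡0) t)
    ρ≡tq : ∀ t → ρ C t ≡ t * eval q t
    ρ≡tq t = trans (P≡tq t) (cong (_* eval q t) (ℤ.+-identityʳ t))
    trace≡ : trace (Q C) + + 2 ≡ + 2 * + suc n
    trace≡ = trans (cong (_+ + 2) (traceOf e≡n)) (lemma (+ n))
      where
      lemma : ∀ x → + 2 * x + + 2 ≡ + 2 * (1ℤ + x)
      lemma = solve-∀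
    ones : ∀ m → ∑ {m} (λ _ → 1ℤ) ≡ + m
    ones zero = refl
    ones (suc m) = cong (_+_ 1ℤ) (ones m)
    adjugate₀ : ∀ u → adjugate (λ i j → Q C i j + 0ℤ * δ i j) u u ≡ 1ℤ
    adjugate₀ u = trans (adjugate-cong (λ i j → trans (cong (_+_ (Q C i j)) (ℤ.*-zeroˡ (δ i j))) (ℤ.+-identityʳ (Q C i j))) u u) (adj≡1 u)
    -- The derivative at 0 is the sum of the `suc n` principal minors, each of them 1.
    q₀≡n : eval q 0ℤ ≡ + suc n
    q₀≡n = quotient≡derivative (ρ C) 0ℤ q (+ suc n) P≡tq λ s → ≈-trans (ρ-shift C 0ℤ s)
      (≡⇒≈ (trans (cong₂ (λ x y → x + s * y) (trans (ρ-zero C) det≡0) (trans (∑-cong adjugate₀) (ones (suc n)))) (ℤ.+-identityˡ _)))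
    cases : Dec (eval q -2ℤ ≡ 0ℤ) → Component C
    cases (no q≢0) = tree₀ q ρ≡tq q₀≡n q≢0 trace≡
    cases (yes q≡0) = tree₂ (proj₁ m) r (trans n≡2r₀ (cong (+ 2 *_) (proj₂ m)))
      (λ t → trans (ρ≡tq t) (cong (t *_) (proj₂ (divideRoot q -2ℤ q≡0) t))) (proj₂ m) r≢0 trace≡
      where
      r : Poly
      r = proj₁ (divideRoot q -2ℤ q≡0)
      -- At 0 the factor `t + 2` is 2. This is why a tree with eigenvalue 2 has even order.
      n≡2r₀ : + suc n ≡ + 2 * eval r 0ℤ
      n≡2r₀ = trans (sym q₀≡n) (proj₂ (divideRoot q -2ℤ q≡0) 0ℤ)
      nonneg : ∀ x → + suc n ≡ + 2 * x → ∃ λ m → x ≡ + m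
      nonneg (+ m) _ = m , refl
      nonneg -[1+ m ] ()
      m : ∃ λ m → eval r 0ℤ ≡ + m
      m = nonneg (eval r 0ℤ) n≡2r₀
      rearrange : ∀ t x → t * (t + + 2) * x ≡ (t + + 2) * (0ℤ + t * x)
      rearrange = solve-∀
      -- Otherwise - 2 would be a double root of `ρ`; the factor `t` is absorbed into the quotient
      -- as `0ℤ ∷ r`.
      r≢0 : eval r -2ℤ ≢ 0ℤ
      r≢0 r≡0 = -2-simple C (λ u → ≡⇒≈ (adj≡1 u)) (trans (ρ≡tq -2ℤ) (trans (cong (-2ℤ *_) q≡0) (ℤ.*-zeroʳ -2ℤ))) (0ℤ ∷ r)
        (λ t → trans (ρ≡tq t) (trans (cong (t *_) (proj₂ (divideRoot q -2ℤ q≡0) t))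
          (trans (sym (ℤ.*-assoc t (t + + 2) (eval r t))) (rearrange t (eval r t)))))
        (trans (cong (λ x → 0ℤ + -2ℤ * x) r≡0) refl)

  module _ (m : OddUnicyclicMatrix (Q C)) where
    open OddUnicyclicMatrix m

    -- The value at - 4 modulo 16 sees the linear coefficient of ρ modulo 4.
    ρ[-4] : ρ C -[1+ 3 ] ≈ + 4 * (1ℤ - + suc n * girth) [mod + 16 ]
    ρ[-4] = ≈-trans (ρ-shift C 0ℤ -[1+ 3 ]) (≈-trans
      (≡⇒≈ (cong₂ (λ x y → x + -[1+ 3 ] * y) (trans (ρ-zero C) det≡4) (∑-cong λ u →
        adjugate-cong (λ i j → trans (cong (_+_ (Q C i j)) (ℤ.*-zeroˡ (δ i j))) (ℤ.+-identityʳ (Q C i j))) u u)))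
      (≈-trans (step trace≈) (≡⇒≈ (lemma (+ suc n * girth)))))
      where
      lemma : ∀ x → + 4 + -[1+ 3 ] * x ≡ + 4 * (1ℤ - x)
      lemma = solve-∀
      step : ∀ {a b} → a ≈ b [mod + 4 ] → + 4 + -[1+ 3 ] * a ≈ + 4 + -[1+ 3 ] * b [mod + 16 ]
      step {b = b} (k by refl) = (- k) by expand b k
        where
        expand : ∀ b k → + 4 + -[1+ 3 ] * (b + + 4 * k) ≡ (+ 4 + -[1+ 3 ] * b) + + 16 * - k
        expand = solve-∀

    unicyclicComponent : edgeCount C ≡ suc n → Component C
    unicyclicComponent e≡1+n = cases (ρ C -2ℤ ℤ.≟ 0ℤ)
      where
      cases : Dec (ρ C -2ℤ ≡ 0ℤ) → Component C
      cases (no root) = unicyclic₀ (trans (ρ-zero C) det≡4) root (traceOf e≡1+n)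
      cases (yes root) = build (eval-≈ q 0ℤ -[1+ 3 ]) ρ[-4] girth-odd
        where
        P≡0 : eval P -2ℤ ≡ 0ℤ
        P≡0 = trans (sym (ρ≡P -2ℤ)) root
        q : Poly
        q = proj₁ (divideRoot P -2ℤ P≡0)
        ρ≡ : ∀ t → ρ C t ≡ (t + + 2) * eval q t
        ρ≡ t = trans (ρ≡P t) (proj₂ (divideRoot P -2ℤ P≡0) t)
        q₀≡2 : eval q 0ℤ ≡ + 2
        q₀≡2 = *-cancelˡ (+ 2) (eval q 0ℤ) (+ 2) (λ ()) (trans (sym (ρ≡ 0ℤ)) (trans (ρ-zero C) det≡4))
        -- With q (- 4) = 2 - 4 k and ρ (- 4) = - 2 * q (- 4) one reads off that n * girth is even.
        build : eval q -[1+ 3 ] ≈ eval q 0ℤ [mod -[1+ 3 ] - 0ℤ ] → ρ C -[1+ 3 ] ≈ + 4 * (1ℤ - + suc n * girth) [mod + 16 ] →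
          Odd girth → Component C
        build (k by q₄≡) (l by ρ₄≡) (h by girth≡) = unicyclic₂ j q o n≡2j ρ≡ q₀≡2 (-2-simple C diagonal-odd root q ρ≡) q₄≡-2o o≈ (traceOf e≡1+n)
          where
          N : ℤ
          N = + suc n
          -- `o` is `ρ (- 4) / 4`, hence `q (- 4) / (- 2)`; `j` is half of the order, obtained by
          -- comparing this with `q (- 4) = 2 - 4 k`.
          o j : ℤ
          o = 1ℤ - N * girth + + 4 * l
          j = 1ℤ - k + + 2 * l - N * h
          ρ₄≡′ : -2ℤ * eval q -[1+ 3 ] ≡ + 4 * (1ℤ - N * girth) + + 16 * l
          ρ₄≡′ = trans (sym (ρ≡ -[1+ 3 ])) ρ₄≡
          q₄≡-2o : eval q -[1+ 3 ] ≡ -2ℤ * o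
          q₄≡-2o = *-cancelˡ -2ℤ _ _ (λ ()) (trans ρ₄≡′ (lemma (N * girth) l))
            where
            lemma : ∀ x l → + 4 * (1ℤ - x) + + 16 * l ≡ -2ℤ * (-2ℤ * (1ℤ - x + + 4 * l))
            lemma = solve-∀
          -2o≡2-4k : -2ℤ * o ≡ + 2 + -[1+ 3 ] * k
          -2o≡2-4k = trans (sym q₄≡-2o) (trans q₄≡ (cong (_+ -[1+ 3 ] * k) q₀≡2))
          n≡2j : N ≡ + 2 * j
          n≡2j = *-cancelˡ (+ 2) N (+ 2 * j) (λ ()) (begin
            + 2 * N
              ≡⟨ lemma₁ N h l ⟩
            + 2 + -2ℤ * (1ℤ - (N * (1ℤ + + 2 * h)) + + 4 * l) + + 8 * l - + 4 * (N * h) - 0ℤ + 0ℤ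
              ≡⟨ cong (λ g → + 2 + -2ℤ * (1ℤ - (N * g) + + 4 * l) + + 8 * l - + 4 * (N * h) - 0ℤ + 0ℤ) (sym girth≡) ⟩
            + 2 + -2ℤ * o + + 8 * l - + 4 * (N * h) - 0ℤ + 0ℤ
              ≡⟨ cong (λ x → + 2 + x + + 8 * l - + 4 * (N * h) - 0ℤ + 0ℤ) -2o≡2-4k ⟩
            + 2 + (+ 2 + -[1+ 3 ] * k) + + 8 * l - + 4 * (N * h) - 0ℤ + 0ℤ
              ≡⟨ lemma₂ N h k l ⟩
            + 2 * (+ 2 * j) ∎)
            where
            lemma₁ : ∀ N h l → + 2 * N ≡ + 2 + -2ℤ * (1ℤ - (N * (1ℤ + + 2 * h)) + + 4 * l) + + 8 * l - + 4 * (N * h) - 0ℤ + 0ℤ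
            lemma₁ = solve-∀
            lemma₂ : ∀ N h k l → + 2 + (+ 2 + -[1+ 3 ] * k) + + 8 * l - + 4 * (N * h) - 0ℤ + 0ℤ ≡
              + 2 * (+ 2 * (1ℤ - k + + 2 * l - N * h))
            lemma₂ = solve-∀
          o≈ : o ≈ 1ℤ - + 2 * j [mod + 4 ]
          o≈ = (l - j * h) by trans (cong₂ (λ x g → 1ℤ - x * g + + 4 * l) n≡2j girth≡) (lemma j h l)
            where
            lemma : ∀ j h l → 1ℤ - (+ 2 * j) * (1ℤ + + 2 * h) + + 4 * l ≡ (1ℤ - + 2 * j) + + 4 * (l - j * h)
            lemma = solve-∀

  excessComponent : suc n ℕ.< edgeCount C → Component C
  excessComponent n<e with ℕ.m≤n⇒∃[o]m+o≡n n<e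
  ... | k , e≡ = excess 0 P k (λ t → trans (ρ≡P t) (sym (ℤ.*-identityˡ (eval P t))))
    (trans (cong (_+ + 0) (traceOf (sym e≡))) (trans (ℤ.+-identityʳ _) (trans (cong (+ 2 *_) split) (ℤ.*-distribˡ-+ (+ 2) (+ suc n) (+ suc k)))))
    where
    split : + (suc (suc n) ℕ.+ k) ≡ + suc n + + suc k
    split = cong +_ (sym (ℕ.+-suc (suc n) k))

  evenUnicyclicComponent : edgeCount C ≡ suc n → detℤ (Q C) ≡ 0ℤ → Component C
  evenUnicyclicComponent e≡1+n det≡0 = excess 1 (proj₁ (divideRoot P 0ℤ P₀≡0)) 0
    (λ t → trans (ρ≡P t) (trans (proj₂ (divideRoot P 0ℤ P₀≡0) t)
      (cong (_* eval (proj₁ (divideRoot P 0ℤ P₀≡0)) t) (trans (ℤ.+-identityʳ t) (sym (ℤ.*-identityʳ t))))))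
    (cong (_+ + 2) (traceOf e≡1+n))
    where
    P₀≡0 : eval P 0ℤ ≡ 0ℤ
    P₀≡0 = trans (sym (ρ≡P 0ℤ)) (trans (ρ-zero C) det≡0)

  component : Connected C → Component C
  component connected with connectedKind C connected
  ... | tree e≡n det≡0 adj≡1 = treeComponent e≡n det≡0 adj≡1
  ... | oddUnicyclic e≡1+n m = unicyclicComponent m e≡1+n
  ... | evenUnicyclic e≡1+n det≡0 _ _ _ = evenUnicyclicComponent e≡1+n det≡0
  ... | manyEdges n<e = excessComponent n<e

-- Decomposition into connected components

_++ʷ_ : ∀ {n} {G : Graph n} {u v w} → Walk G u v → Walk G v w → Walk G u w
[] ++ʷ q = q
(e ∷ p) ++ʷ q = e ∷ (p ++ʷ q)

reverseʷ : ∀ {n} {G : Graph n} {u v} → Walk G u v → Walk G v u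
reverseʷ [] = []
reverseʷ {G = G} (_∷_ {u} {w} e p) = reverseʷ p ++ʷ (trans (adj-sym G w u) e ∷ [])

record Partition {n} (P : Fin n → Set) : Set where
  field
    {sizeˡ sizeʳ} : ℕ
    left : Fin sizeˡ → Fin n
    right : Fin sizeʳ → Fin n
    split : Fin n → Fin sizeˡ ⊎ Fin sizeʳ
    left-P : ∀ i → P (left i)
    right-P : ∀ i → ¬ P (right i)
    split-left : ∀ i → split (left i) ≡ inj₁ i
    split-right : ∀ i → split (right i) ≡ inj₂ i
    unsplit : ∀ u → [ left , right ]′ (split u) ≡ u

onZeroSuc : ∀ {n} {A : Set} → A → (Fin n → A) → Fin (suc n) → A
onZeroSuc x f zero = x
onZeroSuc x f (suc i) = f i

partition : ∀ {n} (P : Fin n → Set) → (∀ u → Dec (P u)) → Partition P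
partition {zero} P P? = record
  { sizeˡ = 0 ; sizeʳ = 0 ; left = λ () ; right = λ () ; split = λ ()
  ; left-P = λ () ; right-P = λ () ; split-left = λ () ; split-right = λ () ; unsplit = λ () }
partition {suc n} P P? with P? zero | partition (P ∘ suc) (P? ∘ suc)
... | yes p | rest = record
  { left = onZeroSuc zero (suc ∘ left)
  ; right = suc ∘ right
  ; split = λ { zero → inj₁ zero ; (suc u) → [ (λ i → inj₁ (suc i)) , inj₂ ]′ (split u) }
  ; left-P = λ { zero → p ; (suc i) → left-P i }
  ; right-P = right-P
  ; split-left = λ { zero → refl ; (suc i) → cong [ inj₁ ∘ suc , inj₂ ]′ (split-left i) }
  ; split-right = λ i → cong [ inj₁ ∘ suc , inj₂ ]′ (split-right i)
  ; unsplit = λ { zero → refl ; (suc u) → lemma (split u) (unsplit u) }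
  }
  where
  open Partition rest
  lemma : ∀ x {u} → [ left , right ]′ x ≡ u →
    [ onZeroSuc zero (suc ∘ left) , suc ∘ right ]′ ([ inj₁ ∘ suc , inj₂ ]′ x) ≡ suc u
  lemma (inj₁ i) e = cong suc e
  lemma (inj₂ i) e = cong suc e
... | no ¬p | rest = record
  { left = suc ∘ left
  ; right = onZeroSuc zero (suc ∘ right)
  ; split = λ { zero → inj₂ zero ; (suc u) → [ inj₁ , inj₂ ∘ suc ]′ (split u) }
  ; left-P = left-P
  ; right-P = λ { zero → ¬p ; (suc i) → right-P i }
  ; split-left = λ i → cong [ inj₁ , inj₂ ∘ suc ]′ (split-left i)
  ; split-right = λ { zero → refl ; (suc i) → cong [ inj₁ , inj₂ ∘ suc ]′ (split-right i) }
  ; unsplit = λ { zero → refl ; (suc u) → lemma (split u) (unsplit u) }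
  }
  where
  open Partition rest
  lemma : ∀ x {u} → [ left , right ]′ x ≡ u →
    [ suc ∘ left , onZeroSuc zero (suc ∘ right) ]′ ([ inj₁ , inj₂ ∘ suc ]′ x) ≡ suc u
  lemma (inj₁ i) e = cong suc e
  lemma (inj₂ i) e = cong suc e

induced : ∀ {n m} → Graph n → (Fin m → Fin n) → Graph m
induced G f = record
  { adj = λ u v → adj G (f u) (f v)
  ; adj-sym = λ u v → adj-sym G (f u) (f v)
  ; adj-irrefl = λ u → adj-irrefl G (f u)
  }

module _ {n : ℕ} (H : Graph (suc n)) where
  record ComponentSet : Set where
    field
      members : Subset (suc n)
      root∈ : zero ∈ members
      walkToRoot : ∀ {u} → u ∈ members → Walk H u zero
      closed : ∀ {u v} → u ∈ members → adj H u v ≡ true → v ∈ members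

  componentSet : ComponentSet
  componentSet = grow ⁅ zero ⁆ (⊃-wellFounded _) (x∈⁅x⁆ zero)
    (λ {u} u∈ → subst (λ w → Walk H w zero) (sym (x∈⁅y⁆⇒x≡y zero u∈)) [])
    where
    -- An edge leaving `S` supplies a further vertex joined to the root, so `S` grows strictly
    -- inside a finite set; when no edge leaves, `S` is closed.
    grow : ∀ S → Acc _⊃_ S → zero ∈ S → (∀ {u} → u ∈ S → Walk H u zero) → ComponentSet
    grow S (acc rs) 0∈ walk with Fin.any? (λ u → Fin.any? (λ v → (u ∈? S) ×-dec (¬? (v ∈? S) ×-dec (adj H u v Bool.≟ true))))
    ... | yes (u , v , u∈ , v∉ , uv) = grow (S ∪ ⁅ v ⁆) (rs ((p⊆p∪q ⁅ v ⁆) , v , q⊆p∪q S ⁅ v ⁆ (x∈⁅x⁆ v) , v∉)) (p⊆p∪q ⁅ v ⁆ 0∈) walk′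
      where
      walk′ : ∀ {w} → w ∈ S ∪ ⁅ v ⁆ → Walk H w zero
      walk′ {w} w∈ with x∈p∪q⁻ S ⁅ v ⁆ w∈
      ... | inj₁ w∈S = walk w∈S
      ... | inj₂ w∈v = subst (λ x → Walk H x zero) (sym (x∈⁅y⁆⇒x≡y v w∈v)) (trans (adj-sym H v u) uv ∷ walk u∈)
    ... | no none = record
      { members = S
      ; root∈ = 0∈
      ; walkToRoot = walk
      ; closed = λ {u} {v} u∈ uv → decidable-stable (v ∈? S) (λ v∉ → none (u , v , u∈ , v∉ , uv))
      }

  module SplitOff (S : ComponentSet) (parts : Partition (_∈ ComponentSet.members S)) where
    open ComponentSet S
    open Partition parts

    side : ∀ u → u ∈ members → ∃ λ i → split u ≡ inj₁ i × left i ≡ u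
    side u u∈ with split u | unsplit u
    ... | inj₁ i | e = i , refl , e
    ... | inj₂ i | refl = contradiction u∈ (right-P i)

    restrict : ∀ {u v} → Walk H u v → ∀ i j → left i ≡ u → left j ≡ v → Walk (induced H left) i j
    restrict [] i j li lj with refl ← trans (sym (split-left i)) (trans (cong split (trans li (sym lj))) (split-left j)) = []
    restrict (_∷_ {w = w} e walk) i j refl lj with side w (closed (left-P i) e)
    ... | i′ , _ , li′ = trans (cong (adj H (left i)) li′) e ∷ restrict walk i′ j li′ lj

    component-connected : Connected (induced H left)
    component-connected i j = restrict (walkToRoot (left-P i) ++ʷ reverseʷ (walkToRoot (left-P j))) i j refl refl

    entries : ∀ u v → sumAdj (adj (induced H left)) (adj (induced H right)) (split u) (split v) ≡ adj H u v
    entries u v with split u | unsplit u | split v | unsplit v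
    ... | inj₁ i | refl | inj₁ j | refl = refl
    ... | inj₂ i | refl | inj₂ j | refl = refl
    ... | inj₁ i | refl | inj₂ j | refl = sym (Bool.¬-not λ e → right-P j (closed (left-P i) e))
    ... | inj₂ i | refl | inj₁ j | refl = sym (Bool.¬-not λ e → right-P i (closed (left-P j) (trans (adj-sym H (left j) (right i)) e)))

    private
      join : Fin sizeˡ ⊎ Fin sizeʳ → Fin (sizeˡ ℕ.+ sizeʳ)
      join = Fin.join sizeˡ sizeʳ

      sides : Fin sizeˡ ⊎ Fin sizeʳ → Fin (suc n)
      sides = [ left , right ]′

      split-sides : ∀ x → split (sides x) ≡ x
      split-sides (inj₁ i) = split-left i
      split-sides (inj₂ i) = split-right i

      bijection : Fin (suc n) ↔ Fin (sizeˡ ℕ.+ sizeʳ)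
      bijection = mk↔ₛ′ (λ u → join (split u)) (λ x → sides (splitAt sizeˡ x))
        (λ x → trans (cong join (split-sides (splitAt sizeˡ x))) (Fin.join-splitAt sizeˡ sizeʳ x))
        (λ u → trans (cong sides (Fin.splitAt-join sizeˡ sizeʳ (split u))) (unsplit u))

    iso : H ≃ induced H left ⊔ induced H right
    iso = isomorphism bijection λ u v → trans (adj-⊔ (induced H left) (induced H right) (join (split u)) (join (split v)))
      (trans (cong₂ (sumAdj (adj (induced H left)) (adj (induced H right))) (Fin.splitAt-join sizeˡ sizeʳ (split u)) (Fin.splitAt-join sizeˡ sizeʳ (split v)))
        (entries u v))

    splitOff : ∃₂ λ k l → Σ (Graph (suc k)) λ C → Σ (Graph l) λ R → Connected C × H ≃ C ⊔ R
    splitOff = nonempty sizeˡ left component-connected iso (proj₁ (side zero root∈))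
      where
      nonempty : ∀ a (left : Fin a → Fin (suc n)) → Connected (induced H left) → H ≃ induced H left ⊔ induced H right → Fin a →
        ∃₂ λ k l → Σ (Graph (suc k)) λ C → Σ (Graph l) λ R → Connected C × H ≃ C ⊔ R
      nonempty (suc k) left c e _ = k , sizeʳ , induced H left , induced H right , c , e

  splitComponent : ∃₂ λ k l → Σ (Graph (suc k)) λ C → Σ (Graph l) λ R → Connected C × H ≃ C ⊔ R
  splitComponent = SplitOff.splitOff componentSet (partition _ (_∈? ComponentSet.members componentSet))

data Components : ∀ {m} → Graph m → Set where
  none : (H : Graph 0) → Components H
  cons : ∀ {k l m} {H : Graph m} (C : Graph (suc k)) (R : Graph l) → Connected C → H ≃ C ⊔ R → Components R → Components H

components : ∀ {m} (H : Graph m) → Components H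
components {m} H = go H (<-wellFounded m)
  where
  go : ∀ {m} (H : Graph m) → Acc ℕ._<_ m → Components H
  go {zero} H _ = none H
  go {suc m} H (acc rs) = rest (splitComponent H)
    where
    rest : (∃₂ λ k l → Σ (Graph (suc k)) λ C → Σ (Graph l) λ R → Connected C × H ≃ C ⊔ R) → Components H
    rest (k , l , C , R , connected , iso) = cons C R connected iso
      (go R (rs (subst (l ℕ.<_) (sym (≃⇒order≡ iso)) (s≤s (ℕ.m≤n+m l k)))))

-- Disjoint unions up to isomorphism

-- A graph carried to an arbitrary vertex type. Unions can then be rearranged on sum types, without
-- arithmetic on positions in `Fin`.
record Represents {n} (G : Graph n) (X : Set) (e : X → X → Bool) : Set where
  constructor represents
  field
    vertices : Fin n ↔ X
    edges-agree : ∀ u v → e (Inverse.to vertices u) (Inverse.to vertices v) ≡ adj G u v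

represents-self : ∀ {n} (G : Graph n) → Represents G (Fin n) (adj G)
represents-self G = represents ↔-refl λ _ _ → refl

≃⇒represents : ∀ {n m} {G : Graph n} {H : Graph m} → G ≃ H → Represents G (Fin m) (adj H)
≃⇒represents (isomorphism f h) = represents f h

represents⇒≃ : ∀ {n m X Y} {e : X → X → Bool} {e′ : Y → Y → Bool} {G : Graph n} {H : Graph m} →
  Represents G X e → Represents H Y e′ → (g : X ↔ Y) → (∀ x y → e′ (Inverse.to g x) (Inverse.to g y) ≡ e x y) → G ≃ H
represents⇒≃ {e′ = e′} (represents f hf) (represents k hk) g hg = isomorphism (↔-trans f (↔-trans g (↔-sym k))) λ u v →
  trans (sym (hk _ _)) (trans (cong₂ e′ (Inverse.strictlyInverseˡ k _) (Inverse.strictlyInverseˡ k _))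
    (trans (hg (Inverse.to f u) (Inverse.to f v)) (hf u v)))

represents-⊔ : ∀ {n m X Y} {e : X → X → Bool} {e′ : Y → Y → Bool} (G : Graph n) (H : Graph m) →
  Represents G X e → Represents H Y e′ → Represents (G ⊔ H) (X ⊎ Y) (sumAdj e e′)
represents-⊔ {n} {m} {e = e} {e′} G H (represents f hf) (represents k hk) = represents (↔-trans Fin.+↔⊎ (f ⊎-↔ k)) λ u v →
  trans (entry (splitAt n u) (splitAt n v)) (sym (adj-⊔ G H u v))
  where
  entry : ∀ x y → sumAdj e e′ (Inverse.to (f ⊎-↔ k) x) (Inverse.to (f ⊎-↔ k) y) ≡ sumAdj (adj G) (adj H) x y
  entry (inj₁ u) (inj₁ v) = hf u v
  entry (inj₂ u) (inj₂ v) = hk u v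
  entry (inj₁ u) (inj₂ v) = refl
  entry (inj₂ u) (inj₁ v) = refl

⊔-cong : ∀ {n n′ m m′} {G : Graph n} {G′ : Graph n′} {H : Graph m} {H′ : Graph m′} → G ≃ G′ → H ≃ H′ → G ⊔ H ≃ G′ ⊔ H′
⊔-cong {G = G} {G′} {H} {H′} g h = represents⇒≃
  (represents-⊔ G H (≃⇒represents g) (≃⇒represents h)) (represents-⊔ G′ H′ (represents-self G′) (represents-self H′)) ↔-refl (λ _ _ → refl)

-- Used to move the unicyclic component in front of the copies of `K₂` found before it.
⊔-leftComm : ∀ {a b c} (A : Graph a) (B : Graph b) (C : Graph c) → A ⊔ (B ⊔ C) ≃ B ⊔ (A ⊔ C)
⊔-leftComm A B C = represents⇒≃
  (represents-⊔ A (B ⊔ C) (represents-self A) (represents-⊔ B C (represents-self B) (represents-self C)))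
  (represents-⊔ B (A ⊔ C) (represents-self B) (represents-⊔ A C (represents-self A) (represents-self C)))
  (mk↔ₛ′ swap swap swap-swap swap-swap) entry
  where
  swap : ∀ {X Y Z : Set} → X ⊎ (Y ⊎ Z) → Y ⊎ (X ⊎ Z)
  swap (inj₁ x) = inj₂ (inj₁ x)
  swap (inj₂ (inj₁ y)) = inj₁ y
  swap (inj₂ (inj₂ z)) = inj₂ (inj₂ z)
  swap-swap : ∀ {X Y Z : Set} (x : X ⊎ (Y ⊎ Z)) → swap (swap x) ≡ x
  swap-swap (inj₁ x) = refl
  swap-swap (inj₂ (inj₁ y)) = refl
  swap-swap (inj₂ (inj₂ z)) = refl
  entry : ∀ x y → sumAdj (adj B) (sumAdj (adj A) (adj C)) (swap x) (swap y) ≡ sumAdj (adj A) (sumAdj (adj B) (adj C)) x y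
  entry (inj₁ _) (inj₁ _) = refl
  entry (inj₁ _) (inj₂ (inj₁ _)) = refl
  entry (inj₁ _) (inj₂ (inj₂ _)) = refl
  entry (inj₂ (inj₁ _)) (inj₁ _) = refl
  entry (inj₂ (inj₁ _)) (inj₂ (inj₁ _)) = refl
  entry (inj₂ (inj₁ _)) (inj₂ (inj₂ _)) = refl
  entry (inj₂ (inj₂ _)) (inj₁ _) = refl
  entry (inj₂ (inj₂ _)) (inj₂ (inj₁ _)) = refl
  entry (inj₂ (inj₂ _)) (inj₂ (inj₂ _)) = refl

-- Disjoint copies of `K₂`

ρ-rK₂ : ∀ r t → ρ (rK₂ r) t ≡ t ℤ.^ r * (t + + 2) ℤ.^ r
ρ-rK₂ zero t = detℤ-zero (λ u v → Q empty u v + t * δ u v)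
ρ-rK₂ (suc r) t = trans (ρ-⊔ K₂ (rK₂ r) t) (trans (cong₂ _*_ (ρ-K₂ t) (ρ-rK₂ r t))
  (lemma t (t + + 2) (t ℤ.^ r) ((t + + 2) ℤ.^ r)))
  where
  lemma : ∀ t u a b → (t * u) * (a * b) ≡ (t * a) * (u * b)
  lemma = solve-∀

trace-rK₂ : ∀ r → trace (Q (rK₂ r)) ≡ + 2 * + r
trace-rK₂ zero = refl
trace-rK₂ (suc r) = trans (trace-⊔ K₂ (rK₂ r)) (trans (cong₂ _+_ (trace-Q K₂) (trace-rK₂ r)) (lemma (+ r)))
  where
  lemma : ∀ x → + 2 * + 1 + + 2 * x ≡ + 2 * (1ℤ + x)
  lemma = solve-∀

-- Powers of a linear factor

timesPower : ℤ → ℕ → Poly → Poly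
timesPower c zero p = p
timesPower c (suc a) p = ((- c) ∷ 1ℤ ∷ []) ⊗ timesPower c a p

eval-timesPower : ∀ c a p t → eval (timesPower c a p) t ≡ (t - c) ℤ.^ a * eval p t
eval-timesPower c zero p t = sym (ℤ.*-identityˡ (eval p t))
eval-timesPower c (suc a) p t = trans (eval-⊗ ((- c) ∷ 1ℤ ∷ []) (timesPower c a p) t)
  (trans (cong (eval ((- c) ∷ 1ℤ ∷ []) t *_) (eval-timesPower c a p t)) (lemma c t ((t - c) ℤ.^ a) (eval p t)))
  where
  lemma : ∀ c t x y → (- c + t * (1ℤ + t * 0ℤ)) * (x * y) ≡ (t - c) * x * y
  lemma = solve-∀

cancelFactor : ∀ c a b p q → (∀ t → (t - c) ℤ.^ suc a * eval p t ≡ (t - c) ℤ.^ suc b * eval q t) →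
  ∀ t → (t - c) ℤ.^ a * eval p t ≡ (t - c) ℤ.^ b * eval q t
cancelFactor c a b p q h t = trans (sym (eval-timesPower c a p t)) (trans
  (eval-cancel c (timesPower c a p) (timesPower c b q) (λ s → trans (peel a p s) (trans (h s) (sym (peel b q s)))) t)
  (eval-timesPower c b q t))
  where
  peel : ∀ a p s → (s - c) * eval (timesPower c a p) s ≡ (s - c) ℤ.^ suc a * eval p s
  peel a p s = trans (cong ((s - c) *_) (eval-timesPower c a p s)) (sym (ℤ.*-assoc (s - c) ((s - c) ℤ.^ a) (eval p s)))

cancelPower : ∀ c a p q → (∀ t → (t - c) ℤ.^ a * eval p t ≡ (t - c) ℤ.^ a * eval q t) → ∀ t → eval p t ≡ eval q t
cancelPower c zero p q h t = trans (sym (ℤ.*-identityˡ (eval p t))) (trans (h t) (ℤ.*-identityˡ (eval q t)))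
cancelPower c (suc a) p q h = cancelPower c a p q (cancelFactor c a a p q h)

-- As `p` does not vanish at `c`, the left side has a zero of order exactly `a` there, and the right
-- side one of order at least `b`.
comparePowers : ∀ c a b p q → eval p c ≢ 0ℤ → (∀ t → (t - c) ℤ.^ a * eval p t ≡ (t - c) ℤ.^ b * eval q t) →
  ∃ λ k → a ≡ b ℕ.+ k × ∀ t → (t - c) ℤ.^ k * eval p t ≡ eval q t
comparePowers c a zero p q p≢0 h = a , refl , λ t → trans (h t) (ℤ.*-identityˡ (eval q t))
comparePowers c zero (suc b) p q p≢0 h = contradiction (trans (sym (ℤ.*-identityˡ (eval p c))) (trans (h c)
  (trans (cong (λ x → x * (c - c) ℤ.^ b * eval q c) (ℤ.+-inverseʳ c)) (lemma ((c - c) ℤ.^ b) (eval q c))))) p≢0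
  where
  lemma : ∀ x y → 0ℤ * x * y ≡ 0ℤ
  lemma = solve-∀
comparePowers c (suc a) (suc b) p q p≢0 h with comparePowers c a b p q p≢0 (cancelFactor c a b p q h)
... | k , a≡b+k , e = k , cong suc a≡b+k , e

-- Invariants of a disjoint union of components

-- The trace being twice the number of edges, `k` is the excess of edges plus factors `t` over the
-- order. It adds up over components, is 0 for trees and odd unicyclic graphs and positive for all
-- others, so a positive value forces too many eigenvalues 0.
record TreeBound {m} (H : Graph m) (k : ℕ) : Set where
  field
    τ : ℕ
    q : Poly
    ρ≡ : ∀ t → ρ H t ≡ t ℤ.^ τ * eval q t
    trace≡ : trace (Q H) + + 2 * + τ ≡ + 2 * + m + + 2 * + k

-- 2 * j is the total order of the unicyclic components, all of which have eigenvalue 2, and the trees are K₁ and K₂.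
Residue₁ : Poly → (ε m α β : ℕ) → Set
Residue₁ q ε m α β = ∃₂ λ j o → eval q -[1+ 3 ] ≡ -2ℤ ℤ.^ ε * o × o ≈ 1ℤ - + 2 * j [mod + 4 ] × + m ≡ + 2 * j + (+ α + + 2 * + β)

-- As before, except that one of the trees has order 4.
Residue₂ : Poly → (ε m α : ℕ) → Set
Residue₂ q ε m α = ∃₂ λ s o → eval q -[1+ 3 ] ≡ -2ℤ ℤ.^ ε * (+ 2 * o) × Odd o × + m ≡ + α + + 2 * s

-- Here A is the product of the orders of the trees without eigenvalue 2 and B the product of the halved orders of the
-- trees with eigenvalue 2; the remaining factor q has constant term A * B * 4 ^ γ * 2 ^ ε.
record Summary {m} (H : Graph m) : Set where
  field
    α β γ ε A B : ℕ
    q : Poly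
    ρ≡ : ∀ t → ρ H t ≡ t ℤ.^ α * (t ℤ.^ β * ((t + + 2) ℤ.^ β * ((t + + 2) ℤ.^ ε * eval q t)))
    q[-2]≢0 : eval q -2ℤ ≢ 0ℤ
    q[0] : eval q 0ℤ ≡ + (A ℕ.* (B ℕ.* (4 ℕ.^ γ ℕ.* 2 ℕ.^ ε)))
    trace≡ : trace (Q H) + + 2 * (+ α + + β) ≡ + 2 * + m
    B>0 : 1 ≤ B
    A≡1 : α ≡ 0 → A ≡ 1
    -- The single tree without eigenvalue 2 cannot have order 2, since it would then be `K₂`, which
    -- has that eigenvalue.
    A≢2 : α ≡ 1 → A ≢ 2
    -- Here the order is twice the sum of the `β` halved orders, all positive with product `B`; the
    -- sum of `β` such numbers is largest when all but one of them are 1.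
    order-bound : α ≡ 0 → γ ≡ 0 → ε ≡ 0 → m ℕ.+ 2 ≤ 2 ℕ.* β ℕ.+ 2 ℕ.* B
    matching : α ≡ 0 → B ≡ 1 → γ ℕ.+ ε ≡ 0 → H ≃ rK₂ β
    matching⁺ : α ≡ 0 → B ≡ 1 → γ ℕ.+ ε ≡ 1 → ∃ λ k → Σ (Graph k) λ U → H ≃ U ⊔ rK₂ β
    residue₁ : A ≡ 1 → γ ≡ 0 → B ≡ 1 → Residue₁ q ε m α β
    residue₂ : A ≡ 1 → γ ≡ 0 → B ≡ 2 → Residue₂ q ε m α

TreeBound-≃ : ∀ {m n k} {H : Graph m} {K : Graph n} → H ≃ K → TreeBound K k → TreeBound H k
TreeBound-≃ {H = H} {K} iso b with refl ← ≃⇒order≡ iso = record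
  { τ = τ
  ; q = q
  ; ρ≡ = λ t → trans (≃⇒ρ≡ iso t) (ρ≡ t)
  ; trace≡ = trans (cong (_+ + 2 * + τ) (≃⇒trace≡ iso)) trace≡
  }
  where open TreeBound b

Summary-≃ : ∀ {m n} {H : Graph m} {K : Graph n} → H ≃ K → Summary K → Summary H
Summary-≃ {H = H} {K} iso s with refl ← ≃⇒order≡ iso = record
  { q = q
  ; ρ≡ = λ t → trans (≃⇒ρ≡ iso t) (ρ≡ t)
  ; q[-2]≢0 = q[-2]≢0
  ; q[0] = q[0]
  ; trace≡ = trans (cong (_+ + 2 * (+ α + + β)) (≃⇒trace≡ iso)) trace≡
  ; B>0 = B>0
  ; A≡1 = A≡1
  ; A≢2 = A≢2
  ; order-bound = order-bound
  ; matching = λ a b c → ≃-trans iso (matching a b c)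
  ; matching⁺ = λ a b c → let (k , U , e) = matching⁺ a b c in k , U , ≃-trans iso e
  ; residue₁ = residue₁
  ; residue₂ = residue₂
  }
  where open Summary s

module _ {k l : ℕ} {C : Graph k} {R : Graph l} where
  TreeBound-⊔ : ∀ {a b} → TreeBound C a → TreeBound R b → TreeBound (C ⊔ R) (a ℕ.+ b)
  TreeBound-⊔ {a} {b} x y = record
    { τ = X.τ ℕ.+ Y.τ
    ; q = X.q ⊗ Y.q
    ; ρ≡ = λ t → trans (ρ-⊔ C R t) (trans (cong₂ _*_ (X.ρ≡ t) (Y.ρ≡ t))
        (trans (interchange (t ℤ.^ X.τ) (eval X.q t) (t ℤ.^ Y.τ) (eval Y.q t))
          (sym (cong₂ _*_ (ℤ.^-distribˡ-+-* t X.τ Y.τ) (eval-⊗ X.q Y.q t)))))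
    ; trace≡ = trans (cong₂ (λ u v → u + + 2 * v) (trace-⊔ C R) (ℤ.pos-+ X.τ Y.τ))
        (trans (collect₁ (trace (Q C)) (trace (Q R)) (+ X.τ) (+ Y.τ))
          (trans (cong₂ _+_ X.trace≡ Y.trace≡)
            (trans (collect₂ (+ k) (+ l) (+ a) (+ b)) (sym (cong₂ (λ u v → + 2 * u + + 2 * v) (ℤ.pos-+ k l) (ℤ.pos-+ a b))))))
    }
    where
    module X = TreeBound x
    module Y = TreeBound y
    interchange : ∀ a b c d → (a * b) * (c * d) ≡ (a * c) * (b * d)
    interchange = solve-∀
    collect₁ : ∀ s t u v → (s + t) + + 2 * (u + v) ≡ (s + + 2 * u) + (t + + 2 * v)
    collect₁ = solve-∀
    collect₂ : ∀ s t u v → (+ 2 * s + + 2 * u) + (+ 2 * t + + 2 * v) ≡ + 2 * (s + t) + + 2 * (u + v)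
    collect₂ = solve-∀

Summary⇒TreeBound : ∀ {m} {H : Graph m} → Summary H → TreeBound H 0
Summary⇒TreeBound {m} {H} s = record
  { τ = α ℕ.+ β
  ; q = timesPower -2ℤ β (timesPower -2ℤ ε q)
  ; ρ≡ = λ t → trans (ρ≡ t) (trans (sym (ℤ.*-assoc (t ℤ.^ α) (t ℤ.^ β) _))
      (cong₂ _*_ (sym (ℤ.^-distribˡ-+-* t α β))
        (sym (trans (eval-timesPower -2ℤ β (timesPower -2ℤ ε q) t) (cong ((t + + 2) ℤ.^ β *_) (eval-timesPower -2ℤ ε q t))))))
  ; trace≡ = trans (cong (λ x → trace (Q H) + + 2 * x) (ℤ.pos-+ α β)) (trans trace≡ (sym (ℤ.+-identityʳ (+ 2 * + m))))
  }
  where open Summary s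

emptySummary : (H : Graph 0) → Summary H
emptySummary H = record
  { α = 0 ; β = 0 ; γ = 0 ; ε = 0 ; A = 1 ; B = 1
  ; q = 1ℤ ∷ []
  ; ρ≡ = λ t → trans (detℤ-zero (λ u v → Q H u v + t * δ u v)) (one t)
  ; q[-2]≢0 = λ ()
  ; q[0] = refl
  ; trace≡ = refl
  ; B>0 = ℕ.≤-refl
  ; A≡1 = λ _ → refl
  ; A≢2 = λ ()
  ; order-bound = λ _ _ _ → ℕ.≤-refl
  ; matching = λ _ _ _ → isomorphism ↔-refl λ ()
  ; matching⁺ = λ _ _ ()
  ; residue₁ = λ _ _ _ → 0ℤ , 1ℤ , refl , ≡⇒≈ refl , refl
  ; residue₂ = λ _ _ ()
  }
  where
  one : ∀ t → 1ℤ ≡ 1ℤ * (1ℤ * (1ℤ * (1ℤ * (1ℤ + t * 0ℤ))))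
  one = solve-∀

m*n≡2 : ∀ m n → m ℕ.* n ≡ 2 → (m ≡ 1 × n ≡ 2) ⊎ (m ≡ 2 × n ≡ 1)
m*n≡2 (suc zero) n h = inj₁ (refl , trans (sym (ℕ.+-identityʳ n)) h)
m*n≡2 (suc (suc zero)) n h = inj₂ (refl , ℕ.*-cancelˡ-≡ n 1 2 h)
m*n≡2 (suc (suc (suc m))) zero h = contradiction (trans (sym (ℕ.*-zeroʳ m)) h) λ ()
m*n≡2 (suc (suc (suc m))) (suc n) h = contradiction (ℕ.≤-trans (ℕ.m≤m*n (suc (suc (suc m))) (suc n)) (ℕ.≤-reflexive h)) λ { (s≤s (s≤s ())) }

≈-mod-neg : ∀ {a b c} → a ≈ b [mod - c ] → a ≈ b [mod c ]
≈-mod-neg {b = b} {c} (k by refl) = (- k) by lemma b c k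
  where
  lemma : ∀ b c k → b + - c * k ≡ b + c * - k
  lemma = solve-∀

odd-residue : ∀ {o} j → o ≈ 1ℤ - + 2 * j [mod + 4 ] → Odd o
odd-residue j (k by refl) = (+ 2 * k - j) by lemma j k
  where
  lemma : ∀ j k → 1ℤ - + 2 * j + + 4 * k ≡ 1ℤ + + 2 * (+ 2 * k - j)
  lemma = solve-∀

module _ {k l : ℕ} (C : Graph (suc k)) (R : Graph l) (connected : Connected C) (s : Summary R) where
  private
    open Summary s

    module _ (p : Poly) where
      at : ∀ t → eval (p ⊗ q) t ≡ eval p t * eval q t
      at = eval-⊗ p q

      [-2]≢0 : eval p -2ℤ ≢ 0ℤ → eval (p ⊗ q) -2ℤ ≢ 0ℤ
      [-2]≢0 p≢0 pq≡0 with ℤ.i*j≡0⇒i≡0∨j≡0 (eval p -2ℤ) (trans (sym (at -2ℤ)) pq≡0)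
      ... | inj₁ p≡0 = p≢0 p≡0
      ... | inj₂ q≡0 = q[-2]≢0 q≡0

      [0]≡ : ∀ w {v} → eval p 0ℤ ≡ + w → w ℕ.* (A ℕ.* (B ℕ.* (4 ℕ.^ γ ℕ.* 2 ℕ.^ ε))) ≡ v → eval (p ⊗ q) 0ℤ ≡ + v
      [0]≡ w p₀ h = trans (at 0ℤ) (trans (cong₂ _*_ p₀ q[0])
        (trans (sym (ℤ.pos-* w (A ℕ.* (B ℕ.* (4 ℕ.^ γ ℕ.* 2 ℕ.^ ε))))) (cong +_ h)))

    trace+ : ∀ d → trace (Q C) + + 2 * d ≡ + 2 * + suc k → trace (Q (C ⊔ R)) + + 2 * (d + (+ α + + β)) ≡ + 2 * + (suc k ℕ.+ l)
    trace+ d h = trans (cong (_+ + 2 * (d + (+ α + + β))) (trace-⊔ C R))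
      (trans (collect₁ (trace (Q C)) (trace (Q R)) d (+ α + + β))
        (trans (cong₂ _+_ h trace≡) (sym (trans (cong (+ 2 *_) (ℤ.pos-+ (suc k) l)) (ℤ.*-distribˡ-+ (+ 2) (+ suc k) (+ l))))))
      where
      collect₁ : ∀ s t u v → (s + t) + + 2 * (u + v) ≡ (s + + 2 * u) + (t + + 2 * v)
      collect₁ = solve-∀

    -- Values of `p` at - 4 and 0 agree modulo 4. So joining `K₁` or `K₂`, whose remaining factor
    -- has constant term 1, leaves the residue of `o` unchanged.
    residue-1 : ∀ {o j} p → eval p 0ℤ ≡ 1ℤ → o ≈ 1ℤ - + 2 * j [mod + 4 ] → eval p -[1+ 3 ] * o ≈ 1ℤ - + 2 * j [mod + 4 ]
    residue-1 {o} {j} p p₀ o≈ = ≈-trans (≈-* (≈-trans (≈-mod-neg {c = + 4} (eval-≈ p 0ℤ -[1+ 3 ])) (≡⇒≈ p₀)) o≈)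
      (≡⇒≈ (ℤ.*-identityˡ (1ℤ - + 2 * j)))

    odd-1 : ∀ {o} p → eval p 0ℤ ≡ 1ℤ → Odd o → Odd (eval p -[1+ 3 ] * o)
    odd-1 p p₀ o-odd = ≈-trans (≈-* (≈-trans (odd (eval-≈ p 0ℤ -[1+ 3 ])) (≡⇒≈ p₀)) o-odd) (≡⇒≈ refl)
      where
      odd : ∀ {a b} → a ≈ b [mod -[1+ 3 ] ] → a ≈ b [mod + 2 ]
      odd {b = b} (x by refl) = (-2ℤ * x) by lemma b x
        where
        lemma : ∀ b x → b + -[1+ 3 ] * x ≡ b + + 2 * (-2ℤ * x)
        lemma = solve-∀

    swapFactors : ∀ a b c → a * (b * c) ≡ b * (a * c)
    swapFactors = solve-∀

  join-tree₀ : (p : Poly) → (∀ t → ρ C t ≡ t * eval p t) → eval p 0ℤ ≡ + suc k → eval p -2ℤ ≢ 0ℤ →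
    trace (Q C) + + 2 ≡ + 2 * + suc k → Summary (C ⊔ R)
  join-tree₀ p ρC p₀ p₋₂ trC = record
    { α = suc α ; β = β ; γ = γ ; ε = ε ; A = suc k ℕ.* A ; B = B ; q = p ⊗ q
    ; ρ≡ = λ t → trans (ρ-⊔ C R t) (trans (cong₂ _*_ (ρC t) (ρ≡ t))
        (trans (regroup t (eval p t) (t ℤ.^ α) (t ℤ.^ β) ((t + + 2) ℤ.^ β) ((t + + 2) ℤ.^ ε) (eval q t))
          (cong (λ x → t * t ℤ.^ α * (t ℤ.^ β * ((t + + 2) ℤ.^ β * ((t + + 2) ℤ.^ ε * x)))) (sym (at p t)))))
    ; q[-2]≢0 = [-2]≢0 p p₋₂
    ; q[0] = [0]≡ p (suc k) p₀ (sym (ℕ.*-assoc (suc k) A (B ℕ.* (4 ℕ.^ γ ℕ.* 2 ℕ.^ ε))))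
    ; trace≡ = trans (cong (λ x → trace (Q (C ⊔ R)) + + 2 * x) (ℤ.+-assoc 1ℤ (+ α) (+ β))) (trace+ 1ℤ trC)
    ; B>0 = B>0
    ; A≡1 = λ ()
    ; A≢2 = λ α≡0 nA≡2 → noOrder2 (trans (sym (trans (cong (suc k ℕ.*_) (A≡1 (ℕ.suc-injective α≡0))) (ℕ.*-identityʳ (suc k)))) nA≡2)
    ; order-bound = λ ()
    ; matching = λ ()
    ; matching⁺ = λ ()
    ; residue₁ = λ nA≡1 γ≡0 B≡1 → residueOne (ℕ.m*n≡1⇒m≡1 (suc k) A nA≡1) (residue₁ (ℕ.m*n≡1⇒n≡1 (suc k) A nA≡1) γ≡0 B≡1)
    ; residue₂ = λ nA≡1 γ≡0 B≡2 → residueTwo (ℕ.m*n≡1⇒m≡1 (suc k) A nA≡1) (residue₂ (ℕ.m*n≡1⇒n≡1 (suc k) A nA≡1) γ≡0 B≡2)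
    }
    where
    regroup : ∀ t x a b c d y → (t * x) * (a * (b * (c * (d * y)))) ≡ t * a * (b * (c * (d * (x * y))))
    regroup = solve-∀
    noOrder2 : suc k ≢ 2
    noOrder2 refl = p₋₂ (*-cancelˡ -2ℤ (eval p -2ℤ) 0ℤ (λ ()) (trans (sym (ρC -2ℤ))
      (trans (≃⇒ρ≡ (connected⇒≃K₂ C connected) -2ℤ) (ρ-K₂ -2ℤ))))
    residueOne : suc k ≡ 1 → Residue₁ q ε l α β → Residue₁ (p ⊗ q) ε (suc k ℕ.+ l) (suc α) β
    residueOne refl (j , o , q₄ , o≈ , l≡) = j , eval p -[1+ 3 ] * o ,
      trans (at p -[1+ 3 ]) (trans (cong (eval p -[1+ 3 ] *_) q₄) (swapFactors (eval p -[1+ 3 ]) (-2ℤ ℤ.^ ε) o)) ,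
      residue-1 {j = j} p p₀ o≈ , trans (cong (_+_ 1ℤ) l≡) (lemma j (+ α) (+ β))
      where
      lemma : ∀ j a b → 1ℤ + (+ 2 * j + (a + + 2 * b)) ≡ + 2 * j + ((1ℤ + a) + + 2 * b)
      lemma = solve-∀
    residueTwo : suc k ≡ 1 → Residue₂ q ε l α → Residue₂ (p ⊗ q) ε (suc k ℕ.+ l) (suc α)
    residueTwo refl (s , o , q₄ , o-odd , l≡) = s , eval p -[1+ 3 ] * o ,
      trans (at p -[1+ 3 ]) (trans (cong (eval p -[1+ 3 ] *_) q₄) (lemma (eval p -[1+ 3 ]) (-2ℤ ℤ.^ ε) o)) ,
      odd-1 p p₀ o-odd , trans (cong (_+_ 1ℤ) l≡) (sym (ℤ.+-assoc 1ℤ (+ α) (+ 2 * s)))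
      where
      lemma : ∀ x e o → x * (e * (+ 2 * o)) ≡ e * (+ 2 * (x * o))
      lemma = solve-∀

  join-tree₂ : (m : ℕ) (p : Poly) → + suc k ≡ + 2 * + m → (∀ t → ρ C t ≡ t * ((t + + 2) * eval p t)) → eval p 0ℤ ≡ + m →
    eval p -2ℤ ≢ 0ℤ → trace (Q C) + + 2 ≡ + 2 * + suc k → Summary (C ⊔ R)
  join-tree₂ m p n≡2m ρC p₀ p₋₂ trC = record
    { α = α ; β = suc β ; γ = γ ; ε = ε ; A = A ; B = m ℕ.* B ; q = p ⊗ q
    ; ρ≡ = λ t → trans (ρ-⊔ C R t) (trans (cong₂ _*_ (ρC t) (ρ≡ t))
        (trans (regroup t (t + + 2) (eval p t) (t ℤ.^ α) (t ℤ.^ β) ((t + + 2) ℤ.^ β) ((t + + 2) ℤ.^ ε) (eval q t))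
          (cong (λ x → t ℤ.^ α * (t * t ℤ.^ β * ((t + + 2) * (t + + 2) ℤ.^ β * ((t + + 2) ℤ.^ ε * x)))) (sym (at p t)))))
    ; q[-2]≢0 = [-2]≢0 p p₋₂
    ; q[0] = [0]≡ p m p₀ (moveFactor m A B (4 ℕ.^ γ ℕ.* 2 ℕ.^ ε))
    ; trace≡ = trans (cong (λ x → trace (Q (C ⊔ R)) + + 2 * x) (moveOne (+ α) (+ β))) (trace+ 1ℤ trC)
    ; B>0 = ℕ.*-mono-≤ m>0 B>0
    ; A≡1 = A≡1
    ; A≢2 = A≢2
    ; order-bound = λ a b c → bound (order-bound a b c)
    ; matching = λ α≡0 mB≡1 none →
        ⊔-cong (isK₂ (ℕ.m*n≡1⇒m≡1 m B mB≡1)) (matching α≡0 (ℕ.m*n≡1⇒n≡1 m B mB≡1) none)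
    ; matching⁺ = λ α≡0 mB≡1 one → let (u , U , e) = matching⁺ α≡0 (ℕ.m*n≡1⇒n≡1 m B mB≡1) one in
        u , U , ≃-trans
          (⊔-cong (isK₂ (ℕ.m*n≡1⇒m≡1 m B mB≡1)) e) (⊔-leftComm K₂ U (rK₂ β))
    ; residue₁ = λ A≡1 γ≡0 mB≡1 → residueOne (ℕ.m*n≡1⇒m≡1 m B mB≡1) (residue₁ A≡1 γ≡0 (ℕ.m*n≡1⇒n≡1 m B mB≡1))
    ; residue₂ = λ A≡1 γ≡0 mB≡2 → residueTwo A≡1 γ≡0 (m*n≡2 m B mB≡2)
    }
    where
    n≡2*m : suc k ≡ 2 ℕ.* m
    n≡2*m = ℤ.+-injective (trans n≡2m (sym (ℤ.pos-* 2 m)))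
    m>0 : 1 ≤ m
    m>0 = positive m n≡2*m
      where
      positive : ∀ m → suc k ≡ 2 ℕ.* m → 1 ≤ m
      positive (suc m) _ = s≤s z≤n
    isK₂ : m ≡ 1 → C ≃ K₂
    isK₂ refl with refl ← n≡2*m = connected⇒≃K₂ C connected
    regroup : ∀ t u x a b c d y → (t * (u * x)) * (a * (b * (c * (d * y)))) ≡ a * (t * b * (u * c * (d * (x * y))))
    regroup = solve-∀
    moveFactor : ∀ m a b c → m ℕ.* (a ℕ.* (b ℕ.* c)) ≡ a ℕ.* (m ℕ.* b ℕ.* c)
    moveFactor = ℕ-solve-∀
    moveOne : ∀ a b → a + (1ℤ + b) ≡ 1ℤ + (a + b)
    moveOne = solve-∀
    bound : l ℕ.+ 2 ≤ 2 ℕ.* β ℕ.+ 2 ℕ.* B → suc k ℕ.+ l ℕ.+ 2 ≤ 2 ℕ.* suc β ℕ.+ 2 ℕ.* (m ℕ.* B)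
    bound h = subst (λ n → n ℕ.+ l ℕ.+ 2 ≤ 2 ℕ.* suc β ℕ.+ 2 ℕ.* (m ℕ.* B)) (sym n≡2*m) (go m B m>0 B>0 h)
      where
      -- The slack `2 * (a * b)` is twice `(m - 1) * (B - 1)`: a sum of two positive numbers is at
      -- most their product plus 1.
      go : ∀ m B → 1 ≤ m → 1 ≤ B → l ℕ.+ 2 ≤ 2 ℕ.* β ℕ.+ 2 ℕ.* B → 2 ℕ.* m ℕ.+ l ℕ.+ 2 ≤ 2 ℕ.* suc β ℕ.+ 2 ℕ.* (m ℕ.* B)
      go (suc a) (suc b) _ _ h = begin
        2 ℕ.* suc a ℕ.+ l ℕ.+ 2                            ≡⟨ ℕ.+-assoc (2 ℕ.* suc a) l 2 ⟩
        2 ℕ.* suc a ℕ.+ (l ℕ.+ 2)                          ≤⟨ ℕ.+-monoʳ-≤ (2 ℕ.* suc a) h ⟩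
        2 ℕ.* suc a ℕ.+ (2 ℕ.* β ℕ.+ 2 ℕ.* suc b)          ≤⟨ ℕ.m≤m+n _ (2 ℕ.* (a ℕ.* b)) ⟩
        2 ℕ.* suc a ℕ.+ (2 ℕ.* β ℕ.+ 2 ℕ.* suc b) ℕ.+ 2 ℕ.* (a ℕ.* b) ≡⟨ lemma a b β ⟩
        2 ℕ.* suc β ℕ.+ 2 ℕ.* (suc a ℕ.* suc b) ∎
        where
        open ℕ.≤-Reasoning
        lemma : ∀ a b c → 2 ℕ.* suc a ℕ.+ (2 ℕ.* c ℕ.+ 2 ℕ.* suc b) ℕ.+ 2 ℕ.* (a ℕ.* b) ≡ 2 ℕ.* suc c ℕ.+ 2 ℕ.* (suc a ℕ.* suc b)
        lemma = ℕ-solve-∀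
    residueOne : m ≡ 1 → Residue₁ q ε l α β → Residue₁ (p ⊗ q) ε (suc k ℕ.+ l) α (suc β)
    residueOne refl (j , o , q₄ , o≈ , l≡) = j , eval p -[1+ 3 ] * o ,
      trans (at p -[1+ 3 ]) (trans (cong (eval p -[1+ 3 ] *_) q₄) (swapFactors (eval p -[1+ 3 ]) (-2ℤ ℤ.^ ε) o)) ,
      residue-1 {j = j} p p₀ o≈ , trans (ℤ.pos-+ (suc k) l) (trans (cong₂ _+_ n≡2m l≡) (lemma j (+ α) (+ β)))
      where
      lemma : ∀ j a b → + 2 * + 1 + (+ 2 * j + (a + + 2 * b)) ≡ + 2 * j + (a + + 2 * (1ℤ + b))
      lemma = solve-∀
    residueTwo : A ≡ 1 → γ ≡ 0 → (m ≡ 1 × B ≡ 2) ⊎ (m ≡ 2 × B ≡ 1) → Residue₂ (p ⊗ q) ε (suc k ℕ.+ l) α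
    residueTwo A≡1 γ≡0 (inj₁ (refl , B≡2)) with residue₂ A≡1 γ≡0 B≡2
    ... | s , o , q₄ , o-odd , l≡ = 1ℤ + s , eval p -[1+ 3 ] * o ,
      trans (at p -[1+ 3 ]) (trans (cong (eval p -[1+ 3 ] *_) q₄) (lemma (eval p -[1+ 3 ]) (-2ℤ ℤ.^ ε) o)) ,
      odd-1 p p₀ o-odd , trans (ℤ.pos-+ (suc k) l) (trans (cong₂ _+_ n≡2m l≡) (lemma′ (+ α) s))
      where
      lemma : ∀ x e o → x * (e * (+ 2 * o)) ≡ e * (+ 2 * (x * o))
      lemma = solve-∀
      lemma′ : ∀ a s → + 2 * + 1 + (a + + 2 * s) ≡ a + + 2 * (1ℤ + s)
      lemma′ = solve-∀
    -- The new tree has order 4 and `p` has constant term 2, so its value at - 4 is `2 - 4 x`, twice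
    -- an odd number: this is the extra factor 2 in `Residue₂`.
    residueTwo A≡1 γ≡0 (inj₂ (refl , B≡1)) with residue₁ A≡1 γ≡0 B≡1 | eval-≈ p 0ℤ -[1+ 3 ]
    ... | j , o , q₄ , o≈ , l≡ | x by p₄ = + 2 + j + + β , (1ℤ + -2ℤ * x) * o ,
      trans (at p -[1+ 3 ]) (trans (cong₂ _*_ (trans p₄ (cong (_+ -[1+ 3 ] * x) p₀)) q₄) (lemma x (-2ℤ ℤ.^ ε) o)) ,
      ≈-trans (≈-* {a = 1ℤ + -2ℤ * x} {1ℤ} ((- x) by lemma₁ x) (odd-residue j o≈)) (≡⇒≈ refl) ,
      trans (ℤ.pos-+ (suc k) l) (trans (cong₂ _+_ n≡2m l≡) (lemma′ (+ α) (+ β) j))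
      where
      lemma : ∀ x e o → (+ 2 + -[1+ 3 ] * x) * (e * o) ≡ e * (+ 2 * ((1ℤ + -2ℤ * x) * o))
      lemma = solve-∀
      lemma₁ : ∀ x → 1ℤ + -2ℤ * x ≡ 1ℤ + + 2 * - x
      lemma₁ = solve-∀
      lemma′ : ∀ a b j → + 2 * + 2 + (+ 2 * j + (a + + 2 * b)) ≡ a + + 2 * (+ 2 + j + b)
      lemma′ = solve-∀

  join-unicyclic₀ : ρ C 0ℤ ≡ + 4 → ρ C -2ℤ ≢ 0ℤ → trace (Q C) ≡ + 2 * + suc k → Summary (C ⊔ R)
  join-unicyclic₀ ρ₀ ρ₋₂ trC = record
    { α = α ; β = β ; γ = suc γ ; ε = ε ; A = A ; B = B ; q = p ⊗ q
    ; ρ≡ = λ t → trans (ρ-⊔ C R t) (trans (cong₂ _*_ (sym (eval-ρ-poly C t)) (ρ≡ t))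
        (trans (regroup (eval p t) (t ℤ.^ α) (t ℤ.^ β) ((t + + 2) ℤ.^ β) ((t + + 2) ℤ.^ ε) (eval q t))
          (cong (λ x → t ℤ.^ α * (t ℤ.^ β * ((t + + 2) ℤ.^ β * ((t + + 2) ℤ.^ ε * x)))) (sym (at p t)))))
    ; q[-2]≢0 = [-2]≢0 p (λ p≡0 → ρ₋₂ (trans (sym (eval-ρ-poly C -2ℤ)) p≡0))
    ; q[0] = [0]≡ p 4 (trans (eval-ρ-poly C 0ℤ) ρ₀) (moveFactor A B (4 ℕ.^ γ) (2 ℕ.^ ε))
    ; trace≡ = trans (cong (λ x → trace (Q (C ⊔ R)) + + 2 * x) (sym (ℤ.+-identityˡ (+ α + + β)))) (trace+ 0ℤ (trans (ℤ.+-identityʳ _) trC))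
    ; B>0 = B>0
    ; A≡1 = A≡1
    ; A≢2 = A≢2
    ; order-bound = λ _ ()
    ; matching = λ _ _ ()
    ; matching⁺ = λ α≡0 B≡1 one → suc k , C ,
        ⊔-cong (≃-refl) (matching α≡0 B≡1 (ℕ.suc-injective one))
    ; residue₁ = λ _ ()
    ; residue₂ = λ _ ()
    }
    where
    p : Poly
    p = ρ-poly C
    regroup : ∀ x a b c d y → x * (a * (b * (c * (d * y)))) ≡ a * (b * (c * (d * (x * y))))
    regroup = solve-∀
    moveFactor : ∀ a b g e → 4 ℕ.* (a ℕ.* (b ℕ.* (g ℕ.* e))) ≡ a ℕ.* (b ℕ.* (4 ℕ.* g ℕ.* e))
    moveFactor = ℕ-solve-∀

  join-unicyclic₂ : (j : ℤ) (p : Poly) (o : ℤ) → + suc k ≡ + 2 * j → (∀ t → ρ C t ≡ (t + + 2) * eval p t) → eval p 0ℤ ≡ + 2 →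
    eval p -2ℤ ≢ 0ℤ → eval p -[1+ 3 ] ≡ -2ℤ * o → o ≈ 1ℤ - + 2 * j [mod + 4 ] → trace (Q C) ≡ + 2 * + suc k → Summary (C ⊔ R)
  join-unicyclic₂ j p o n≡2j ρC p₀ p₋₂ p₄ o≈ trC = record
    { α = α ; β = β ; γ = γ ; ε = suc ε ; A = A ; B = B ; q = p ⊗ q
    ; ρ≡ = λ t → trans (ρ-⊔ C R t) (trans (cong₂ _*_ (ρC t) (ρ≡ t))
        (trans (regroup (t + + 2) (eval p t) (t ℤ.^ α) (t ℤ.^ β) ((t + + 2) ℤ.^ β) ((t + + 2) ℤ.^ ε) (eval q t))
          (cong (λ x → t ℤ.^ α * (t ℤ.^ β * ((t + + 2) ℤ.^ β * ((t + + 2) * (t + + 2) ℤ.^ ε * x)))) (sym (at p t)))))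
    ; q[-2]≢0 = [-2]≢0 p p₋₂
    ; q[0] = [0]≡ p 2 p₀ (moveFactor A B (4 ℕ.^ γ) (2 ℕ.^ ε))
    ; trace≡ = trans (cong (λ x → trace (Q (C ⊔ R)) + + 2 * x) (sym (ℤ.+-identityˡ (+ α + + β)))) (trace+ 0ℤ (trans (ℤ.+-identityʳ _) trC))
    ; B>0 = B>0
    ; A≡1 = A≡1
    ; A≢2 = A≢2
    ; order-bound = λ _ _ ()
    ; matching = λ _ _ γ+1+ε≡0 → contradiction (trans (sym (ℕ.+-suc γ ε)) γ+1+ε≡0) λ ()
    ; matching⁺ = λ α≡0 B≡1 one → suc k , C ,
        ⊔-cong (≃-refl) (matching α≡0 B≡1 (ℕ.suc-injective (trans (sym (ℕ.+-suc γ ε)) one)))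
    ; residue₁ = λ A≡1 γ≡0 B≡1 → residueOne (residue₁ A≡1 γ≡0 B≡1)
    ; residue₂ = λ A≡1 γ≡0 B≡2 → residueTwo (residue₂ A≡1 γ≡0 B≡2)
    }
    where
    regroup : ∀ u x a b c d y → (u * x) * (a * (b * (c * (d * y)))) ≡ a * (b * (c * (u * d * (x * y))))
    regroup = solve-∀
    moveFactor : ∀ a b g e → 2 ℕ.* (a ℕ.* (b ℕ.* (g ℕ.* e))) ≡ a ℕ.* (b ℕ.* (g ℕ.* (2 ℕ.* e)))
    moveFactor = ℕ-solve-∀
    -- Modulo 4 the product of `1 - 2 j` and `1 - 2 j′` is `1 - 2 (j + j′)`, so halved orders add
    -- while values multiply.
    residueOne : Residue₁ q ε l α β → Residue₁ (p ⊗ q) (suc ε) (suc k ℕ.+ l) α β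
    residueOne (j′ , o′ , q₄ , o′≈ , l≡) = j + j′ , o * o′ ,
      trans (at p -[1+ 3 ]) (trans (cong₂ _*_ p₄ q₄) (lemma o (-2ℤ ℤ.^ ε) o′)) ,
      ≈-trans (≈-* o≈ o′≈) ((j * j′) by lemma₁ j j′) ,
      trans (ℤ.pos-+ (suc k) l) (trans (cong₂ _+_ n≡2j l≡) (lemma₂ j j′ (+ α + + 2 * + β)))
      where
      lemma : ∀ o e o′ → (-2ℤ * o) * (e * o′) ≡ -2ℤ * e * (o * o′)
      lemma = solve-∀
      lemma₁ : ∀ j i → (1ℤ - + 2 * j) * (1ℤ - + 2 * i) ≡ 1ℤ - + 2 * (j + i) + + 4 * (j * i)
      lemma₁ = solve-∀
      lemma₂ : ∀ j i x → + 2 * j + (+ 2 * i + x) ≡ + 2 * (j + i) + x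
      lemma₂ = solve-∀
    residueTwo : Residue₂ q ε l α → Residue₂ (p ⊗ q) (suc ε) (suc k ℕ.+ l) α
    residueTwo (s , o′ , q₄ , o′-odd , l≡) = j + s , o * o′ ,
      trans (at p -[1+ 3 ]) (trans (cong₂ _*_ p₄ q₄) (lemma o (-2ℤ ℤ.^ ε) o′)) ,
      ≈-trans (≈-* (odd-residue j o≈) o′-odd) (≡⇒≈ refl) ,
      trans (ℤ.pos-+ (suc k) l) (trans (cong₂ _+_ n≡2j l≡) (lemma₂ j s (+ α)))
      where
      lemma : ∀ o e o′ → (-2ℤ * o) * (e * (+ 2 * o′)) ≡ -2ℤ * e * (+ 2 * (o * o′))
      lemma = solve-∀
      lemma₂ : ∀ j s a → + 2 * j + (a + + 2 * s) ≡ a + + 2 * (j + s)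
      lemma₂ = solve-∀

componentTreeBound : ∀ {n} (C : Graph (suc n)) → Component C → ∃ λ k → TreeBound C k
componentTreeBound C (tree₀ q ρ≡ _ _ tr) = 0 , record { τ = 1 ; q = q
  ; ρ≡ = λ t → trans (ρ≡ t) (cong (_* eval q t) (sym (ℤ.*-identityʳ t))) ; trace≡ = trans tr (sym (ℤ.+-identityʳ _)) }
componentTreeBound C (tree₂ m q _ ρ≡ _ _ tr) = 0 , record { τ = 1 ; q = timesPower -2ℤ 1 q
  ; ρ≡ = λ t → trans (ρ≡ t) (cong₂ _*_ (sym (ℤ.*-identityʳ t))
      (sym (trans (eval-timesPower -2ℤ 1 q t) (cong (_* eval q t) (ℤ.*-identityʳ (t + + 2))))))
  ; trace≡ = trans tr (sym (ℤ.+-identityʳ _)) }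
componentTreeBound C (unicyclic₀ _ _ tr) = 0 , record { τ = 0 ; q = ρ-poly C
  ; ρ≡ = λ t → trans (sym (eval-ρ-poly C t)) (sym (ℤ.*-identityˡ _)) ; trace≡ = cong (_+ 0ℤ) tr }
componentTreeBound C (unicyclic₂ _ _ _ _ _ _ _ _ _ tr) = 0 , record { τ = 0 ; q = ρ-poly C
  ; ρ≡ = λ t → trans (sym (eval-ρ-poly C t)) (sym (ℤ.*-identityˡ _)) ; trace≡ = cong (_+ 0ℤ) tr }
componentTreeBound C (excess τ q k ρ≡ tr) = suc k , record { τ = τ ; q = q ; ρ≡ = ρ≡ ; trace≡ = tr }

-- Excess is never compensated by other components. After the first component in excess only the
-- bound is carried on; otherwise all components are trees or odd unicyclic and the full invariants
-- are kept.
summarize : ∀ {m} {H : Graph m} → Components H → (∃ λ k → TreeBound H (suc k)) ⊎ Summary H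
summarize (none H) = inj₂ (emptySummary H)
summarize {H = H} (cons C R connected iso rest) = join (component C connected) (summarize rest)
  where
  transport : (∃ λ k → TreeBound (C ⊔ R) (suc k)) ⊎ Summary (C ⊔ R) → (∃ λ k → TreeBound H (suc k)) ⊎ Summary H
  transport (inj₁ (k , b)) = inj₁ (k , TreeBound-≃ iso b)
  transport (inj₂ s) = inj₂ (Summary-≃ iso s)
  join : Component C → (∃ λ k → TreeBound R (suc k)) ⊎ Summary R → (∃ λ k → TreeBound H (suc k)) ⊎ Summary H
  join c (inj₁ (k , b)) with componentTreeBound C c
  ... | a , b′ = transport (inj₁ (a ℕ.+ k , subst (TreeBound (C ⊔ R)) (ℕ.+-suc a k) (TreeBound-⊔ b′ b)))
  join (excess τ q k ρ≡ tr) (inj₂ s) = transport (inj₁ (k ℕ.+ 0 ,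
    TreeBound-⊔ (proj₂ (componentTreeBound C (excess τ q k ρ≡ tr))) (Summary⇒TreeBound s)))
  join (tree₀ p ρC p₀ p₋₂ trC) (inj₂ s) = transport (inj₂ (join-tree₀ C R connected s p ρC p₀ p₋₂ trC))
  join (tree₂ m p n≡2m ρC p₀ p₋₂ trC) (inj₂ s) = transport (inj₂ (join-tree₂ C R connected s m p n≡2m ρC p₀ p₋₂ trC))
  join (unicyclic₀ ρ₀ ρ₋₂ trC) (inj₂ s) = transport (inj₂ (join-unicyclic₀ C R connected s ρ₀ ρ₋₂ trC))
  join (unicyclic₂ j p o n≡2j ρC p₀ p₋₂ p₄ o≈ trC) (inj₂ s) =
    transport (inj₂ (join-unicyclic₂ C R connected s j p o n≡2j ρC p₀ p₋₂ p₄ o≈ trC))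

-- Comparison with G ⊔ rK₂ r

data Outcome (α γ ε A B : ℕ) : Set where
  matched : α ≡ 0 → B ≡ 1 → γ ℕ.+ ε ≡ 1 → Outcome α γ ε A B
  forest : α ≡ 0 → γ ≡ 0 → ε ≡ 0 → B ≡ 4 → Outcome α γ ε A B
  oneUnicyclic : α ≡ 1 → γ ≡ 0 → ε ≡ 1 → A ≡ 1 → B ≡ 2 → Outcome α γ ε A B
  twoUnicyclic : α ≡ 2 → γ ≡ 0 → ε ≡ 2 → A ≡ 1 → B ≡ 1 → Outcome α γ ε A B

c*2^s≡4 : ∀ c s → c ℕ.* 2 ℕ.^ s ≡ 4 → (s ≡ 0 × c ≡ 4) ⊎ (s ≡ 1 × c ≡ 2) ⊎ (s ≡ 2 × c ≡ 1)
c*2^s≡4 c zero h = inj₁ (refl , trans (sym (ℕ.*-identityʳ c)) h)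
c*2^s≡4 c (suc zero) h = inj₂ (inj₁ (refl , ℕ.*-cancelʳ-≡ c 2 2 h))
c*2^s≡4 c (suc (suc zero)) h = inj₂ (inj₂ (refl , ℕ.*-cancelʳ-≡ c 1 4 h))
c*2^s≡4 c (suc (suc (suc s))) h = contradiction
  (ℕ.m*n≡1⇒m≡1 2 (c ℕ.* 2 ℕ.^ s) (ℕ.*-cancelˡ-≡ (2 ℕ.* (c ℕ.* 2 ℕ.^ s)) 1 4 (trans (lemma c (2 ℕ.^ s)) h))) λ ()
  where
  lemma : ∀ c x → 4 ℕ.* (2 ℕ.* (c ℕ.* x)) ≡ c ℕ.* (2 ℕ.* (2 ℕ.* (2 ℕ.* x)))
  lemma = ℕ-solve-∀

x+x+α≡0 : ∀ x α → x ℕ.+ x ℕ.+ α ≡ 0 → x ≡ 0 × α ≡ 0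
x+x+α≡0 x α h = ℕ.m+n≡0⇒m≡0 x (ℕ.m+n≡0⇒m≡0 (x ℕ.+ x) h) , ℕ.m+n≡0⇒n≡0 (x ℕ.+ x) h

x+x+α≡1 : ∀ x α → x ℕ.+ x ℕ.+ α ≡ 1 → x ≡ 0 × α ≡ 1
x+x+α≡1 zero α h = refl , h
x+x+α≡1 (suc x) α h rewrite ℕ.+-suc x x = contradiction (ℕ.suc-injective h) λ ()

x+x+α≡2 : ∀ x α → x ℕ.+ x ℕ.+ α ≡ 2 → (x ≡ 0 × α ≡ 2) ⊎ (x ≡ 1 × α ≡ 0)
x+x+α≡2 zero α h = inj₁ (refl , h)
x+x+α≡2 (suc x) α h rewrite ℕ.+-suc x x with x+x+α≡0 x α (ℕ.suc-injective (ℕ.suc-injective h))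
... | refl , refl = inj₂ (refl , refl)

m+n≡1 : ∀ m n → m ℕ.+ n ≡ 1 → (m ≡ 0 × n ≡ 1) ⊎ (m ≡ 1 × n ≡ 0)
m+n≡1 zero n h = inj₁ (refl , h)
m+n≡1 (suc zero) zero h = inj₂ (refl , refl)

-- The hypothesis amounts to `A * B * 2 ^ (2 * (κ + γ) + α) = 4`. Exponent 0 gives `forest`.
-- Exponent 1 means `α = 1`, and of the two ways to have `A * B = 2` the one with `A = 2` is ruled
-- out. Exponent 2 means `α = 2`, or `α = 0` with exactly one of `κ`, `γ` equal to 1, which is
-- `matched`.
outcome : ∀ {γ A B} α κ → (α ≡ 0 → A ≡ 1) → (α ≡ 1 → A ≢ 2) →
  2 ℕ.^ κ ℕ.* (A ℕ.* (B ℕ.* (4 ℕ.^ γ ℕ.* 2 ℕ.^ (α ℕ.+ κ)))) ≡ 4 → Outcome α γ (α ℕ.+ κ) A B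
outcome {γ} {A} {B} α κ A≡1 A≢2 h = cases (c*2^s≡4 (A ℕ.* B) (κ ℕ.+ γ ℕ.+ (κ ℕ.+ γ) ℕ.+ α) (trans regroup h))
  where
  4^γ≡ : ∀ γ → 4 ℕ.^ γ ≡ 2 ℕ.^ γ ℕ.* 2 ℕ.^ γ
  4^γ≡ γ = trans (ℕ.^-*-assoc 2 2 γ) (trans (cong (λ k → 2 ℕ.^ (γ ℕ.+ k)) (ℕ.+-identityʳ γ)) (ℕ.^-distribˡ-+-* 2 γ γ))
  lemma : ∀ a b k g x → a ℕ.* b ℕ.* (k ℕ.* g ℕ.* (k ℕ.* g) ℕ.* x) ≡ k ℕ.* (a ℕ.* (b ℕ.* (g ℕ.* g ℕ.* (x ℕ.* k))))
  lemma = ℕ-solve-∀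
  regroup : A ℕ.* B ℕ.* 2 ℕ.^ (κ ℕ.+ γ ℕ.+ (κ ℕ.+ γ) ℕ.+ α) ≡ 2 ℕ.^ κ ℕ.* (A ℕ.* (B ℕ.* (4 ℕ.^ γ ℕ.* 2 ℕ.^ (α ℕ.+ κ))))
  regroup = begin
    A ℕ.* B ℕ.* 2 ℕ.^ (κ ℕ.+ γ ℕ.+ (κ ℕ.+ γ) ℕ.+ α)
      ≡⟨ cong (A ℕ.* B ℕ.*_) (trans (ℕ.^-distribˡ-+-* 2 (κ ℕ.+ γ ℕ.+ (κ ℕ.+ γ)) α) (cong (ℕ._* 2 ℕ.^ α)
           (trans (ℕ.^-distribˡ-+-* 2 (κ ℕ.+ γ) (κ ℕ.+ γ)) (cong (λ x → x ℕ.* x) (ℕ.^-distribˡ-+-* 2 κ γ))))) ⟩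
    A ℕ.* B ℕ.* (2 ℕ.^ κ ℕ.* 2 ℕ.^ γ ℕ.* (2 ℕ.^ κ ℕ.* 2 ℕ.^ γ) ℕ.* 2 ℕ.^ α)
      ≡⟨ lemma A B (2 ℕ.^ κ) (2 ℕ.^ γ) (2 ℕ.^ α) ⟩
    2 ℕ.^ κ ℕ.* (A ℕ.* (B ℕ.* (2 ℕ.^ γ ℕ.* 2 ℕ.^ γ ℕ.* (2 ℕ.^ α ℕ.* 2 ℕ.^ κ))))
      ≡⟨ cong₂ (λ g x → 2 ℕ.^ κ ℕ.* (A ℕ.* (B ℕ.* (g ℕ.* x)))) (sym (4^γ≡ γ)) (sym (ℕ.^-distribˡ-+-* 2 α κ)) ⟩
    2 ℕ.^ κ ℕ.* (A ℕ.* (B ℕ.* (4 ℕ.^ γ ℕ.* 2 ℕ.^ (α ℕ.+ κ)))) ∎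
    where open ≡-Reasoning
  build : ∀ {κ′ γ′ α′} → κ ≡ κ′ → γ ≡ γ′ → α ≡ α′ → Outcome α′ γ′ (α′ ℕ.+ κ′) A B → Outcome α γ (α ℕ.+ κ) A B
  build refl refl refl o = o
  cases : let s = κ ℕ.+ γ ℕ.+ (κ ℕ.+ γ) ℕ.+ α; c = A ℕ.* B in
    (s ≡ 0 × c ≡ 4) ⊎ (s ≡ 1 × c ≡ 2) ⊎ (s ≡ 2 × c ≡ 1) → Outcome α γ (α ℕ.+ κ) A B
  cases (inj₁ (s≡0 , c≡4)) with x+x+α≡0 (κ ℕ.+ γ) α s≡0
  ... | x≡0 , α≡0 = build (ℕ.m+n≡0⇒m≡0 κ x≡0) (ℕ.m+n≡0⇒n≡0 κ x≡0) α≡0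
    (forest refl refl refl (trans (sym (trans (cong (ℕ._* B) (A≡1 α≡0)) (ℕ.*-identityˡ B))) c≡4))
  cases (inj₂ (inj₁ (s≡1 , c≡2))) with x+x+α≡1 (κ ℕ.+ γ) α s≡1 | m*n≡2 A B c≡2
  ... | x≡0 , α≡1 | inj₁ (a , b) = build (ℕ.m+n≡0⇒m≡0 κ x≡0) (ℕ.m+n≡0⇒n≡0 κ x≡0) α≡1 (oneUnicyclic refl refl refl a b)
  ... | x≡0 , α≡1 | inj₂ (A≡2 , _) = contradiction A≡2 (A≢2 α≡1)
  cases (inj₂ (inj₂ (s≡2 , c≡1))) with x+x+α≡2 (κ ℕ.+ γ) α s≡2
  ... | inj₁ (x≡0 , α≡2) = build (ℕ.m+n≡0⇒m≡0 κ x≡0) (ℕ.m+n≡0⇒n≡0 κ x≡0) α≡2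
    (twoUnicyclic refl refl refl (ℕ.m*n≡1⇒m≡1 A B c≡1) (ℕ.m*n≡1⇒n≡1 A B c≡1))
  ... | inj₂ (x≡1 , α≡0) with m+n≡1 κ γ x≡1
  ...   | inj₁ (κ≡0 , γ≡1) = build κ≡0 γ≡1 α≡0 (matched refl (ℕ.m*n≡1⇒n≡1 A B c≡1) refl)
  ...   | inj₂ (κ≡1 , γ≡0) = build κ≡1 γ≡0 α≡0 (matched refl (ℕ.m*n≡1⇒n≡1 A B c≡1) refl)

2^≢0 : ∀ r → (+ 2) ℤ.^ r ≢ 0ℤ
2^≢0 zero ()
2^≢0 (suc r) h with ℤ.i*j≡0⇒i≡0∨j≡0 (+ 2) h
... | inj₂ h′ = 2^≢0 r h′

2^-pos : ∀ r → (+ 2) ℤ.^ r ≡ + (2 ℕ.^ r)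
2^-pos zero = refl
2^-pos (suc r) = trans (cong (+ 2 *_) (2^-pos r)) (sym (ℤ.pos-* 2 (2 ℕ.^ r)))

module _ {n : ℕ} (G : Graph (suc n)) (G-matrix : OddUnicyclicMatrix (Q G)) (G-edges : edgeCount G ≡ suc n) (G-dqs : DQS G)
         (n≥7 : 7 ≤ suc n) (r : ℕ) (H : Graph (suc n ℕ.+ r ℕ.* 2)) (cs : QCospectral (G ⊔ rK₂ r) H) where
  private
    open OddUnicyclicMatrix G-matrix
    open ≡-Reasoning

    N : ℤ
    N = + suc n

    pG : Poly
    pG = ρ-poly G

    pG[0] : eval pG 0ℤ ≡ + 4
    pG[0] = trans (eval-ρ-poly G 0ℤ) (trans (ρ-zero G) det≡4)

    order≡ : + (suc n ℕ.+ r ℕ.* 2) ≡ N + + r * + 2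
    order≡ = trans (ℤ.pos-+ (suc n) (r ℕ.* 2)) (cong (_+_ N) (ℤ.pos-* r 2))

    at0 : ∀ t a → t ℤ.^ a ≡ (t - 0ℤ) ℤ.^ a
    at0 t a = cong (ℤ._^ a) (sym (ℤ.+-identityʳ t))

    ρ-⊔-rK₂ : ∀ {u} (U : Graph u) t → ρ (U ⊔ rK₂ r) t ≡ (t - 0ℤ) ℤ.^ r * eval (timesPower -2ℤ r (ρ-poly U)) t
    ρ-⊔-rK₂ U t = begin
      ρ (U ⊔ rK₂ r) t                                       ≡⟨ ρ-⊔ U (rK₂ r) t ⟩
      ρ U t * ρ (rK₂ r) t                                   ≡⟨ cong₂ _*_ (sym (eval-ρ-poly U t)) (ρ-rK₂ r t) ⟩
      eval (ρ-poly U) t * (t ℤ.^ r * (t + + 2) ℤ.^ r)       ≡⟨ lemma (eval (ρ-poly U) t) (t ℤ.^ r) ((t + + 2) ℤ.^ r) ⟩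
      t ℤ.^ r * ((t + + 2) ℤ.^ r * eval (ρ-poly U) t)       ≡⟨ cong₂ _*_ (at0 t r) (sym (eval-timesPower -2ℤ r (ρ-poly U) t)) ⟩
      (t - 0ℤ) ℤ.^ r * eval (timesPower -2ℤ r (ρ-poly U)) t ∎
      where
      lemma : ∀ x a b → x * (a * b) ≡ a * (b * x)
      lemma = solve-∀

    v : Poly
    v = timesPower -2ℤ r pG

    ρH : ∀ t → ρ H t ≡ (t - 0ℤ) ℤ.^ r * eval v t
    ρH t = trans (sym (cospectral⇒ρ≡ (G ⊔ rK₂ r) H cs t)) (ρ-⊔-rK₂ G t)

    v[0]≢0 : eval v 0ℤ ≢ 0ℤ
    v[0]≢0 h = [ 2^≢0 r , (λ ()) ]′ (ℤ.i*j≡0⇒i≡0∨j≡0 ((+ 2) ℤ.^ r)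
      (trans (cong ((+ 2) ℤ.^ r *_) (sym pG[0])) (trans (sym (eval-timesPower -2ℤ r pG 0ℤ)) h)))

    traceH : trace (Q H) ≡ + 2 * N + + 2 * + r
    traceH = begin
      trace (Q H)                           ≡⟨ sym (cospectral⇒trace≡ (G ⊔ rK₂ r) H cs) ⟩
      trace (Q (G ⊔ rK₂ r))                 ≡⟨ trace-⊔ G (rK₂ r) ⟩
      trace (Q G) + trace (Q (rK₂ r))       ≡⟨ cong₂ _+_ (trans (trace-Q G) (cong (λ e → + 2 * + e) G-edges)) (trace-rK₂ r) ⟩
      + 2 * N + + 2 * + r                   ∎

    -- H has `N + r` edges and `N + 2 r` vertices, so an excess of `x` amounts to `r + x` factors
    -- `t`.
    trees≡ : ∀ τ x → trace (Q H) + + 2 * τ ≡ + 2 * + (suc n ℕ.+ r ℕ.* 2) + + 2 * x → τ ≡ + r + x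
    trees≡ τ x h = *-cancelˡ (+ 2) τ (+ r + x) (λ ()) (begin
      + 2 * τ
        ≡⟨ lemma₁ N (+ r) τ ⟩
      (+ 2 * N + + 2 * + r + + 2 * τ) - + 2 * (N + + r)
        ≡⟨ cong (_- + 2 * (N + + r)) (trans (cong (_+ + 2 * τ) (sym traceH)) (trans h (cong (λ m → + 2 * m + + 2 * x) order≡))) ⟩
      (+ 2 * (N + + r * + 2) + + 2 * x) - + 2 * (N + + r)
        ≡⟨ lemma₂ N (+ r) x ⟩
      + 2 * (+ r + x) ∎)
      where
      lemma₁ : ∀ n r t → + 2 * t ≡ (+ 2 * n + + 2 * r + + 2 * t) - + 2 * (n + r)
      lemma₁ = solve-∀
      lemma₂ : ∀ n r x → (+ 2 * (n + r * + 2) + + 2 * x) - + 2 * (n + r) ≡ + 2 * (r + x)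
      lemma₂ = solve-∀

    -- The constant term of `v` is nonzero, so 0 is a root of `ρ H` of multiplicity exactly `r`,
    -- whereas positive excess would split off more than `r` factors `t`.
    noExcess : ∀ k → ¬ TreeBound H (suc k)
    noExcess k b = absurd (comparePowers 0ℤ r τ v q v[0]≢0 λ t → trans (sym (ρH t)) (trans (ρ≡ t) (cong (_* eval q t) (at0 t τ))))
      where
      open TreeBound b
      τ≡ : τ ≡ r ℕ.+ suc k
      τ≡ = ℤ.+-injective (trans (trees≡ (+ τ) (+ suc k) trace≡) (sym (ℤ.pos-+ r (suc k))))
      absurd : ¬ (∃ λ k′ → r ≡ τ ℕ.+ k′ × ∀ t → (t - 0ℤ) ℤ.^ k′ * eval v t ≡ eval q t)
      absurd (k′ , r≡τ+k′ , _) = ℕ.m≢1+m+n r (trans r≡τ+k′ (trans (cong (ℕ._+ k′) τ≡)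
        (trans (ℕ.+-assoc r (suc k) k′) (ℕ.+-suc r (k ℕ.+ k′)))))

    -- The factors of the `r` copies of `K₂` cancel from both sides, which makes `U` cospectral with
    -- `G`; being determined by its spectrum, `G` is then isomorphic to `U`.
    fromMatching : ∀ {u} (U : Graph u) → H ≃ U ⊔ rK₂ r → (G ⊔ rK₂ r) ≅ H
    fromMatching {u} U iso = go u U iso (ℕ.+-cancelʳ-≡ (r ℕ.* 2) (suc n) u (≃⇒order≡ iso))
      where
      go : ∀ u (U : Graph u) → H ≃ U ⊔ rK₂ r → suc n ≡ u → (G ⊔ rK₂ r) ≅ H
      go .(suc n) U iso refl = ≃⇒≅ (≃-trans
        (⊔-cong (≅⇒≃ (G-dqs U (ρ≡⇒cospectral G U G~U))) (≃-refl))
        (≃-sym iso))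
        where
        pU v′ : Poly
        pU = ρ-poly U
        v′ = timesPower -2ℤ r pU
        v′≡v : ∀ t → eval v′ t ≡ eval v t
        v′≡v = cancelPower 0ℤ r v′ v λ t → trans (sym (trans (≃⇒ρ≡ iso t) (ρ-⊔-rK₂ U t))) (ρH t)
        G~U : ∀ t → ρ G t ≡ ρ U t
        G~U t = trans (sym (eval-ρ-poly G t)) (trans
          (cancelPower -2ℤ r pG pU (λ s → trans (sym (eval-timesPower -2ℤ r pG s)) (trans (sym (v′≡v s)) (eval-timesPower -2ℤ r pU s))) t)
          (eval-ρ-poly U t))

    module _ (s : Summary H) where
      open Summary s

      α+β≡r : α ℕ.+ β ≡ r
      α+β≡r = ℤ.+-injective (trans (ℤ.pos-+ α β) (trans (trees≡ (+ α + + β) 0ℤ (trans trace≡ (sym (ℤ.+-identityʳ _)))) (ℤ.+-identityʳ (+ r))))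

      w : Poly
      w = timesPower -2ℤ (β ℕ.+ ε) q

      v≡w : ∀ t → eval v t ≡ eval w t
      v≡w = cancelPower 0ℤ r v w λ t → trans (sym (ρH t)) (trans (ρ≡ t) (begin
        t ℤ.^ α * (t ℤ.^ β * ((t + + 2) ℤ.^ β * ((t + + 2) ℤ.^ ε * eval q t)))
          ≡⟨ lemma (t ℤ.^ α) (t ℤ.^ β) ((t + + 2) ℤ.^ β) ((t + + 2) ℤ.^ ε) (eval q t) ⟩
        t ℤ.^ α * t ℤ.^ β * ((t + + 2) ℤ.^ β * (t + + 2) ℤ.^ ε * eval q t)
          ≡⟨ cong₂ (λ x y → x * (y * eval q t)) (sym (ℤ.^-distribˡ-+-* t α β)) (sym (ℤ.^-distribˡ-+-* (t + + 2) β ε)) ⟩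
        t ℤ.^ (α ℕ.+ β) * ((t + + 2) ℤ.^ (β ℕ.+ ε) * eval q t)
          ≡⟨ cong₂ _*_ (trans (cong (t ℤ.^_) α+β≡r) (at0 t r)) (sym (eval-timesPower -2ℤ (β ℕ.+ ε) q t)) ⟩
        (t - 0ℤ) ℤ.^ r * eval w t ∎))
        where
        lemma : ∀ a b c d x → a * (b * (c * (d * x))) ≡ a * b * (c * d * x)
        lemma = solve-∀

      -- As `q` does not vanish at - 2, `κ` is the multiplicity of the eigenvalue 2 in `G`.
      comparison : ∃ λ κ → β ℕ.+ ε ≡ r ℕ.+ κ × ∀ t → (t - -2ℤ) ℤ.^ κ * eval q t ≡ eval pG t
      comparison = comparePowers -2ℤ (β ℕ.+ ε) r q pG q[-2]≢0 λ t →
        trans (sym (eval-timesPower -2ℤ (β ℕ.+ ε) q t)) (trans (sym (v≡w t)) (eval-timesPower -2ℤ r pG t))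

      κ : ℕ
      κ = proj₁ comparison

      -- The eigenvalue 2 occurs `β + ε` times in H and `r + κ` times in the given graph. Every tree
      -- without it must be made up for by a unicyclic component that has it.
      ε≡α+κ : ε ≡ α ℕ.+ κ
      ε≡α+κ = ℕ.+-cancelˡ-≡ β ε (α ℕ.+ κ) (trans (proj₁ (proj₂ comparison)) (trans (cong (ℕ._+ κ) (sym α+β≡r)) (lemma α β κ)))
        where
        lemma : ∀ a b k → a ℕ.+ b ℕ.+ k ≡ b ℕ.+ (a ℕ.+ k)
        lemma = ℕ-solve-∀

      constant≡4 : 2 ℕ.^ κ ℕ.* (A ℕ.* (B ℕ.* (4 ℕ.^ γ ℕ.* 2 ℕ.^ ε))) ≡ 4
      constant≡4 = ℤ.+-injective (begin
        + (2 ℕ.^ κ ℕ.* W)        ≡⟨ ℤ.pos-* (2 ℕ.^ κ) W ⟩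
        + (2 ℕ.^ κ) * + W        ≡⟨ cong₂ _*_ (sym (2^-pos κ)) (sym q[0]) ⟩
        (+ 2) ℤ.^ κ * eval q 0ℤ    ≡⟨ proj₂ (proj₂ comparison) 0ℤ ⟩
        eval pG 0ℤ               ≡⟨ pG[0] ⟩
        + 4                      ∎)
        where
        W = A ℕ.* (B ℕ.* (4 ℕ.^ γ ℕ.* 2 ℕ.^ ε))

      result : Outcome α γ ε A B
      result = subst (λ e → Outcome α γ e A B) (sym ε≡α+κ)
        (outcome α κ A≡1 A≢2 (subst (λ e → 2 ℕ.^ κ ℕ.* (A ℕ.* (B ℕ.* (4 ℕ.^ γ ℕ.* 2 ℕ.^ e))) ≡ 4) ε≡α+κ constant≡4))

      -- With `B = 4` the order bound reads `n + 2 r + 2 ≤ 2 r + 8` for the order `n` of `G`, so `n`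
      -- is at most 6. The assumption of at least 7 vertices enters here.
      noForest : α ≡ 0 → γ ≡ 0 → ε ≡ 0 → B ≢ 4
      noForest α≡0 γ≡0 ε≡0 B≡4 = contradiction (ℕ.≤-trans (ℕ.+-monoˡ-≤ (r ℕ.* 2 ℕ.+ 2) n≥7) bound) (ℕ.<⇒≱ (ℕ.≤-reflexive (lemma r)))
        where
        β≡r : β ≡ r
        β≡r = trans (cong (ℕ._+ β) (sym α≡0)) α+β≡r
        bound : suc n ℕ.+ (r ℕ.* 2 ℕ.+ 2) ≤ 2 ℕ.* r ℕ.+ 2 ℕ.* 4
        bound = subst₂ _≤_ (ℕ.+-assoc (suc n) (r ℕ.* 2) 2) (cong₂ (λ b c → 2 ℕ.* b ℕ.+ 2 ℕ.* c) β≡r B≡4) (order-bound α≡0 γ≡0 ε≡0)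
        lemma : ∀ r → suc (2 ℕ.* r ℕ.+ 2 ℕ.* 4) ≡ 7 ℕ.+ (r ℕ.* 2 ℕ.+ 2)
        lemma = ℕ-solve-∀

      κ≡0 : α ≡ ε → κ ≡ 0
      κ≡0 α≡ε = ℕ.+-cancelˡ-≡ α κ 0 (trans (sym ε≡α+κ) (trans (sym α≡ε) (sym (ℕ.+-identityʳ α))))

      -- In both remaining shapes `G` lacks the eigenvalue 2, so `q` takes the values of `ρ G`. The
      -- value at - 4 computed from the components of H can therefore be compared with the one given
      -- by the order and girth of `G`.
      q[-4] : κ ≡ 0 → eval q -[1+ 3 ] ≈ + 4 * (1ℤ - N * girth) [mod + 16 ]
      q[-4] κ≡0 = ≈-trans (≡⇒≈ (trans (sym (trans (cong (λ k → -2ℤ ℤ.^ k * eval q -[1+ 3 ]) κ≡0) (ℤ.*-identityˡ _)))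
        (trans (proj₂ (proj₂ comparison) -[1+ 3 ]) (eval-ρ-poly G -[1+ 3 ])))) (ρ[-4] G G-matrix)

      quarter : ∀ x l → + 4 * (1ℤ - x) + + 16 * l ≡ + 4 * (1ℤ - x + + 4 * l)
      quarter = solve-∀

      cancelOrder : ∀ n r → n ≡ (n + r * + 2) - r * + 2
      cancelOrder = solve-∀

      -- The order of G is odd, so 1 - N * girth is even, although q (- 4) / 4 is odd.
      noOneUnicyclic : α ≡ 1 → γ ≡ 0 → ε ≡ 1 → A ≡ 1 → B ≢ 2
      noOneUnicyclic α≡1 γ≡0 ε≡1 A≡1′ B≡2 = absurd (residue₂ A≡1′ γ≡0 B≡2) (q[-4] (κ≡0 (trans α≡1 (sym ε≡1)))) girth-odd
        where
        absurd : Residue₂ q ε (suc n ℕ.+ r ℕ.* 2) α →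
          eval q -[1+ 3 ] ≈ + 4 * (1ℤ - N * girth) [mod + 16 ] → ¬ Odd girth
        absurd (σ , o , q₄ , (a by o≡) , order) (l by q₄≡) (h by g≡) = 2*i≢1 (- h - b - + 2 * (b * h) + + 2 * l + a + 1ℤ) (sym (begin
          1ℤ
            ≡⟨ lemma₁ a ⟩
          - (1ℤ + + 2 * a) - + 2 * (- a - 1ℤ)
            ≡⟨ cong (_- + 2 * (- a - 1ℤ)) (trans (cong -_ (sym o≡)) -o≡) ⟩
          (1ℤ - N * girth + + 4 * l) - + 2 * (- a - 1ℤ)
            ≡⟨ cong₂ (λ x g → (1ℤ - x * g + + 4 * l) - + 2 * (- a - 1ℤ)) N≡ g≡ ⟩
          (1ℤ - (1ℤ + + 2 * b) * (1ℤ + + 2 * h) + + 4 * l) - + 2 * (- a - 1ℤ)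
            ≡⟨ lemma₂ b h l a ⟩
          + 2 * (- h - b - + 2 * (b * h) + + 2 * l + a + 1ℤ) ∎))
          where
          b : ℤ
          b = σ - + r
          lemma₁ : ∀ a → 1ℤ ≡ - (1ℤ + + 2 * a) - + 2 * (- a - 1ℤ)
          lemma₁ = solve-∀
          lemma₂ : ∀ b h l a → (1ℤ - (1ℤ + + 2 * b) * (1ℤ + + 2 * h) + + 4 * l) - + 2 * (- a - 1ℤ) ≡
            + 2 * (- h - b - + 2 * (b * h) + + 2 * l + a + 1ℤ)
          lemma₂ = solve-∀
          -o≡ : - o ≡ 1ℤ - N * girth + + 4 * l
          -o≡ = *-cancelˡ (+ 4) (- o) (1ℤ - N * girth + + 4 * l) (λ ()) (trans (lemma o) (trans (cong (λ e → -2ℤ ℤ.^ e * (+ 2 * o)) (sym ε≡1))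
            (trans (sym q₄) (trans q₄≡ (quarter (N * girth) l)))))
            where
            lemma : ∀ o → + 4 * - o ≡ -2ℤ * 1ℤ * (+ 2 * o)
            lemma = solve-∀
          N≡ : N ≡ 1ℤ + + 2 * b
          N≡ = begin
            N                                  ≡⟨ cancelOrder N (+ r) ⟩
            (N + + r * + 2) - + r * + 2        ≡⟨ cong (_- + r * + 2) (trans (sym order≡) (trans order (cong (λ a → + a + + 2 * σ) α≡1))) ⟩
            (1ℤ + + 2 * σ) - + r * + 2         ≡⟨ lemma σ (+ r) ⟩
            1ℤ + + 2 * b                       ∎
            where
            lemma : ∀ s r → (1ℤ + + 2 * s) - r * + 2 ≡ 1ℤ + + 2 * (s - r)
            lemma = solve-∀

      -- The unicyclic components have 2 * j = N + 2 vertices in total, whereas q (- 4) / 4 gives 2 * j ≡ N modulo 4.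
      noTwoUnicyclic : α ≡ 2 → γ ≡ 0 → ε ≡ 2 → A ≡ 1 → B ≢ 1
      noTwoUnicyclic α≡2 γ≡0 ε≡2 A≡1′ B≡1 = absurd (residue₁ A≡1′ γ≡0 B≡1) (q[-4] (κ≡0 (trans α≡2 (sym ε≡2)))) girth-odd
        where
        absurd : Residue₁ q ε (suc n ℕ.+ r ℕ.* 2) α β →
          eval q -[1+ 3 ] ≈ + 4 * (1ℤ - N * girth) [mod + 16 ] → ¬ Odd girth
        absurd (j , o , q₄ , (a by o≡) , order) (l by q₄≡) (h by g≡) =
          2*i≢1 (a - h + j * h - l) (*-cancelˡ (+ 2) (+ 2 * (a - h + j * h - l)) 1ℤ (λ ()) (begin
          + 2 * (+ 2 * (a - h + j * h - l))
            ≡⟨ lemma a h j l ⟩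
          (1ℤ - + 2 * j + + 4 * a) - (1ℤ - (+ 2 * j - + 2) * (1ℤ + + 2 * h) + + 4 * l) + + 2
            ≡⟨ cong₂ (λ x y → x - y + + 2) (sym o≡) (sym (trans o≡′ (cong₂ (λ x g → 1ℤ - x * g + + 4 * l) N≡ g≡))) ⟩
          o - o + + 2
            ≡⟨ cong (_+ + 2) (ℤ.+-inverseʳ o) ⟩
          + 2 * 1ℤ ∎))
          where
          lemma : ∀ a h j l → + 2 * (+ 2 * (a - h + j * h - l)) ≡
            (1ℤ - + 2 * j + + 4 * a) - (1ℤ - (+ 2 * j - + 2) * (1ℤ + + 2 * h) + + 4 * l) + + 2
          lemma = solve-∀
          o≡′ : o ≡ 1ℤ - N * girth + + 4 * l
          o≡′ = *-cancelˡ (+ 4) o (1ℤ - N * girth + + 4 * l) (λ ()) (trans (cong (λ e → -2ℤ ℤ.^ e * o) (sym ε≡2))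
            (trans (sym q₄) (trans q₄≡ (quarter (N * girth) l))))
          r≡ : + r ≡ + 2 + + β
          r≡ = trans (cong +_ (sym α+β≡r)) (trans (ℤ.pos-+ α β) (cong (λ a → + a + + β) α≡2))
          N≡ : N ≡ + 2 * j - + 2
          N≡ = begin
            N
              ≡⟨ cancelOrder N (+ r) ⟩
            (N + + r * + 2) - + r * + 2
              ≡⟨ cong₂ (λ x y → x - y * + 2) (trans (sym order≡) (trans order (cong (λ a → + 2 * j + (+ a + + 2 * + β)) α≡2))) r≡ ⟩
            (+ 2 * j + (+ 2 + + 2 * + β)) - (+ 2 + + β) * + 2
              ≡⟨ lemma′ j (+ β) ⟩
            + 2 * j - + 2 ∎
            where
            lemma′ : ∀ j b → (+ 2 * j + (+ 2 + + 2 * b)) - (+ 2 + b) * + 2 ≡ + 2 * j - + 2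
            lemma′ = solve-∀

      conclude : Outcome α γ ε A B → (G ⊔ rK₂ r) ≅ H
      conclude (matched α≡0 B≡1 one) = let (u , U , iso) = matching⁺ α≡0 B≡1 one in
        fromMatching U (subst (λ b → H ≃ U ⊔ rK₂ b) (trans (cong (ℕ._+ β) (sym α≡0)) α+β≡r) iso)
      conclude (forest α≡0 γ≡0 ε≡0 B≡4) = contradiction B≡4 (noForest α≡0 γ≡0 ε≡0)
      conclude (oneUnicyclic α≡1 γ≡0 ε≡1 A≡1 B≡2) = contradiction B≡2 (noOneUnicyclic α≡1 γ≡0 ε≡1 A≡1)
      conclude (twoUnicyclic α≡2 γ≡0 ε≡2 A≡1 B≡1) = contradiction B≡1 (noTwoUnicyclic α≡2 γ≡0 ε≡2 A≡1)

  ⊔-rK₂-isomorphic : (G ⊔ rK₂ r) ≅ H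
  ⊔-rK₂-isomorphic = [ (λ (k , b) → contradiction b (noExcess k)) , (λ s → conclude s (result s)) ]′ (summarize (components H))

theorem3p2 : ∀ (n : ℕ) (G : Graph n) → 7 ≤ n → OddUnicyclic G → DQS G →
    ∀ (r : ℕ) → 1 ≤ r → DQS (G ⊔ rK₂ r)
theorem3p2 (suc n) G n≥7 odd dqs r _ H cs with cospectral⇒order≡ (G ⊔ rK₂ r) H cs
... | refl = ⊔-rK₂-isomorphic G (oddUnicyclic⇒matrix G odd) (proj₂ (proj₁ odd)) dqs n≥7 r H cs
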